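{- Let \[J(t,u,v)=\sum_{n\ge 1}\sum_{\pi\in\mathcal W_2(n)}|s^{ -1}(\pi)|\,t^n u^{\mathrm{leg}(\pi)-1} v^{\mathrm{tl}(\pi)},\] and let $C(x)=\frac{1-\sqrt{1-4x}}{2x}=\sum_{n\ge0}\frac{1}{n+1}\binom{2n}{n}x^n$. Then, as formal power series, \[ J(t,u,v)=(C(tuv)-1)\bigl(1+tu\,J(t,u,1)\bigr)+\frac{tuv}{1-u}\left(\frac{J(t,u,1)-J(t,u,v)}{1-v}-\frac{C(tuv)-1}{v}\right)\left(\frac{J(t,1,1)-uv\,J(t,1,uv)}{1-uv}-u\,\frac{J(t,u,1)-v\,J(t,u,v)}{1-v}\right). \]
   Context: A permutation is an ordering of a finite set of positive integers; $S_n$ is the set of permutations of $\{1,\dots,n\}$. The stack-sorting map $s$ is defined recursively: $s$ sends the empty permutation to itself, and if $\pi$ is nonempty with largest entry $m$, written $\pi=LmR$, then $s(\pi)=s(L)\,s(R)\,m$. A permutation $\pi$ is $k$-stack-sortable if $s^k(\pi)$ is increasing; $\mathcal W_k(n)$ denotes the set of $k$-stack-sortable permutations in $S_n$. For $\pi\in S_n$, $s^{ -1}(\pi)$ is the set of $\sigma\in S_n$ with $s(\sigma)=\pi$. The tail length $\mathrm{tl}(\pi)$ of $\pi=\pi_1\cdots\pi_n\in S_n$ is the largest $\ell\in\{0,\dots,n\}$ with $\pi_i=i$ for all $i\in\{n-\ell+1,\dots,n\}$. For $a\in\{0,\dots,n\}$, the open interval $(a,a+1)$ is a legal space for $\pi$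 if there are no indices $i_1<i_2<i_3$ with $\pi_{i_3}\le a<\pi_{i_1}<\pi_{i_2}$; $\mathrm{leg}(\pi)$ is the number of legal spaces of $\pi$. The divided differences in the equation are interpreted as exact divisions of formal power series in $t$ with polynomial coefficients in $u,v$. -}

module Defs where

open import Data.Nat using (ℕ; zero; suc; _∸_; _⊔_; _≡ᵇ_; _<ᵇ_; _≤ᵇ_) renaming (_*_ to _*ℕ_; _/_ to _/ℕ_)
open import Data.Nat.Combinatorics using (_C_)
open import Data.Integer using (ℤ; +_; _+_; _-_; _*_)
open import Data.List using (List; []; _∷_; _++_; length; map; concatMap; foldr; applyUpTo; upTo; filterᵇ)
open import Data.Bool.ListAction using (all; any)
open import Data.Bool using (Bool; true; false; if_then_else_; _∧_; not)
open import Data.Product using (_×_; _,_; proj₁; proj₂)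

oneTo : ℕ → List ℕ
oneTo n = applyUpTo suc n

words : ℕ → ℕ → List (List ℕ)
words n zero    = [] ∷ []
words n (suc k) = concatMap (λ w → map (λ x → x ∷ w) (oneTo n)) (words n k)

elemᵇ : ℕ → List ℕ → Bool
elemᵇ x l = any (λ y → x ≡ᵇ y) l

S : ℕ → List (List ℕ)
S n = filterᵇ (λ w → all (λ i → elemᵇ i w) (oneTo n)) (words n n)

eqListᵇ : List ℕ → List ℕ → Bool
eqListᵇ []       []       = true
eqListᵇ []       (_ ∷ _)  = false
eqListᵇ (_ ∷ _)  []       = false
eqListᵇ (x ∷ xs) (y ∷ ys) = (x ≡ᵇ y) ∧ eqListᵇ xs ys

-- The stack-sorting map  s(L m R) = s(L) s(R) m

maxL : List ℕ → ℕ
maxL = foldr _⊔_ 0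

breakAt : ℕ → List ℕ → List ℕ × List ℕ
breakAt m []       = [] , []
breakAt m (x ∷ xs) with x ≡ᵇ m
... | true  = [] , xs
... | false = x ∷ proj₁ (breakAt m xs) , proj₂ (breakAt m xs)

-- fuel-indexed recursion (fuel = length suffices since |L|,|R| < |LmR|)
sFuel : ℕ → List ℕ → List ℕ
sFuel _       []       = []
sFuel zero    (x ∷ xs) = x ∷ xs
sFuel (suc k) (x ∷ xs) =
  sFuel k (proj₁ (breakAt (maxL (x ∷ xs)) (x ∷ xs)))
  ++ sFuel k (proj₂ (breakAt (maxL (x ∷ xs)) (x ∷ xs)))
  ++ (maxL (x ∷ xs) ∷ [])

s : List ℕ → List ℕ
s π = sFuel (length π) π

sIter : ℕ → List ℕ → List ℕ
sIter zero    π = π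
sIter (suc k) π = s (sIter k π)

increasingᵇ : List ℕ → Bool
increasingᵇ []           = true
increasingᵇ (x ∷ [])     = true
increasingᵇ (x ∷ y ∷ r)  = (x <ᵇ y) ∧ increasingᵇ (y ∷ r)

sortableᵇ : ℕ → List ℕ → Bool
sortableᵇ k π = increasingᵇ (sIter k π)

W : ℕ → ℕ → List (List ℕ)
W k n = filterᵇ (sortableᵇ k) (S n)

preimageCount : ℕ → List ℕ → ℕ
preimageCount n π = length (filterᵇ (λ σ → eqListᵇ (s σ) π) (S n))

-- 1-based entry π_i (0 if out of range)
at : List ℕ → ℕ → ℕ
at []       _             = 0
at (x ∷ xs) zero          = 0
at (x ∷ xs) (suc zero)    = x
at (x ∷ xs) (suc (suc i)) = at xs (suc i)

tailOKᵇ : List ℕ → ℕ → Bool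
tailOKᵇ π ℓ = all (λ i → if (length π ∸ ℓ) <ᵇ i then at π i ≡ᵇ i else true) (oneTo (length π))

tl : List ℕ → ℕ
tl π = maxL (filterᵇ (tailOKᵇ π) (upTo (suc (length π))))

-- (a, a+1) is a legal space: no i1<i2<i3 with π_{i3} ≤ a < π_{i1} < π_{i2}
legalᵇ : List ℕ → ℕ → Bool
legalᵇ π a = not (any (λ i₁ → any (λ i₂ → any (λ i₃ →
    (i₁ <ᵇ i₂) ∧ (i₂ <ᵇ i₃) ∧ (at π i₃ ≤ᵇ a) ∧ (a <ᵇ at π i₁) ∧ (at π i₁ <ᵇ at π i₂))
    (oneTo (length π))) (oneTo (length π))) (oneTo (length π)))

leg : List ℕ → ℕ
leg π = length (filterᵇ (legalᵇ π) (upTo (suc (length π))))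

-- Formal power series in t, u, v with integer coefficients:
-- f n a b is the coefficient of t^n u^a v^b.

Series : Set
Series = ℕ → ℕ → ℕ → ℤ

_≋_ : Series → Series → Set
f ≋ g = ∀ n a b → f n a b ≡ g n a b
  where open import Relation.Binary.PropositionalEquality using (_≡_)

infix 4 _≋_
infixl 6 _⊕_ _⊖_
infixl 7 _⊛_

_⊕_ : Series → Series → Series
(f ⊕ g) n a b = f n a b + g n a b

_⊖_ : Series → Series → Series
(f ⊖ g) n a b = f n a b - g n a b

sumTo : ℕ → (ℕ → ℤ) → ℤ
sumTo zero    f = f zero
sumTo (suc n) f = sumTo n f + f (suc n)

_⊛_ : Series → Series → Series
(f ⊛ g) n a b = sumTo n λ i → sumTo a λ j → sumTo b λ k →
  f i j k * g (n ∸ i) (a ∸ j) (b ∸ k)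

mono : ℕ → ℕ → ℕ → Series
mono i j k n a b = if (n ≡ᵇ i) ∧ (a ≡ᵇ j) ∧ (b ≡ᵇ k) then + 1 else + 0

𝟙 tS uS vS : Series
𝟙  = mono 0 0 0
tS = mono 1 0 0
uS = mono 0 1 0
vS = mono 0 0 1

inv1-u inv1-v inv1-uv : Series
inv1-u  n a b = if (n ≡ᵇ 0) ∧ (b ≡ᵇ 0) then + 1 else + 0
inv1-v  n a b = if (n ≡ᵇ 0) ∧ (a ≡ᵇ 0) then + 1 else + 0
inv1-uv n a b = if (n ≡ᵇ 0) ∧ (a ≡ᵇ b) then + 1 else + 0

-- exact division by v (used only on series with no v^0 terms)
divV : Series → Series
divV f n a b = f n a (suc b)

catalan : ℕ → ℕ
catalan n = ((2 *ℕ n) C n) /ℕ suc n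

Ctuv : Series
Ctuv n a b = if (a ≡ᵇ n) ∧ (b ≡ᵇ n) then + catalan n else + 0

-- J with a substitution applied to the monomial u^(leg π - 1) v^(tl π):
-- φ (leg π - 1) (tl π) = (exponent of u, exponent of v) after substitution.

sumℕ : List ℕ → ℕ
sumℕ = foldr Data.Nat._+_ 0
  where import Data.Nat

Jsub : (ℕ → ℕ → ℕ × ℕ) → Series
Jsub φ zero    a b = + 0
Jsub φ (suc m) a b = + sumℕ (map (λ π →
    if (proj₁ (φ (leg π ∸ 1) (tl π)) ≡ᵇ a) ∧ (proj₂ (φ (leg π ∸ 1) (tl π)) ≡ᵇ b)
    then preimageCount (suc m) π else 0)
  (W 2 (suc m)))

J Ju1 J11 J1uv : Series
J    = Jsub (λ x y → x , y)
Ju1  = Jsub (λ x y → x , 0)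
J11  = Jsub (λ x y → 0 , 0)
J1uv = Jsub (λ x y → y , y)

-- For m larger than all entries of X, the fertility N(π) = |s⁻¹(π)| satisfies
-- N(X m) = Σ N(α) N(β) over the factorisations X = αβ. By induction on k,
--   N(L m R m+1 ⋯ m+k) = Σ_{i+j=k-1} N(L m m+1 ⋯ m+i) N(R m+1 ⋯ m+j)
-- whenever R is nonempty and L, R < m. Moreover L m R with L, R nonempty is 2-stack-sortable
-- iff L and R are, every entry of L except its maximum lies below R, and max L sits in a legal
-- space of R; with c legal spaces of R from that one on, leg(L m R) = leg(L) + c. So for
-- h_b = Σ N(π n+1 ⋯ n+b) tⁿ u^(leg π - 1), summed over the 2-stack-sortable π in S_n, n ≥ 0,
--   h_b = C_b + tu h_{b+1} + tu Σ_{k+l=b-1} (C_{k+1} h⁺_l + h⁺_{k+1} g⁺_l),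
-- where C_b is the Catalan number N(1 ⋯ b), ⁺ drops the empty permutation, and g replaces
-- u^(leg π - 1) by 1 + u + ⋯ + u^(leg π - 1). A permutation of tail length at least b has the form
-- π n+1 ⋯ n+b, and the tail raises leg by b; hence Σ h_b vᵇ, Σ g_b vᵇ become the divided differences
-- of J under v ↦ tuv, and the recurrence becomes the functional equation.
module Submission where

open import Level using (0ℓ)
open import Algebra using (CommutativeRing)
import Algebra.Properties.CommutativeSemigroup as CSG
import Algebra.Properties.Group as GroupProps
import Algebra.Solver.Ring.NaturalCoefficients.Default as SemiringSolver
open import Data.Bool using (Bool; true; false; T; not; if_then_else_; _∧_)
open import Data.Bool.ListAction using (any; all)
import Data.Bool.Properties as Bₚ
open import Data.Empty using (⊥-elim)
open import Data.Integer as ℤ using (ℤ; +_)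
import Data.Integer.Properties as ℤₚ
import Data.Integer.Tactic.RingSolver as ℤSolver
open import Data.List using (List; []; _∷_; [_]; _++_; _∷ʳ_; length; map; concatMap; applyUpTo; upTo; filterᵇ; InitLast; _∷ʳ′_; initLast)
import Data.List.Properties as Lₚ
open import Data.List.Membership.Propositional using (_∈_; _∉_; find; lose)
open import Data.List.Membership.Propositional.Properties
  using (∈-++⁺ˡ; ∈-++⁺ʳ; ∈-++⁻; ∈-map⁺; ∈-map⁻; ∈-filter⁺; ∈-filter⁻; ∈-concatMap⁺; ∈-concatMap⁻; ∈-upTo⁺; ∈-upTo⁻; ∈-∃++)
open import Data.List.Relation.Binary.BagAndSetEquality using (∼bag⇒↭)
open import Data.List.Membership.Propositional.Properties.WithK using (unique∧set⇒bag)
open import Data.List.Relation.Binary.Permutation.Propositional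
  using (_↭_; ↭-refl; ↭-sym; ↭-trans; ↭-prep; ↭-reflexive)
import Data.List.Relation.Binary.Permutation.Propositional as Perm
import Data.List.Relation.Binary.Permutation.Propositional.Properties as Permₚ
open import Data.List.Relation.Unary.All as All using (All; []; _∷_)
import Data.List.Relation.Unary.All.Properties as Allₚ
open import Data.List.Relation.Unary.AllPairs as AllPairs using (AllPairs; []; _∷_)
import Data.List.Relation.Unary.AllPairs.Properties as AllPairsₚ
open import Data.List.Relation.Unary.Any as Any using (Any; here; there)
import Data.List.Relation.Unary.Any.Properties as Anyₚ
open import Data.List.Relation.Unary.Unique.Propositional using (Unique)
import Data.List.Relation.Unary.Unique.Propositional.Properties as Uniqueₚ
open import Data.Nat as ℕ using (ℕ; zero; suc; _∸_; _!; _≤_; _<_; z≤n; s≤s; _⊔_; _⊓_; _≡ᵇ_; _<ᵇ_; _≤ᵇ_)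
open import Data.Nat.Combinatorics as Comb using (k![n∸k]!∣n!; nCk≡n!/k![n-k]!)
import Data.Nat.DivMod as DivMod
import Data.Nat.Properties as ℕₚ
import Data.Nat.Tactic.RingSolver as ℕSolver
open import Data.Product using (_×_; _,_; proj₁; proj₂; ∃-syntax; Σ-syntax)
open import Data.Sum using (_⊎_; inj₁; inj₂)
open import Data.Unit using (tt)
open import Function using (_∘_; _on_; id; case_of_)
open import Function.Bundles using (_⇔_; mk⇔; Equivalence)
open import Relation.Binary.PropositionalEquality
  using (_≡_; _≢_; refl; sym; trans; cong; cong₂; subst; subst₂; module ≡-Reasoning)
open import Relation.Binary.Definitions using (tri<; tri≈; tri>)
import Relation.Binary.Reasoning.Setoid as SetoidReasoning
open import Relation.Nullary using (¬_; yes; no; contradiction)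
open import Defs

-- Power series in one variable

-- If R is nonempty, L m R ends below its maximum and has no preimage at all, so its own fertility
-- cannot reflect those of L and R. Hooks from m exist only once a tail is appended; this is why
-- every sum carries a tail length b as an extra parameter. The permutation in front of the tail is
-- arbitrary and may itself end in a tail, so such a sum collects tail length at least b, and the
-- recurrence never has to ask where the tail stops. Tail length exactly b comes back as a
-- difference of neighbouring coefficients. Sortability and legality are brought to one form: both
-- are conditions on ordered pairs of entries in an output of `s`, and such conditions split at the
-- maximum. No series is ever divided. Each quotient of the equation is a series already at hand,
-- recognised by the first-order linear recurrence of its coefficients.

module PowerSeries (A : CommutativeRing 0ℓ 0ℓ) where
  open CommutativeRing A hiding (zero; setoid)
    renaming (refl to ≈-refl; sym to ≈-sym; trans to ≈-trans)
  open SetoidReasoning (CommutativeRing.setoid A)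
  open CSG +-commutativeSemigroup using () renaming (interchange to +-interchange)

  PSC : Set
  PSC = ℕ → Carrier

  _≈ₚ_ : PSC → PSC → Set
  f ≈ₚ g = ∀ n → f n ≈ g n

  -- Peeling the constant term off the left factor, instead of summing over i + j = n, makes every
  -- ring law an induction on n without index arithmetic. `sumUpTo-mul` reconnects it with the
  -- convolution sums of `_⊛_`.
  mul : PSC → PSC → PSC
  mul f g zero    = f 0 * g 0
  mul f g (suc n) = f 0 * g (suc n) + mul (f ∘ suc) g n

  mul-cong : ∀ {f f′ g g′} → f ≈ₚ f′ → g ≈ₚ g′ → mul f g ≈ₚ mul f′ g′
  mul-cong p q zero    = *-cong (p 0) (q 0)
  mul-cong p q (suc n) = +-cong (*-cong (p 0) (q (suc n))) (mul-cong (p ∘ suc) q n)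

  mul-zeroˡ : ∀ {f} g → (∀ i → f i ≈ 0#) → ∀ n → mul f g n ≈ 0#
  mul-zeroˡ g p zero    = ≈-trans (*-congʳ (p 0)) (zeroˡ _)
  mul-zeroˡ g p (suc n) =
    ≈-trans (+-cong (≈-trans (*-congʳ (p 0)) (zeroˡ _)) (mul-zeroˡ g (p ∘ suc) n)) (+-identityˡ 0#)

  mul-sucʳ : ∀ f g n → mul f g (suc n) ≈ mul f (g ∘ suc) n + f (suc n) * g 0
  mul-sucʳ f g zero    = ≈-refl
  mul-sucʳ f g (suc n) = ≈-trans (+-congˡ (mul-sucʳ (f ∘ suc) g n)) (≈-sym (+-assoc _ _ _))

  mul-comm : ∀ f g → mul f g ≈ₚ mul g f
  mul-comm f g zero    = *-comm _ _
  mul-comm f g (suc n) = begin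
    f 0 * g (suc n) + mul (f ∘ suc) g n ≈⟨ +-cong (*-comm _ _) (mul-comm (f ∘ suc) g n) ⟩
    g (suc n) * f 0 + mul g (f ∘ suc) n ≈⟨ +-comm _ _ ⟩
    mul g (f ∘ suc) n + g (suc n) * f 0 ≈⟨ ≈-sym (mul-sucʳ g f n) ⟩
    mul g f (suc n)                     ∎

  mul-distribʳ : ∀ h f g n → mul (λ i → f i + g i) h n ≈ mul f h n + mul g h n
  mul-distribʳ h f g zero    = distribʳ _ _ _
  mul-distribʳ h f g (suc n) = begin
    (f 0 + g 0) * h (suc n) + mul (λ i → f (suc i) + g (suc i)) h n
      ≈⟨ +-cong (distribʳ _ _ _) (mul-distribʳ h (f ∘ suc) (g ∘ suc) n) ⟩
    (f 0 * h (suc n) + g 0 * h (suc n)) + (mul (f ∘ suc) h n + mul (g ∘ suc) h n)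
      ≈⟨ +-interchange _ _ _ _ ⟩
    mul f h (suc n) + mul g h (suc n) ∎

  mul-scaleˡ : ∀ c f g n → mul (λ i → c * f i) g n ≈ c * mul f g n
  mul-scaleˡ c f g zero    = *-assoc _ _ _
  mul-scaleˡ c f g (suc n) =
    ≈-trans (+-cong (*-assoc _ _ _) (mul-scaleˡ c (f ∘ suc) g n)) (≈-sym (distribˡ _ _ _))

  mul-assoc : ∀ f g h n → mul (mul f g) h n ≈ mul f (mul g h) n
  mul-assoc f g h zero    = *-assoc _ _ _
  mul-assoc f g h (suc n) = begin
    (f 0 * g 0) * h (suc n) + mul (λ i → f 0 * g (suc i) + mul (f ∘ suc) g i) h n
      ≈⟨ +-cong (*-assoc _ _ _) (mul-distribʳ h (λ i → f 0 * g (suc i)) (mul (f ∘ suc) g) n) ⟩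
    f 0 * (g 0 * h (suc n)) + (mul (λ i → f 0 * g (suc i)) h n + mul (mul (f ∘ suc) g) h n)
      ≈⟨ +-congˡ (+-cong (mul-scaleˡ (f 0) (g ∘ suc) h n) (mul-assoc (f ∘ suc) g h n)) ⟩
    f 0 * (g 0 * h (suc n)) + (f 0 * mul (g ∘ suc) h n + mul (f ∘ suc) (mul g h) n)
      ≈⟨ ≈-sym (+-assoc _ _ _) ⟩
    (f 0 * (g 0 * h (suc n)) + f 0 * mul (g ∘ suc) h n) + mul (f ∘ suc) (mul g h) n
      ≈⟨ +-congʳ (≈-sym (distribˡ _ _ _)) ⟩
    mul f (mul g h) (suc n) ∎

  const : Carrier → PSC
  const c zero    = c
  const c (suc n) = 0#

  mul-const : ∀ c f n → mul (const c) f n ≈ c * f n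
  mul-const c f zero    = ≈-refl
  mul-const c f (suc n) = ≈-trans (+-congˡ (mul-zeroˡ f (λ _ → ≈-refl) n)) (+-identityʳ _)

  mul-identityˡ : ∀ f → mul (const 1#) f ≈ₚ f
  mul-identityˡ f n = ≈-trans (mul-const 1# f n) (*-identityˡ _)

  -- The result is again a ring of the kind taken as parameter, so the construction can be iterated
  -- over the integers to give series in u, t and v.
  psRing : CommutativeRing 0ℓ 0ℓ
  psRing = record
    { Carrier = PSC
    ; _≈_ = _≈ₚ_
    ; _+_ = λ f g n → f n + g n
    ; _*_ = mul
    ; -_ = λ f n → - f n
    ; 0# = λ _ → 0#
    ; 1# = const 1#
    ; isCommutativeRing = record
      { isRing = record
        { +-isAbelianGroup = record
          { isGroup = record
            { isMonoid = record
              { isSemigroup = record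
                { isMagma = record
                  { isEquivalence = record
                    { refl = λ _ → ≈-refl
                    ; sym = λ p n → ≈-sym (p n)
                    ; trans = λ p q n → ≈-trans (p n) (q n) }
                  ; ∙-cong = λ p q n → +-cong (p n) (q n) }
                ; assoc = λ f g h n → +-assoc _ _ _ }
              ; identity = (λ f n → +-identityˡ _) , (λ f n → +-identityʳ _) }
            ; inverse = (λ f n → -‿inverseˡ _) , (λ f n → -‿inverseʳ _)
            ; ⁻¹-cong = λ p n → -‿cong (p n) }
          ; comm = λ f g n → +-comm _ _ }
        ; *-cong = mul-cong
        ; *-assoc = mul-assoc
        ; *-identity = mul-identityˡ
                     , λ f n → ≈-trans (mul-comm f (const 1#) n) (mul-identityˡ f n)
        ; distrib = (λ h f g n → ≈-trans (mul-comm h (λ i → f i + g i) n)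
                      (≈-trans (mul-distribʳ h f g n) (+-cong (mul-comm f h n) (mul-comm g h n))))
                  , mul-distribʳ }
      ; *-comm = mul-comm } }

  shift : PSC → PSC
  shift f zero    = 0#
  shift f (suc n) = f n

  X : PSC
  X = shift (const 1#)

  mul-X : ∀ f → mul X f ≈ₚ shift f
  mul-X f zero    = zeroˡ _
  mul-X f (suc n) = ≈-trans (+-cong (zeroˡ _) (mul-identityˡ f n)) (+-identityˡ _)

  shift-cong : ∀ {f g} → f ≈ₚ g → shift f ≈ₚ shift g
  shift-cong p zero    = ≈-refl
  shift-cong p (suc n) = p n

  shift-+ : ∀ f g → shift (λ i → f i + g i) ≈ₚ λ n → shift f n + shift g n
  shift-+ f g zero    = ≈-sym (+-identityˡ 0#)
  shift-+ f g (suc n) = ≈-refl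

  mul-shiftˡ : ∀ f g → mul (shift f) g ≈ₚ shift (mul f g)
  mul-shiftˡ f g zero    = zeroˡ _
  mul-shiftˡ f g (suc n) = ≈-trans (+-congʳ (zeroˡ _)) (+-identityˡ _)

  const-+ : ∀ c d → const (c + d) ≈ₚ λ n → const c n + const d n
  const-+ c d zero    = ≈-refl
  const-+ c d (suc n) = ≈-sym (+-identityˡ _)

  const-* : ∀ c d → const (c * d) ≈ₚ mul (const c) (const d)
  const-* c d zero    = ≈-refl
  const-* c d (suc n) = ≈-sym (≈-trans (mul-const c (const d) (suc n)) (zeroʳ c))

  pow : Carrier → PSC
  pow c zero    = 1#
  pow c (suc n) = c * pow c n

  -- The substitution X ↦ cX.
  scale : Carrier → PSC → PSC
  scale c f n = pow c n * f n

  -- The power cⁿ distributes over i + j = n. For c = tu this turns convolutions in the tail length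
  -- into products of generating functions.
  scale-mul : ∀ c f g n → scale c (mul f g) n ≈ mul (scale c f) (scale c g) n
  scale-mul c f g zero    = ≈-trans (*-identityˡ _) (≈-sym (*-cong (*-identityˡ _) (*-identityˡ _)))
  scale-mul c f g (suc n) = begin
    pow c (suc n) * (f 0 * g (suc n) + mul (f ∘ suc) g n)
      ≈⟨ distribˡ _ _ _ ⟩
    pow c (suc n) * (f 0 * g (suc n)) + (c * pow c n) * mul (f ∘ suc) g n
      ≈⟨ +-cong (M.x∙yz≈y∙xz _ _ _) (*-assoc _ _ _) ⟩
    f 0 * scale c g (suc n) + c * scale c (mul (f ∘ suc) g) n
      ≈⟨ +-cong (≈-sym (*-congʳ (*-identityˡ _))) (*-congˡ (scale-mul c (f ∘ suc) g n)) ⟩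
    scale c f 0 * scale c g (suc n) + c * mul (scale c (f ∘ suc)) (scale c g) n
      ≈⟨ +-congˡ (≈-sym (mul-scaleˡ c (scale c (f ∘ suc)) (scale c g) n)) ⟩
    scale c f 0 * scale c g (suc n) + mul (λ i → c * (pow c i * f (suc i))) (scale c g) n
      ≈⟨ +-congˡ (mul-cong (λ i → ≈-sym (*-assoc _ _ _)) (λ _ → ≈-refl) n) ⟩
    mul (scale c f) (scale c g) (suc n) ∎
    where module M = CSG *-commutativeSemigroup

  -- pow c is 1/(1 - cX), and the hypotheses say that (1 - cX) g = f.
  geometric : ∀ c f g → (∀ n → g (suc n) ≈ f (suc n) + c * g n) → g 0 ≈ f 0 → mul (pow c) f ≈ₚ g
  geometric c f g p q zero    = ≈-trans (*-identityˡ _) (≈-sym q)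
  geometric c f g p q (suc n) = begin
    1# * f (suc n) + mul (λ i → c * pow c i) f n
      ≈⟨ +-cong (*-identityˡ _) (mul-scaleˡ c (pow c) f n) ⟩
    f (suc n) + c * mul (pow c) f n
      ≈⟨ +-congˡ (*-congˡ (geometric c f g p q n)) ⟩
    f (suc n) + c * g n
      ≈⟨ ≈-sym (p n) ⟩
    g (suc n) ∎

  sumUpTo : ℕ → (ℕ → Carrier) → Carrier
  sumUpTo zero    f = f 0
  sumUpTo (suc n) f = sumUpTo n f + f (suc n)

  sumUpTo-shift : ∀ n f → sumUpTo (suc n) f ≈ f 0 + sumUpTo n (f ∘ suc)
  sumUpTo-shift zero    f = ≈-refl
  sumUpTo-shift (suc n) f = ≈-trans (+-congʳ (sumUpTo-shift n f)) (+-assoc _ _ _)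

  sumUpTo-mul : ∀ n f g → sumUpTo n (λ i → f i * g (n ∸ i)) ≈ mul f g n
  sumUpTo-mul zero    f g = ≈-refl
  sumUpTo-mul (suc n) f g =
    ≈-trans (sumUpTo-shift n _) (+-congˡ (sumUpTo-mul n (f ∘ suc) g))

-- Catalan numbers

module U = PowerSeries ℤₚ.+-*-commutativeRing

-- Here y stands for the Catalan series and w for x y′; the hypothesis on w is the derivative of the
-- one on y. The conclusion of `linearise` has no products of y and w, hence yields a two-term
-- recurrence for the coefficients.
module QuadraticODE (A : CommutativeRing 0ℓ 0ℓ) where
  open CommutativeRing A hiding (zero; setoid)
    renaming (refl to ≈-refl; sym to ≈-sym; trans to ≈-trans)
  open SemiringSolver commutativeSemiring
  private
    open SetoidReasoning (CommutativeRing.setoid A)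
    module G = GroupProps +-group

  -- With a = 1 - 2xy and b = 1 + 2xy + 4xw, the difference of the two sides is
  -- a (w - (xy² + 2xyw)) + b (y - (1 + xy²)).
  linearise : ∀ x y w → y ≈ 1# + x * (y * y) → w ≈ x * (y * y) + (x * (y * w) + x * (y * w)) →
    w + y ≈ 1# + ((x * y + x * y) + (x * w + x * w + (x * w + x * w)))
  linearise x y w e₁ e₂ = G.∙-cancelʳ _ _ _ (begin
    (w + y) + ((w + (x * y + x * y) * w) + b * y)
      ≈⟨ +-congˡ (+-cong (+-congʳ e₂) (*-congˡ e₁)) ⟩
    (w + y) + (((x * (y * y) + (x * (y * w) + x * (y * w))) + (x * y + x * y) * w) + b * (1# + x * (y * y)))
      ≈⟨ solve 3 (λ x y w →
           let b = con 1 :+ ((x :* y :+ x :* y) :+ (x :* w :+ x :* w :+ (x :* w :+ x :* w)))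
               e = x :* (y :* y) :+ (x :* (y :* w) :+ x :* (y :* w)) in
           (w :+ y) :+ ((e :+ (x :* y :+ x :* y) :* w) :+ b :* (con 1 :+ x :* (y :* y)))
           := b :+ ((w :+ (x :* y :+ x :* y) :* e) :+ b :* y)) ≈-refl x y w ⟩
    b + ((w + (x * y + x * y) * (x * (y * y) + (x * (y * w) + x * (y * w)))) + b * y)
      ≈⟨ +-congˡ (+-congʳ (+-congˡ (*-congˡ (≈-sym e₂)))) ⟩
    b + ((w + (x * y + x * y) * w) + b * y) ∎)
    where
    b = 1# + ((x * y + x * y) + (x * w + x * w + (x * w + x * w)))

module CatalanSeries (f : ℕ → ℤ) (f0 : f 0 ≡ + 1) (fS : ∀ n → f (suc n) ≡ U.mul f f n) where
  private
    -- The Euler operator x d/dx. It is a derivation (`θ-mul`), so the equation f = 1 + x f² can be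
    -- differentiated within integer series.
    θ : (ℕ → ℤ) → ℕ → ℤ
    θ g n = + n ℤ.* g n

    θ-mul : ∀ g h n → θ (U.mul g h) n ≡ U.mul (θ g) h n ℤ.+ U.mul g (θ h) n
    θ-mul g h zero = eq (g 0) (h 0)
      where
      eq : ∀ x y → + 0 ℤ.* (x ℤ.* y) ≡ (+ 0 ℤ.* x) ℤ.* y ℤ.+ x ℤ.* (+ 0 ℤ.* y)
      eq = ℤSolver.solve-∀
    θ-mul g h (suc n) = begin
      + suc n ℤ.* (g 0 ℤ.* h (suc n) ℤ.+ U.mul (g ∘ suc) h n)
        ≡⟨ eq₁ (g 0) (h (suc n)) (U.mul (g ∘ suc) h n) (+ n) ⟩
      (g 0 ℤ.* (+ suc n ℤ.* h (suc n)) ℤ.+ θ (U.mul (g ∘ suc) h) n) ℤ.+ U.mul (g ∘ suc) h n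
        ≡⟨ cong (λ z → (g 0 ℤ.* (+ suc n ℤ.* h (suc n)) ℤ.+ z) ℤ.+ U.mul (g ∘ suc) h n)
             (θ-mul (g ∘ suc) h n) ⟩
      (g 0 ℤ.* (+ suc n ℤ.* h (suc n)) ℤ.+ (U.mul (θ (g ∘ suc)) h n ℤ.+ U.mul (g ∘ suc) (θ h) n))
        ℤ.+ U.mul (g ∘ suc) h n
        ≡⟨ eq₂ (g 0) (h (suc n)) (+ suc n ℤ.* h (suc n))
             (U.mul (θ (g ∘ suc)) h n) (U.mul (g ∘ suc) (θ h) n) (U.mul (g ∘ suc) h n) ⟩
      ((+ 0 ℤ.* g 0) ℤ.* h (suc n) ℤ.+ (U.mul (θ (g ∘ suc)) h n ℤ.+ U.mul (g ∘ suc) h n))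
        ℤ.+ U.mul g (θ h) (suc n)
        ≡⟨ cong (λ z → ((+ 0 ℤ.* g 0) ℤ.* h (suc n) ℤ.+ z) ℤ.+ U.mul g (θ h) (suc n))
             (trans (sym (U.mul-distribʳ h (θ (g ∘ suc)) (g ∘ suc) n))
                    (U.mul-cong (λ i → eq₃ (+ i) (g (suc i))) (λ _ → refl) n)) ⟩
      U.mul (θ g) h (suc n) ℤ.+ U.mul g (θ h) (suc n) ∎
      where
      open ≡-Reasoning
      eq₁ : ∀ a b m i → (+ 1 ℤ.+ i) ℤ.* (a ℤ.* b ℤ.+ m) ≡ (a ℤ.* ((+ 1 ℤ.+ i) ℤ.* b) ℤ.+ i ℤ.* m) ℤ.+ m
      eq₁ = ℤSolver.solve-∀
      eq₂ : ∀ a b c p q r → (a ℤ.* c ℤ.+ (p ℤ.+ q)) ℤ.+ r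
        ≡ ((+ 0 ℤ.* a) ℤ.* b ℤ.+ (p ℤ.+ r)) ℤ.+ (a ℤ.* c ℤ.+ q)
      eq₂ = ℤSolver.solve-∀
      eq₃ : ∀ i a → i ℤ.* a ℤ.+ a ≡ (+ 1 ℤ.+ i) ℤ.* a
      eq₃ = ℤSolver.solve-∀

    f≈ : ∀ n → f n ≡ U.const (+ 1) n ℤ.+ U.mul U.X (U.mul f f) n
    f≈ zero    = f0
    f≈ (suc n) = trans (fS n) (sym (trans (ℤₚ.+-identityˡ _) (U.mul-X (U.mul f f) (suc n))))

    θf≈ : ∀ n → θ f n ≡ U.mul U.X (U.mul f f) n
      ℤ.+ (U.mul U.X (U.mul f (θ f)) n ℤ.+ U.mul U.X (U.mul f (θ f)) n)
    θf≈ zero    = refl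
    θf≈ (suc n) = begin
      + suc n ℤ.* f (suc n)
        ≡⟨ cong (+ suc n ℤ.*_) (fS n) ⟩
      + suc n ℤ.* U.mul f f n
        ≡⟨ eq (+ n) _ ⟩
      U.mul f f n ℤ.+ θ (U.mul f f) n
        ≡⟨ cong (λ z → U.mul f f n ℤ.+ z)
             (trans (θ-mul f f n) (cong (λ z → z ℤ.+ U.mul f (θ f) n) (U.mul-comm (θ f) f n))) ⟩
      U.mul f f n ℤ.+ (U.mul f (θ f) n ℤ.+ U.mul f (θ f) n)
        ≡⟨ sym (cong₂ ℤ._+_ (U.mul-X (U.mul f f) (suc n))
             (cong₂ ℤ._+_ (U.mul-X (U.mul f (θ f)) (suc n)) (U.mul-X (U.mul f (θ f)) (suc n)))) ⟩
      _ ∎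
      where
      open ≡-Reasoning
      eq : ∀ i a → (+ 1 ℤ.+ i) ℤ.* a ≡ a ℤ.+ i ℤ.* a
      eq = ℤSolver.solve-∀

    -- The coefficient of x^(n+1) in the linear equation of `linearise`, with w = θ f.
    recurrence : ∀ n → + (2 ℕ.+ n) ℤ.* f (suc n) ≡ + (2 ℕ.+ 4 ℕ.* n) ℤ.* f n
    recurrence n = begin
      + (2 ℕ.+ n) ℤ.* f (suc n)
        ≡⟨ eq₁ (+ n) (f (suc n)) ⟩
      θ f (suc n) ℤ.+ f (suc n)
        ≡⟨ QuadraticODE.linearise U.psRing U.X f (θ f) f≈ θf≈ (suc n) ⟩
      + 0 ℤ.+ ((U.mul U.X f (suc n) ℤ.+ U.mul U.X f (suc n)) ℤ.+
        (U.mul U.X (θ f) (suc n) ℤ.+ U.mul U.X (θ f) (suc n)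
          ℤ.+ (U.mul U.X (θ f) (suc n) ℤ.+ U.mul U.X (θ f) (suc n))))
        ≡⟨ cong₂ (λ a b → + 0 ℤ.+ ((a ℤ.+ a) ℤ.+ ((b ℤ.+ b) ℤ.+ (b ℤ.+ b))))
             (U.mul-X f (suc n)) (U.mul-X (θ f) (suc n)) ⟩
      + 0 ℤ.+ ((f n ℤ.+ f n) ℤ.+ ((θ f n ℤ.+ θ f n) ℤ.+ (θ f n ℤ.+ θ f n)))
        ≡⟨ eq₂ (+ n) (f n) ⟩
      (+ 2 ℤ.+ + 4 ℤ.* + n) ℤ.* f n
        ≡⟨ cong (λ z → (+ 2 ℤ.+ z) ℤ.* f n) (sym (ℤₚ.pos-* 4 n)) ⟩
      + (2 ℕ.+ 4 ℕ.* n) ℤ.* f n ∎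
      where
      open ≡-Reasoning
      eq₁ : ∀ i a → (+ 2 ℤ.+ i) ℤ.* a ≡ (+ 1 ℤ.+ i) ℤ.* a ℤ.+ a
      eq₁ = ℤSolver.solve-∀
      eq₂ : ∀ i a → + 0 ℤ.+ ((a ℤ.+ a) ℤ.+ ((i ℤ.* a ℤ.+ i ℤ.* a) ℤ.+ (i ℤ.* a ℤ.+ i ℤ.* a)))
        ≡ (+ 2 ℤ.+ + 4 ℤ.* i) ℤ.* a
      eq₂ = ℤSolver.solve-∀

    -- With denominators cleared, `recurrence` gives this by induction in the integers; the
    -- truncating division in `catalan` is met only in `≡catalan`, where it is exact.
    factorial-form : ∀ n → + suc n ℤ.* f n ℤ.* + (n ! ℕ.* n !) ≡ + ((2 ℕ.* n) !)
    factorial-form zero rewrite f0 = refl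
    factorial-form (suc n) = begin
      + (2 ℕ.+ n) ℤ.* f (suc n) ℤ.* + (suc n ! ℕ.* suc n !)
        ≡⟨ cong₂ ℤ._*_ (recurrence n) (trans (cong +_ (eq₁ n (n !)))
             (trans (ℤₚ.pos-* (suc n ℕ.* suc n) _)
               (cong (ℤ._* + (n ! ℕ.* n !)) (ℤₚ.pos-* (suc n) (suc n))))) ⟩
      + (2 ℕ.+ 4 ℕ.* n) ℤ.* f n ℤ.* (+ suc n ℤ.* + suc n ℤ.* + (n ! ℕ.* n !))
        ≡⟨ eq₂ (+ (2 ℕ.+ 4 ℕ.* n)) (f n) (+ suc n) (+ (n ! ℕ.* n !)) ⟩
      + (2 ℕ.+ 4 ℕ.* n) ℤ.* + suc n ℤ.* (+ suc n ℤ.* f n ℤ.* + (n ! ℕ.* n !))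
        ≡⟨ cong₂ ℤ._*_ (sym (ℤₚ.pos-* (2 ℕ.+ 4 ℕ.* n) (suc n))) (factorial-form n) ⟩
      + ((2 ℕ.+ 4 ℕ.* n) ℕ.* suc n) ℤ.* + ((2 ℕ.* n) !)
        ≡⟨ sym (ℤₚ.pos-* ((2 ℕ.+ 4 ℕ.* n) ℕ.* suc n) _) ⟩
      + ((2 ℕ.+ 4 ℕ.* n) ℕ.* suc n ℕ.* (2 ℕ.* n) !)
        ≡⟨ cong +_ (trans (eq₃ n ((2 ℕ.* n) !)) (sym (cong _! (eq₄ n)))) ⟩
      + ((2 ℕ.* suc n) !) ∎
      where
      open ≡-Reasoning
      eq₁ : ∀ n a → (suc n ℕ.* a) ℕ.* (suc n ℕ.* a) ≡ (suc n ℕ.* suc n) ℕ.* (a ℕ.* a)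
      eq₁ = ℕSolver.solve-∀
      eq₂ : ∀ a b c d → a ℤ.* b ℤ.* (c ℤ.* c ℤ.* d) ≡ a ℤ.* c ℤ.* (c ℤ.* b ℤ.* d)
      eq₂ = ℤSolver.solve-∀
      eq₃ : ∀ n a → (2 ℕ.+ 4 ℕ.* n) ℕ.* suc n ℕ.* a ≡ (2 ℕ.+ 2 ℕ.* n) ℕ.* ((1 ℕ.+ 2 ℕ.* n) ℕ.* a)
      eq₃ = ℕSolver.solve-∀
      eq₄ : ∀ n → 2 ℕ.* suc n ≡ suc (suc (2 ℕ.* n))
      eq₄ = ℕSolver.solve-∀

    central-binomial : ∀ n → ((2 ℕ.* n) Comb.C n) ℕ.* (n ! ℕ.* n !) ≡ (2 ℕ.* n) !
    central-binomial n =
      trans (cong₂ ℕ._*_ (nCk≡n!/k![n-k]! n≤2n) (cong (λ k → n ! ℕ.* k !) (sym 2n∸n≡n)))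
            (DivMod.m/n*n≡m (k![n∸k]!∣n! n≤2n))
      where
      n≤2n : n ℕ.≤ 2 ℕ.* n
      n≤2n = ℕₚ.m≤m+n n _
      2n∸n≡n : 2 ℕ.* n ∸ n ≡ n
      2n∸n≡n = trans (ℕₚ.m+n∸m≡n n (n ℕ.+ 0)) (ℕₚ.+-identityʳ n)
      instance
        nz : ℕ.NonZero (n ! ℕ.* (2 ℕ.* n ∸ n) !)
        nz = n ℕₚ.!* (2 ℕ.* n ∸ n) !≢0

  ≡catalan : ∀ n → f n ≡ + catalan n
  ≡catalan n = sym (trans (cong +_ (cong (ℕ._/ suc n) (sym |f|*n≡binom)))
    (trans (cong +_ (DivMod.m*n/n≡m ℤ.∣ f n ∣ (suc n)))
      (ℤₚ.0≤i⇒+∣i∣≡i {f n} (nonneg (f n) binom))))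
    where
    binom : + suc n ℤ.* f n ≡ + ((2 ℕ.* n) Comb.C n)
    binom = ℤₚ.*-cancelʳ-≡ _ _ (+ (n ! ℕ.* n !)) ⦃ n ℕₚ.!* n !≢0 ⦄
      (trans (factorial-form n) (trans (cong +_ (sym (central-binomial n))) (ℤₚ.pos-* ((2 ℕ.* n) Comb.C n) (n ! ℕ.* n !))))
    |f|*n≡binom : ℤ.∣ f n ∣ ℕ.* suc n ≡ (2 ℕ.* n) Comb.C n
    |f|*n≡binom = trans (ℕₚ.*-comm ℤ.∣ f n ∣ (suc n)) (trans (sym (ℤₚ.abs-* (+ suc n) (f n))) (cong ℤ.∣_∣ binom))
    -- A negative z would make the product a negative constructor, which cannot equal a natural
    -- number.
    nonneg : ∀ z {k} → + suc n ℤ.* z ≡ + k → + 0 ℤ.≤ z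
    nonneg (+ _) _ = ℤ.+≤+ ℕ.z≤n

open import Data.Nat using (_+_)

-- The stack-sorting map and 2-stack-sortability

∈-split : ∀ {A : Set} {P : A → Set} {xs m ys} → (∀ {x} → x ∈ xs → P x) → P m → (∀ {x} → x ∈ ys → P x) →
  ∀ {x} → x ∈ xs ++ m ∷ ys → P x
∈-split {xs = xs} p q r x∈ with ∈-++⁻ xs x∈
... | inj₁ x∈xs         = p x∈xs
... | inj₂ (here refl)  = q
... | inj₂ (there x∈ys) = r x∈ys

Cross : (ℕ → ℕ → Set) → List ℕ → List ℕ → Set
Cross P xs ys = ∀ {x y} → x ∈ xs → y ∈ ys → P x y

module _ {P : ℕ → ℕ → Set} where
  AllPairs-++⁺ : ∀ {xs ys} → AllPairs P xs → AllPairs P ys → Cross P xs ys → AllPairs P (xs ++ ys)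
  AllPairs-++⁺ p q c = AllPairsₚ.++⁺ p q (All.tabulate λ x∈ → All.tabulate λ y∈ → c x∈ y∈)

  AllPairs-++⁻ : ∀ xs {ys} → AllPairs P (xs ++ ys) → AllPairs P xs × AllPairs P ys × Cross P xs ys
  AllPairs-++⁻ []       p        = [] , p , λ ()
  AllPairs-++⁻ (x ∷ xs) (px ∷ p) =
    let p₁ , p₂ , c = AllPairs-++⁻ xs p in
    Allₚ.++⁻ˡ xs px ∷ p₁ , p₂ ,
    λ { (here refl) y∈ → All.lookup (Allₚ.++⁻ʳ xs px) y∈ ; (there x∈) y∈ → c x∈ y∈ }

Unique-resp-↭ : ∀ {xs ys : List ℕ} → xs ↭ ys → Unique xs → Unique ys
Unique-resp-↭ Perm.refl           u = u
Unique-resp-↭ (Perm.prep x p)     (x∉ ∷ u) = Permₚ.All-resp-↭ p x∉ ∷ Unique-resp-↭ p u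
Unique-resp-↭ (Perm.swap x y p)   ((x≢y ∷ x∉) ∷ (y∉ ∷ u)) =
  ((λ y≡x → x≢y (sym y≡x)) ∷ Permₚ.All-resp-↭ p y∉) ∷ (Permₚ.All-resp-↭ p x∉ ∷ Unique-resp-↭ p u)
Unique-resp-↭ (Perm.trans p q)    u = Unique-resp-↭ q (Unique-resp-↭ p u)

-- The decreasing binary tree of a word, with the maximum at the root; `s` reads it in postorder
-- (`s≡sTree`). Structural recursion on it replaces the fuel of `sFuel`.
data Decomposed : List ℕ → Set where
  leaf : Decomposed []
  node : ∀ {L m R} → All (_< m) L → All (_< m) R → Decomposed L → Decomposed R → Decomposed (L ++ m ∷ R)

split-max : ∀ x xs → Unique (x ∷ xs) →
  ∃[ L ] ∃[ m ] ∃[ R ] x ∷ xs ≡ L ++ m ∷ R × All (_< m) L × All (_< m) R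
split-max x [] u = [] , x , [] , refl , [] , []
split-max x (y ∷ ys) ((x≢y ∷ x∉) ∷ u) with split-max y ys u
... | L , m , R , eq , L<m , R<m with ℕₚ.<-cmp x m
... | tri< x<m _ _ = x ∷ L , m , R , cong (x ∷_) eq , x<m ∷ L<m , R<m
... | tri≈ _ x≡m _ = contradiction x≡m
  (All.lookup (x≢y ∷ x∉) (subst (m ∈_) (sym eq) (∈-++⁺ʳ L (here refl))))
... | tri> _ _ m<x = [] , x , y ∷ ys , refl , [] ,
  subst (All (_< x)) (sym eq) (Allₚ.++⁺ (All.map (λ z<m → ℕₚ.<-trans z<m m<x) L<m)
    (m<x ∷ All.map (λ z<m → ℕₚ.<-trans z<m m<x) R<m))

decompose : ∀ {π} → Unique π → Decomposed π
decompose {π} = go (length π) π ℕₚ.≤-refl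
  where
  go : ∀ k π → length π ≤ k → Unique π → Decomposed π
  go k       []       _       _ = leaf
  go (suc k) (x ∷ xs) (s≤s l) u with split-max x xs u
  ... | L , m , R , eq , L<m , R<m =
    let uL , u′ , _ = AllPairs-++⁻ L (subst Unique eq u)
        lenLR : length L + length R ≤ k
        lenLR = ℕₚ.≤-trans (ℕₚ.≤-reflexive (ℕₚ.suc-injective (trans (sym (ℕₚ.+-suc _ _))
                  (trans (sym (Lₚ.length-++ L)) (cong length (sym eq)))))) l
    in subst Decomposed (sym eq) (node L<m R<m
         (go k L (ℕₚ.≤-trans (ℕₚ.m≤m+n _ _) lenLR) uL)
         (go k R (ℕₚ.≤-trans (ℕₚ.m≤n+m _ _) lenLR) (AllPairs.tail u′)))

foldr-⊔-≤ : ∀ {m xs} → All (_< m) xs → maxL xs ≤ m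
foldr-⊔-≤ []         = z≤n
foldr-⊔-≤ (x<m ∷ ps) = ℕₚ.⊔-lub (ℕₚ.<⇒≤ x<m) (foldr-⊔-≤ ps)

maxL-split : ∀ {L m R} → All (_< m) L → All (_< m) R → maxL (L ++ m ∷ R) ≡ m
maxL-split []           R<m = ℕₚ.m≥n⇒m⊔n≡m (foldr-⊔-≤ R<m)
maxL-split {x ∷ L} (x<m ∷ L<m) R<m =
  trans (cong (x ⊔_) (maxL-split L<m R<m)) (ℕₚ.m≤n⇒m⊔n≡n (ℕₚ.<⇒≤ x<m))

T⇒≡true : ∀ {b} → T b → b ≡ true
T⇒≡true {true} _ = refl

¬T⇒≡false : ∀ {b} → ¬ T b → b ≡ false
¬T⇒≡false {true}  p = contradiction tt p
¬T⇒≡false {false} _ = refl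

breakAt-split : ∀ {L m R} → All (_< m) L → breakAt m (L ++ m ∷ R) ≡ (L , R)
breakAt-split {[]} {m} [] rewrite T⇒≡true {m ≡ᵇ m} (ℕₚ.≡⇒≡ᵇ m m refl) = refl
breakAt-split {x ∷ L} {m} {R} (x<m ∷ L<m)
  rewrite ¬T⇒≡false {x ≡ᵇ m} (λ t → ℕₚ.<⇒≢ x<m (ℕₚ.≡ᵇ⇒≡ x m t)) =
  cong (λ p → x ∷ proj₁ p , proj₂ p) (breakAt-split {L} {m} {R} L<m)

sFuel-node : ∀ k {L m R} → All (_< m) L → All (_< m) R →
  sFuel (suc k) (L ++ m ∷ R) ≡ sFuel k L ++ sFuel k R ++ [ m ]
sFuel-node k {L} {m} {R} L<m R<m = trans (unfold L) (trans
  (cong (λ M → sFuel k (proj₁ (breakAt M (L ++ m ∷ R))) ++ sFuel k (proj₂ (breakAt M (L ++ m ∷ R))) ++ [ M ])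
    (maxL-split L<m R<m))
  (cong (λ p → sFuel k (proj₁ p) ++ sFuel k (proj₂ p) ++ [ m ]) (breakAt-split {L} {m} {R} L<m)))
  where
  unfold : ∀ L → let M = maxL (L ++ m ∷ R) ; p = breakAt M (L ++ m ∷ R) in
    sFuel (suc k) (L ++ m ∷ R) ≡ sFuel k (proj₁ p) ++ sFuel k (proj₂ p) ++ [ M ]
  unfold []      = refl
  unfold (_ ∷ _) = refl

sTree : ∀ {π} → Decomposed π → List ℕ
sTree leaf                      = []
sTree (node {m = m} _ _ dL dR)  = sTree dL ++ sTree dR ++ [ m ]

sFuel≡sTree : ∀ k {π} → length π ≤ k → (d : Decomposed π) → sFuel k π ≡ sTree d
sFuel≡sTree k le leaf = sFuel-[] k
  where
  sFuel-[] : ∀ k → sFuel k [] ≡ []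
  sFuel-[] zero    = refl
  sFuel-[] (suc k) = refl
sFuel≡sTree zero {π} le (node {L} {m} {R} _ _ _ _) =
  contradiction (ℕₚ.≤-trans (ℕₚ.m≤n+m 1 _) (ℕₚ.≤-trans (ℕₚ.+-monoʳ-≤ (length L) (s≤s z≤n))
    (ℕₚ.≤-trans (ℕₚ.≤-reflexive (sym (Lₚ.length-++ L))) le))) (λ ())
sFuel≡sTree (suc k) le (node {L} {m} {R} L<m R<m dL dR) = trans (sFuel-node k L<m R<m)
  (cong₂ (λ a b → a ++ b ++ [ m ]) (sFuel≡sTree k (ℕₚ.≤-trans (ℕₚ.m≤m+n _ _) lenLR) dL)
                                   (sFuel≡sTree k (ℕₚ.≤-trans (ℕₚ.m≤n+m _ _) lenLR) dR))
  where
  lenLR : length L + length R ≤ k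
  lenLR = ℕₚ.≤-pred (ℕₚ.≤-trans (ℕₚ.≤-reflexive
            (trans (sym (ℕₚ.+-suc (length L) (length R))) (sym (Lₚ.length-++ L)))) le)

s≡sTree : ∀ {π} (d : Decomposed π) → s π ≡ sTree d
s≡sTree {π} d = sFuel≡sTree (length π) ℕₚ.≤-refl d

Unique-parts : ∀ L {m : ℕ} {R} → Unique (L ++ m ∷ R) → Unique L × Unique R
Unique-parts L u = let uL , u′ , _ = AllPairs-++⁻ L u in uL , AllPairs.tail u′

s-node : ∀ {L m R} → Unique (L ++ m ∷ R) → All (_< m) L → All (_< m) R → s (L ++ m ∷ R) ≡ s L ++ s R ++ [ m ]
s-node {L} {m} {R} u L<m R<m =
  let uL , uR = Unique-parts L u in
  trans (s≡sTree (node L<m R<m (decompose uL) (decompose uR)))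
    (sym (cong₂ (λ a b → a ++ b ++ [ m ]) (s≡sTree (decompose uL)) (s≡sTree (decompose uR))))

-- Induction along that tree, carrying distinctness of the entries. With it and `s-node`, most later
-- arguments about `s` see neither fuel nor trees.
split-induction : (P : List ℕ → Set) → P [] →
  (∀ {L m R} → Unique (L ++ m ∷ R) → All (_< m) L → All (_< m) R → P L → P R → P (L ++ m ∷ R)) →
  ∀ {π} → Unique π → P π
split-induction P base step u = go u (decompose u)
  where
  go : ∀ {π} → Unique π → Decomposed π → P π
  go u leaf = base
  go u (node {L} L<m R<m dL dR) =
    let uL , uR = Unique-parts L u in step u L<m R<m (go uL dL) (go uR dR)

s-↭ : ∀ {π} → Unique π → s π ↭ π
s-↭ = split-induction (λ π → s π ↭ π) ↭-refl λ {L} {m} {R} u L<m R<m ihL ihR →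
  ↭-trans (↭-reflexive (s-node u L<m R<m))
    (Permₚ.++⁺ ihL (↭-trans (Permₚ.++⁺ʳ [ m ] ihR) (↭-sym (Permₚ.∷↭∷ʳ m R))))

s-Unique : ∀ {π} → Unique π → Unique (s π)
s-Unique u = Unique-resp-↭ (↭-sym (s-↭ u)) u

StrictlyMonotone : (ℕ → ℕ) → Set
StrictlyMonotone f = ∀ {x y} → x < y → f x < f y

module _ {f : ℕ → ℕ} (f< : StrictlyMonotone f) where
  mono-injective : ∀ {x y} → f x ≡ f y → x ≡ y
  mono-injective {x} {y} eq with ℕₚ.<-cmp x y
  ... | tri< x<y _ _ = contradiction eq (ℕₚ.<⇒≢ (f< x<y))
  ... | tri≈ _ x≡y _ = x≡y
  ... | tri> _ _ y<x = contradiction (sym eq) (ℕₚ.<⇒≢ (f< y<x))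

  mono-reflects : ∀ {x y} → f x < f y → x < y
  mono-reflects {x} {y} lt with ℕₚ.<-cmp x y
  ... | tri< x<y _ _ = x<y
  ... | tri≈ _ refl _ = contradiction lt (ℕₚ.<-irrefl refl)
  ... | tri> _ _ y<x = contradiction lt (ℕₚ.<-asym (f< y<x))

  Unique-map : ∀ {π} → Unique π → Unique (map f π)
  Unique-map = Uniqueₚ.map⁺ mono-injective

  -- `s` only compares entries. Hence the two sides of a maximum, whose values need not form an
  -- initial segment, can be relabelled to permutations of 1, ..., k.
  s-map : ∀ {π} → Unique π → s (map f π) ≡ map f (s π)
  s-map = split-induction (λ π → s (map f π) ≡ map f (s π)) refl λ {L} {m} {R} u L<m R<m ihL ihR →
    let open ≡-Reasoning in begin
    s (map f (L ++ m ∷ R))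
      ≡⟨ cong s (Lₚ.map-++ f L (m ∷ R)) ⟩
    s (map f L ++ f m ∷ map f R)
      ≡⟨ s-node (subst Unique (Lₚ.map-++ f L (m ∷ R)) (Unique-map u))
           (Allₚ.map⁺ (All.map f< L<m)) (Allₚ.map⁺ (All.map f< R<m)) ⟩
    s (map f L) ++ s (map f R) ++ [ f m ]
      ≡⟨ cong₂ (λ a b → a ++ b ++ [ f m ]) ihL ihR ⟩
    map f (s L) ++ map f (s R) ++ [ f m ]
      ≡⟨ cong (map f (s L) ++_) (sym (Lₚ.map-++ f (s R) [ m ])) ⟩
    map f (s L) ++ map f (s R ++ [ m ])
      ≡⟨ sym (Lₚ.map-++ f (s L) _) ⟩
    map f (s L ++ s R ++ [ m ])
      ≡⟨ cong (map f) (sym (s-node u L<m R<m)) ⟩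
    map f (s (L ++ m ∷ R)) ∎

Sorted : List ℕ → Set
Sorted = AllPairs _<_

Sortable₁ Sortable₂ : List ℕ → Set
Sortable₁ π = Sorted (s π)
Sortable₂ π = Sorted (s (s π))

-- (a, a+1) is legal for π iff s(π) lists every entry ≤ a before every entry > a.
Separated : ℕ → ℕ → ℕ → Set
Separated a y z = z ≤ a → y ≤ a

Legal : ℕ → List ℕ → Set
Legal a π = AllPairs (Separated a) (s π)

Separated-< : ∀ {a x y} → x < y → Separated a x y
Separated-< x<y y≤a = ℕₚ.≤-trans (ℕₚ.<⇒≤ x<y) y≤a

Separated-≤ : ∀ {a xs} → All (_≤ a) xs → AllPairs (Separated a) xs
Separated-≤ []       = []
Separated-≤ (x≤ ∷ p) = All.map (λ _ _ → x≤) p ∷ Separated-≤ p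

Separated-> : ∀ {a xs} → All (a <_) xs → AllPairs (Separated a) xs
Separated-> []       = []
Separated-> (_ ∷ p) = All.map (λ a<z z≤a → contradiction z≤a (ℕₚ.<⇒≱ a<z)) p ∷ Separated-> p

-- Sortedness (P is `_<_`) and legality (P is `Separated a`) split at the maximum for the same
-- reason: m comes last in s(L) s(R) m, and P holds for increasing pairs, so m imposes nothing.
-- Since `s` permutes the entries, the cross condition can be stated for L and R themselves.
module _ {P : ℕ → ℕ → Set} (<⇒P : ∀ {x y} → x < y → P x y) {L m R}
         (u : Unique (L ++ m ∷ R)) (L<m : All (_< m) L) (R<m : All (_< m) R) where
  private
    uL = proj₁ (Unique-parts L u)
    uR = proj₂ (Unique-parts L u)

  AllPairs-s-node⁻ : AllPairs P (s (L ++ m ∷ R)) → AllPairs P (s L) × AllPairs P (s R) × Cross P L R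
  AllPairs-s-node⁻ p =
    let pL , p′ , c = AllPairs-++⁻ (s L) (subst (AllPairs P) (s-node u L<m R<m) p)
        pR , _  , _ = AllPairs-++⁻ (s R) p′
    in pL , pR , λ x∈ y∈ → c (Permₚ.∈-resp-↭ (↭-sym (s-↭ uL)) x∈)
                              (∈-++⁺ˡ (Permₚ.∈-resp-↭ (↭-sym (s-↭ uR)) y∈))

  AllPairs-s-node⁺ : AllPairs P (s L) → AllPairs P (s R) → Cross P L R → AllPairs P (s (L ++ m ∷ R))
  AllPairs-s-node⁺ pL pR c = subst (AllPairs P) (sym (s-node u L<m R<m))
    (AllPairs-++⁺ pL (AllPairs-++⁺ pR ([] ∷ []) λ { x∈ (here refl) → <⇒P (All.lookup R<m (fromR x∈)) })
      λ x∈ y∈ → case ∈-++⁻ (s R) y∈ of λ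
        { (inj₁ y∈R) → c (fromL x∈) (fromR y∈R)
        ; (inj₂ (here refl)) → <⇒P (All.lookup L<m (fromL x∈)) })
    where
    fromL : ∀ {x} → x ∈ s L → x ∈ L
    fromL = Permₚ.∈-resp-↭ (s-↭ uL)
    fromR : ∀ {x} → x ∈ s R → x ∈ R
    fromR = Permₚ.∈-resp-↭ (s-↭ uR)

module _ {A M} (A<M : All (_< M) A) where
  -- Intended for A M = s(L) and B = s(R), where separation of B at M means that M sits in a legal
  -- space of R. Induction on the maximum p of B: if p < M, then M is the overall maximum and all of
  -- B lies below it; if p > M, the word splits at p, and sortedness puts B₂ above M, which stands
  -- to its left, so separation extends from B₁ to B.
  Sortable₁-append⁻ : ∀ {B} → Unique B → Unique (A ++ M ∷ B) → Sortable₁ (A ++ M ∷ B) →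
    Sortable₁ A × Sortable₁ B × Cross _<_ A B × AllPairs (Separated M) B
  Sortable₁-append⁻ uB = split-induction
    (λ B → Unique (A ++ M ∷ B) → Sortable₁ (A ++ M ∷ B) →
      Sortable₁ A × Sortable₁ B × Cross _<_ A B × AllPairs (Separated M) B)
    (λ u p → proj₁ (AllPairs-s-node⁻ id u A<M [] p) , [] , (λ _ ()) , []) step uB
    where
    step : ∀ {B₁ p B₂} → Unique (B₁ ++ p ∷ B₂) → All (_< p) B₁ → All (_< p) B₂ →
      (Unique (A ++ M ∷ B₁) → Sortable₁ (A ++ M ∷ B₁) →
        Sortable₁ A × Sortable₁ B₁ × Cross _<_ A B₁ × AllPairs (Separated M) B₁) →
      _ → Unique (A ++ M ∷ B₁ ++ p ∷ B₂) → Sortable₁ (A ++ M ∷ B₁ ++ p ∷ B₂) →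
      Sortable₁ A × Sortable₁ (B₁ ++ p ∷ B₂) × Cross _<_ A (B₁ ++ p ∷ B₂) × AllPairs (Separated M) (B₁ ++ p ∷ B₂)
    step {B₁} {p} {B₂} uB B₁<p B₂<p ih _ u σ with ℕₚ.<-cmp p M
    ... | tri≈ _ refl _ = contradiction refl
      (All.lookup (AllPairs.head (proj₁ (proj₂ (AllPairs-++⁻ A u)))) (∈-++⁺ʳ B₁ (here refl)))
    ... | tri< p<M _ _ =
      let σA , σB , c = AllPairs-s-node⁻ id u A<M B<M σ
      in σA , σB , c , Separated-≤ (All.map ℕₚ.<⇒≤ B<M)
      where
      B<M : All (_< M) (B₁ ++ p ∷ B₂)
      B<M = Allₚ.++⁺ (All.map (λ z → ℕₚ.<-trans z p<M) B₁<p) (p<M ∷ All.map (λ z → ℕₚ.<-trans z p<M) B₂<p)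
    ... | tri> _ _ M<p =
      let u′ = subst Unique (sym (Lₚ.++-assoc A (M ∷ B₁) (p ∷ B₂))) u
          σ′ = subst Sortable₁ (sym (Lₚ.++-assoc A (M ∷ B₁) (p ∷ B₂))) σ
          A<p = All.map (λ z → ℕₚ.<-trans z M<p) A<M
          σ₁ , σ₂ , c = AllPairs-s-node⁻ id u′ (Allₚ.++⁺ A<p (M<p ∷ B₁<p)) B₂<p σ′
          σA , σB₁ , cAB₁ , sepB₁ = ih (proj₁ (AllPairs-++⁻ (A ++ M ∷ B₁) u′)) σ₁
          M<B₂ : ∀ {y} → y ∈ B₂ → M < y
          M<B₂ y∈ = c (∈-++⁺ʳ A (here refl)) y∈
          M<pB₂ : ∀ {y} → y ∈ p ∷ B₂ → M < y
          M<pB₂ = λ { (here refl) → M<p ; (there y∈) → M<B₂ y∈ }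
          sep-pB₂ = Separated-> (All.tabulate M<pB₂)
      in σA
       , AllPairs-s-node⁺ id uB B₁<p B₂<p σB₁ σ₂ (λ x∈ y∈ → c (∈-++⁺ʳ A (there x∈)) y∈)
       , (λ x∈ → ∈-split (cAB₁ x∈) (All.lookup A<p x∈) (λ y∈ → c (∈-++⁺ˡ x∈) y∈))
       , AllPairs-++⁺ sepB₁ sep-pB₂ (λ _ y∈ y≤M → contradiction y≤M (ℕₚ.<⇒≱ (M<pB₂ y∈)))

  Sortable₁-append⁺ : ∀ {B} → Unique B → Unique (A ++ M ∷ B) →
    Sortable₁ A → Sortable₁ B → Cross _<_ A B → AllPairs (Separated M) B → Sortable₁ (A ++ M ∷ B)
  Sortable₁-append⁺ uB u σA = split-induction
    (λ B → Unique (A ++ M ∷ B) → Sortable₁ B → Cross _<_ A B → AllPairs (Separated M) B → Sortable₁ (A ++ M ∷ B))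
    (λ u _ _ _ → AllPairs-s-node⁺ id u A<M [] σA [] (λ _ ())) step uB u
    where
    step : ∀ {B₁ p B₂} → Unique (B₁ ++ p ∷ B₂) → All (_< p) B₁ → All (_< p) B₂ →
      (Unique (A ++ M ∷ B₁) → Sortable₁ B₁ → Cross _<_ A B₁ → AllPairs (Separated M) B₁ → Sortable₁ (A ++ M ∷ B₁)) →
      _ → Unique (A ++ M ∷ B₁ ++ p ∷ B₂) → Sortable₁ (B₁ ++ p ∷ B₂) →
      Cross _<_ A (B₁ ++ p ∷ B₂) → AllPairs (Separated M) (B₁ ++ p ∷ B₂) → Sortable₁ (A ++ M ∷ B₁ ++ p ∷ B₂)
    step {B₁} {p} {B₂} uB B₁<p B₂<p ih _ u σB cAB sep with ℕₚ.<-cmp p M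
    ... | tri≈ _ refl _ = contradiction refl
      (All.lookup (AllPairs.head (proj₁ (proj₂ (AllPairs-++⁻ A u)))) (∈-++⁺ʳ B₁ (here refl)))
    ... | tri< p<M _ _ = AllPairs-s-node⁺ id u A<M
      (Allₚ.++⁺ (All.map (λ z → ℕₚ.<-trans z p<M) B₁<p) (p<M ∷ All.map (λ z → ℕₚ.<-trans z p<M) B₂<p)) σA σB cAB
    ... | tri> _ _ M<p =
      let u′ = subst Unique (sym (Lₚ.++-assoc A (M ∷ B₁) (p ∷ B₂))) u
          A<p = All.map (λ z → ℕₚ.<-trans z M<p) A<M
          σB₁ , σB₂ , cB = AllPairs-s-node⁻ id uB B₁<p B₂<p σB
          sep₁ , sep₂ , _ = AllPairs-++⁻ B₁ sep
          -- p exceeds M and precedes B₂, so separation at M leaves no entry of B₂ at or below M.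
          M<B₂ : ∀ {y} → y ∈ B₂ → M < y
          M<B₂ = λ y∈ → ℕₚ.≰⇒> (λ y≤M → ℕₚ.<⇒≱ M<p (All.lookup (AllPairs.head sep₂) y∈ y≤M))
      in subst Sortable₁ (Lₚ.++-assoc A (M ∷ B₁) (p ∷ B₂))
           (AllPairs-s-node⁺ id u′ (Allₚ.++⁺ A<p (M<p ∷ B₁<p)) B₂<p
             (ih (proj₁ (AllPairs-++⁻ (A ++ M ∷ B₁) u′)) σB₁ (λ x∈ y∈ → cAB x∈ (∈-++⁺ˡ y∈)) sep₁) σB₂
             (∈-split (λ x∈ y∈ → cAB x∈ (∈-++⁺ʳ B₁ (there y∈))) M<B₂ (λ x∈ y∈ → cB x∈ y∈)))

-- Finite sums over lists

module ListSum (A : CommutativeRing 0ℓ 0ℓ) where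
  open CommutativeRing A hiding (zero; setoid)
    renaming (_+_ to _⊞_; _*_ to _⊠_; refl to ≈-refl; sym to ≈-sym; trans to ≈-trans)

  ∑ : ∀ {B : Set} → List B → (B → Carrier) → Carrier
  ∑ []       f = 0#
  ∑ (x ∷ xs) f = f x ⊞ ∑ xs f

  module _ {B : Set} where
    ∑-cong : ∀ (xs : List B) {f g} → (∀ {x} → x ∈ xs → f x ≈ g x) → ∑ xs f ≈ ∑ xs g
    ∑-cong []       p = ≈-refl
    ∑-cong (x ∷ xs) p = +-cong (p (here refl)) (∑-cong xs (p ∘ there))

    ∑-zero : ∀ (xs : List B) {f} → (∀ {x} → x ∈ xs → f x ≈ 0#) → ∑ xs f ≈ 0#
    ∑-zero []       p = ≈-refl
    ∑-zero (x ∷ xs) p = ≈-trans (+-cong (p (here refl)) (∑-zero xs (p ∘ there))) (+-identityˡ 0#)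

    ∑-++ : ∀ (xs ys : List B) {f} → ∑ (xs ++ ys) f ≈ ∑ xs f ⊞ ∑ ys f
    ∑-++ []       ys = ≈-sym (+-identityˡ _)
    ∑-++ (x ∷ xs) ys = ≈-trans (+-congˡ (∑-++ xs ys)) (≈-sym (+-assoc _ _ _))

    ∑-↭ : ∀ {xs ys : List B} {f} → xs ↭ ys → ∑ xs f ≈ ∑ ys f
    ∑-↭ Perm.refl         = ≈-refl
    ∑-↭ (Perm.prep x p)   = +-congˡ (∑-↭ p)
    ∑-↭ (Perm.swap x y p) = ≈-trans (+-congˡ (+-congˡ (∑-↭ p))) (x∙yz≈y∙xz _ _ _)
      where open CSG +-commutativeSemigroup
    ∑-↭ (Perm.trans p q)  = ≈-trans (∑-↭ p) (∑-↭ q)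

    ∑-+ : ∀ (xs : List B) {f g} → ∑ xs (λ x → f x ⊞ g x) ≈ ∑ xs f ⊞ ∑ xs g
    ∑-+ []       = ≈-sym (+-identityˡ 0#)
    ∑-+ (x ∷ xs) = ≈-trans (+-congˡ (∑-+ xs)) (interchange _ _ _ _)
      where open CSG +-commutativeSemigroup

    ∑-*ˡ : ∀ (xs : List B) {f} c → c ⊠ ∑ xs f ≈ ∑ xs (λ x → c ⊠ f x)
    ∑-*ˡ []       c = zeroʳ c
    ∑-*ˡ (x ∷ xs) c = ≈-trans (distribˡ _ _ _) (+-congˡ (∑-*ˡ xs c))

    ∑-*ʳ : ∀ (xs : List B) {f} c → ∑ xs f ⊠ c ≈ ∑ xs (λ x → f x ⊠ c)
    ∑-*ʳ []       c = zeroˡ c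
    ∑-*ʳ (x ∷ xs) c = ≈-trans (distribʳ _ _ _) (+-congˡ (∑-*ʳ xs c))

  module _ {B C : Set} where
    ∑-map : ∀ (h : B → C) xs {f} → ∑ (map h xs) f ≈ ∑ xs (f ∘ h)
    ∑-map h []       = ≈-refl
    ∑-map h (x ∷ xs) = +-congˡ (∑-map h xs)

    ∑-concatMap : ∀ (h : B → List C) xs {f} → ∑ (concatMap h xs) f ≈ ∑ xs (λ x → ∑ (h x) f)
    ∑-concatMap h []       = ≈-refl
    ∑-concatMap h (x ∷ xs) = ≈-trans (∑-++ (h x) _) (+-congˡ (∑-concatMap h xs))

open ListSum ℤₚ.+-*-commutativeRing using () renaming
  (∑ to ∑ℤ; ∑-cong to ∑ℤ-cong; ∑-zero to ∑ℤ-zero; ∑-++ to ∑ℤ-++; ∑-+ to ∑ℤ-+; ∑-*ˡ to ∑ℤ-*ˡ; ∑-*ʳ to ∑ℤ-*ʳ;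
   ∑-map to ∑ℤ-map; ∑-concatMap to ∑ℤ-concatMap)

mul-∑ : ∀ {B : Set} (xs : List B) (w : B → ℤ) (F : B → ℕ → ℤ) g n →
  U.mul (λ k → ∑ℤ xs (λ x → w x ℤ.* F x k)) g n ≡ ∑ℤ xs (λ x → w x ℤ.* U.mul (F x) g n)
mul-∑ []       w F g n = U.mul-zeroˡ g (λ _ → refl) n
mul-∑ (x ∷ xs) w F g n = trans
  (U.mul-distribʳ g (λ k → w x ℤ.* F x k) (λ k → ∑ℤ xs (λ x → w x ℤ.* F x k)) n)
  (cong₂ ℤ._+_ (U.mul-scaleˡ (w x) (F x) g n) (mul-∑ xs w F g n))

-- The number of preimages under s

splits : List ℕ → List (List ℕ × List ℕ)
splits []       = [ [] , [] ]
splits (x ∷ xs) = ([] , x ∷ xs) ∷ map (λ p → x ∷ proj₁ p , proj₂ p) (splits xs)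

splits-++ : ∀ X {p} → p ∈ splits X → proj₁ p ++ proj₂ p ≡ X
splits-++ []       (here refl) = refl
splits-++ (x ∷ X)  (here refl) = refl
splits-++ (x ∷ X)  (there p∈) with ∈-map⁻ _ p∈
... | q , q∈ , refl = cong (x ∷_) (splits-++ X q∈)

∈-splits : ∀ α {β} → (α , β) ∈ splits (α ++ β)
∈-splits []      {[]}    = here refl
∈-splits []      {_ ∷ _} = here refl
∈-splits (x ∷ α)         = there (∈-map⁺ _ (∈-splits α))

splits-unique : ∀ X → Unique (splits X)
splits-unique []      = [] ∷ []
splits-unique (x ∷ X) =
  All.tabulate (λ q∈ eq → case ∈-map⁻ _ q∈ of λ { (_ , _ , refl) → case eq of λ () })
  ∷ Uniqueₚ.map⁺ (λ { refl → refl }) (splits-unique X)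

-- A cut of X y Y falls either before y, within X, or after y, within Y.
∑-splits : ∀ X {y Y} (h : List ℕ → List ℕ → ℤ) →
  ∑ℤ (splits (X ++ y ∷ Y)) (λ p → h (proj₁ p) (proj₂ p))
  ≡ ∑ℤ (splits X) (λ p → h (proj₁ p) (proj₂ p ++ y ∷ Y)) ℤ.+ ∑ℤ (splits Y) (λ p → h (X ++ y ∷ proj₁ p) (proj₂ p))
∑-splits [] {y} {Y} h = cong₂ ℤ._+_ (sym (ℤₚ.+-identityʳ (h [] (y ∷ Y)))) (∑ℤ-map (λ p → y ∷ proj₁ p , proj₂ p) (splits Y))
∑-splits (x ∷ X) {y} {Y} h = begin
  a ℤ.+ ∑ℤ (map (λ p → x ∷ proj₁ p , proj₂ p) (splits (X ++ y ∷ Y))) (λ p → h (proj₁ p) (proj₂ p))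
    ≡⟨ cong (λ b → a ℤ.+ b) (trans (∑ℤ-map _ (splits (X ++ y ∷ Y))) (∑-splits X (h ∘ (x ∷_)))) ⟩
  a ℤ.+ (∑ℤ (splits X) _ ℤ.+ ∑ℤ (splits Y) _)
    ≡⟨ sym (ℤₚ.+-assoc a _ _) ⟩
  (a ℤ.+ ∑ℤ (splits X) _) ℤ.+ ∑ℤ (splits Y) _
    ≡⟨ cong (λ b → (a ℤ.+ b) ℤ.+ ∑ℤ (splits Y) _) (sym (∑ℤ-map (λ p → x ∷ proj₁ p , proj₂ p) (splits X))) ⟩
  _ ∎
  where
  open ≡-Reasoning
  a = h [] (x ∷ X ++ y ∷ Y)

-- Fertility by recursion on the last entry: s(A m B) = s(A) s(B) m, so the preimages of X m are
-- pairs of preimages over the factorisations of X. A word whose last entry does not exceed all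
-- others is no output of `s`, hence the value 0. The values are integers because they become
-- coefficients.
countFuel : ℕ → ∀ {π : List ℕ} → InitLast π → ℤ
countFuel _       []        = + 1
countFuel zero    (X ∷ʳ′ m) = + 0
countFuel (suc k) (X ∷ʳ′ m) with All.all? (ℕₚ._<? m) X
... | yes _ = ∑ℤ (splits X) (λ p → countFuel k (initLast (proj₁ p)) ℤ.* countFuel k (initLast (proj₂ p)))
... | no  _ = + 0

count : List ℕ → ℤ
count π = countFuel (length π) (initLast π)

splits-length : ∀ X {p} → p ∈ splits X → length (proj₁ p) ≤ length X × length (proj₂ p) ≤ length X
splits-length X {α , β} p∈ =
  let eq = trans (sym (Lₚ.length-++ α)) (cong length (splits-++ X p∈)) in
  ℕₚ.≤-trans (ℕₚ.m≤m+n _ _) (ℕₚ.≤-reflexive eq) , ℕₚ.≤-trans (ℕₚ.m≤n+m _ _) (ℕₚ.≤-reflexive eq)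

length-∷ʳ : ∀ (X : List ℕ) m → length (X ∷ʳ m) ≡ suc (length X)
length-∷ʳ X m = trans (Lₚ.length-++ X) (ℕₚ.+-comm (length X) 1)

countFuel-irrelevant : ∀ j k {π : List ℕ} (v : InitLast π) → length π ≤ j → length π ≤ k → countFuel j v ≡ countFuel k v
countFuel-irrelevant j k [] _ _ = refl
countFuel-irrelevant zero    k       (X ∷ʳ′ m) j≥ k≥ = contradiction (subst (_≤ 0) (length-∷ʳ X m) j≥) λ ()
countFuel-irrelevant (suc j) zero    (X ∷ʳ′ m) j≥ k≥ = contradiction (subst (_≤ 0) (length-∷ʳ X m) k≥) λ ()
countFuel-irrelevant (suc j) (suc k) (X ∷ʳ′ m) j≥ k≥ with All.all? (ℕₚ._<? m) X
... | no  _ = refl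
... | yes _ = ∑ℤ-cong (splits X) λ {p} p∈ →
  let l₁ , l₂ = splits-length X p∈ in
  cong₂ ℤ._*_ (countFuel-irrelevant j k (initLast (proj₁ p)) (ℕₚ.≤-trans l₁ j≥′) (ℕₚ.≤-trans l₁ k≥′))
              (countFuel-irrelevant j k (initLast (proj₂ p)) (ℕₚ.≤-trans l₂ j≥′) (ℕₚ.≤-trans l₂ k≥′))
  where
  j≥′ = ℕₚ.≤-pred (subst (_≤ suc j) (length-∷ʳ X m) j≥)
  k≥′ = ℕₚ.≤-pred (subst (_≤ suc k) (length-∷ʳ X m) k≥)

count-rec : ∀ X {m} → All (_< m) X → count (X ∷ʳ m) ≡ ∑ℤ (splits X) (λ p → count (proj₁ p) ℤ.* count (proj₂ p))
count-rec X {m} X<m = trans (cong (λ k → countFuel k (initLast (X ∷ʳ m))) (length-∷ʳ X m)) (go (initLast (X ∷ʳ m)) refl)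
  where
  go : ∀ {π} (v : InitLast π) → π ≡ X ∷ʳ m →
    countFuel (suc (length X)) v ≡ ∑ℤ (splits X) (λ p → count (proj₁ p) ℤ.* count (proj₂ p))
  go [] eq = contradiction (trans (cong length eq) (length-∷ʳ X m)) λ ()
  go (Y ∷ʳ′ n) eq with Lₚ.∷ʳ-injective Y X eq
  ... | refl , refl with All.all? (ℕₚ._<? m) X
  ...   | no ¬p = contradiction X<m ¬p
  ...   | yes _ = ∑ℤ-cong (splits X) λ {p} p∈ → let l₁ , l₂ = splits-length X p∈ in
    cong₂ ℤ._*_ (countFuel-irrelevant _ _ (initLast (proj₁ p)) l₁ ℕₚ.≤-refl)
                (countFuel-irrelevant _ _ (initLast (proj₂ p)) l₂ ℕₚ.≤-refl)

count-zero : ∀ X {m x} → x ∈ X → m ≤ x → count (X ∷ʳ m) ≡ + 0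
count-zero X {m} x∈ m≤x = trans (cong (λ k → countFuel k (initLast (X ∷ʳ m))) (length-∷ʳ X m)) (go (initLast (X ∷ʳ m)) refl)
  where
  go : ∀ {π} (v : InitLast π) → π ≡ X ∷ʳ m → countFuel (suc (length X)) v ≡ + 0
  go [] eq = contradiction (trans (cong length eq) (length-∷ʳ X m)) λ ()
  go (Y ∷ʳ′ n) eq with Lₚ.∷ʳ-injective Y X eq
  ... | refl , refl with All.all? (ℕₚ._<? m) X
  ...   | no _  = refl
  ...   | yes p = contradiction m≤x (ℕₚ.<⇒≱ (All.lookup p x∈))

-- The last entry comes from x R, hence lies below m and is not the maximum.
count-descent : ∀ L {m x R} → All (_< m) (x ∷ R) → count (L ++ m ∷ x ∷ R) ≡ + 0
count-descent L {m} {x} {R} xR<m = go (x ∷ R) (initLast (x ∷ R)) xR<m (λ ())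
  where
  go : ∀ π → InitLast π → All (_< m) π → π ≢ [] → count (L ++ m ∷ π) ≡ + 0
  go .[]        []         _ ≢[] = contradiction refl ≢[]
  go .(R′ ∷ʳ y) (R′ ∷ʳ′ y) p _   = trans (cong count (sym (Lₚ.++-assoc L (m ∷ R′) [ y ])))
    (count-zero (L ++ m ∷ R′) (∈-++⁺ʳ L (here refl)) (ℕₚ.<⇒≤ (All.lookup p (∈-++⁺ʳ R′ (here refl)))))

splits-map : ∀ (f : ℕ → ℕ) X → splits (map f X) ≡ map (λ p → map f (proj₁ p) , map f (proj₂ p)) (splits X)
splits-map f []      = refl
splits-map f (x ∷ X) = cong (([] , f x ∷ map f X) ∷_) (trans (cong (map _) (splits-map f X))
  (trans (sym (Lₚ.map-∘ (splits X))) (Lₚ.map-∘ (splits X))))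

module _ {f : ℕ → ℕ} (f< : StrictlyMonotone f) where
  count-map : ∀ π → count (map f π) ≡ count π
  count-map π = go (length π) (initLast π) ℕₚ.≤-refl
    where
    go : ∀ k {π} → InitLast π → length π ≤ k → count (map f π) ≡ count π
    go k       []        _ = refl
    go zero    (X ∷ʳ′ m) l = contradiction (subst (_≤ 0) (length-∷ʳ X m) l) λ ()
    go (suc k) (X ∷ʳ′ m) l rewrite Lₚ.map-++ f X [ m ] with All.all? (ℕₚ._<? m) X
    ... | yes X<m = begin
      count (map f X ∷ʳ f m)
        ≡⟨ count-rec (map f X) (Allₚ.map⁺ (All.map f< X<m)) ⟩
      ∑ℤ (splits (map f X)) (λ p → count (proj₁ p) ℤ.* count (proj₂ p))
        ≡⟨ trans (cong (λ S → ∑ℤ S (λ p → count (proj₁ p) ℤ.* count (proj₂ p))) (splits-map f X)) (∑ℤ-map _ (splits X)) ⟩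
      ∑ℤ (splits X) (λ p → count (map f (proj₁ p)) ℤ.* count (map f (proj₂ p)))
        ≡⟨ ∑ℤ-cong (splits X) (λ {p} p∈ → let l₁ , l₂ = splits-length X p∈ in
             cong₂ ℤ._*_ (go k (initLast (proj₁ p)) (ℕₚ.≤-trans l₁ l′)) (go k (initLast (proj₂ p)) (ℕₚ.≤-trans l₂ l′))) ⟩
      ∑ℤ (splits X) (λ p → count (proj₁ p) ℤ.* count (proj₂ p))
        ≡⟨ sym (count-rec X X<m) ⟩
      count (X ∷ʳ m) ∎
      where
      open ≡-Reasoning
      l′ = ℕₚ.≤-pred (subst (_≤ suc k) (length-∷ʳ X m) l)
    ... | no ¬X<m =
      let x , x∈ , x≮m = find (Allₚ.¬All⇒Any¬ (ℕₚ._<? m) X ¬X<m) in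
      trans (count-zero (map f X) (∈-map⁺ f x∈) (mono-≤ (ℕₚ.≮⇒≥ x≮m))) (sym (count-zero X x∈ (ℕₚ.≮⇒≥ x≮m)))
      where
      mono-≤ : ∀ {x y} → x ≤ y → f x ≤ f y
      mono-≤ x≤y with ℕₚ.m≤n⇒m<n∨m≡n x≤y
      ... | inj₁ x<y  = ℕₚ.<⇒≤ (f< x<y)
      ... | inj₂ refl = ℕₚ.≤-refl

seg : ℕ → ℕ → List ℕ
seg m zero    = []
seg m (suc k) = suc m ∷ seg (suc m) k

seg-∷ʳ : ∀ m k → seg m (suc k) ≡ seg m k ∷ʳ suc (m + k)
seg-∷ʳ m zero    = cong (λ x → [ suc x ]) (sym (ℕₚ.+-identityʳ m))
seg-∷ʳ m (suc k) = cong (suc m ∷_) (trans (seg-∷ʳ (suc m) k) (cong (λ x → seg (suc m) k ∷ʳ suc x) (sym (ℕₚ.+-suc m k))))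

∈-seg⁻ : ∀ m k {x} → x ∈ seg m k → m < x × x ≤ m + k
∈-seg⁻ m (suc k) (here refl) = ℕₚ.≤-refl , subst (suc m ≤_) (sym (ℕₚ.+-suc m k)) (s≤s (ℕₚ.m≤m+n m k))
∈-seg⁻ m (suc k) {x} (there x∈) =
  let l , u = ∈-seg⁻ (suc m) k x∈ in ℕₚ.<-trans ℕₚ.≤-refl l , subst (λ z → x ≤ z) (sym (ℕₚ.+-suc m k)) u

∈-seg⁺ : ∀ m k {x} → m < x → x ≤ m + k → x ∈ seg m k
∈-seg⁺ m zero    l u = contradiction (ℕₚ.<-≤-trans l u) (ℕₚ.≤⇒≯ (ℕₚ.≤-reflexive (ℕₚ.+-identityʳ m)))
∈-seg⁺ m (suc k) {x} l u with ℕₚ.m≤n⇒m<n∨m≡n l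
... | inj₁ l′   = there (∈-seg⁺ (suc m) k l′ (subst (λ z → x ≤ z) (ℕₚ.+-suc m k) u))
... | inj₂ refl = here refl

seg-Unique : ∀ m k → Unique (seg m k)
seg-Unique m zero    = []
seg-Unique m (suc k) =
  All.tabulate (λ x∈ → ℕₚ.<⇒≢ (proj₁ (∈-seg⁻ (suc m) k x∈))) ∷ seg-Unique (suc m) k

oneTo≡seg : ∀ n → oneTo n ≡ seg 0 n
oneTo≡seg zero    = refl
oneTo≡seg (suc n) = trans (sym (Lₚ.applyUpTo-∷ʳ suc n)) (trans (cong (_∷ʳ suc n) (oneTo≡seg n)) (sym (seg-∷ʳ 0 n)))

map-seg : ∀ {f : ℕ → ℕ} m m′ k → (∀ i → f (suc (m + i)) ≡ suc (m′ + i)) → map f (seg m k) ≡ seg m′ k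
map-seg m m′ zero    p = refl
map-seg {f} m m′ (suc k) p = cong₂ _∷_ (trans (cong (f ∘ suc) (sym (ℕₚ.+-identityʳ m))) (trans (p 0) (cong suc (ℕₚ.+-identityʳ m′))))
  (map-seg (suc m) (suc m′) k (λ i → trans (cong (f ∘ suc) (sym (ℕₚ.+-suc m i))) (trans (p (suc i)) (cong suc (ℕₚ.+-suc m′ i)))))

-- Opens a gap of width d above m. The relabellings used below are of this form up to translation:
-- moving a tail away from the word before it, lifting max L into R, and making room for it there.
raise : ℕ → ℕ → ℕ → ℕ
raise m d x = if x ≤ᵇ m then x else d + x

raise-≤ : ∀ {m d x} → x ≤ m → raise m d x ≡ x
raise-≤ {m} {d} {x} x≤m = cong (λ b → if b then x else d + x) (T⇒≡true (ℕₚ.≤⇒≤ᵇ x≤m))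

raise-> : ∀ {m d x} → m < x → raise m d x ≡ d + x
raise-> {m} {d} {x} m<x = cong (λ b → if b then x else d + x) (¬T⇒≡false (λ t → ℕₚ.<⇒≱ m<x (ℕₚ.≤ᵇ⇒≤ x m t)))

raise-mono : ∀ m d → StrictlyMonotone (raise m d)
raise-mono m d {x} {y} x<y with ℕₚ.≤-<-connex x m | ℕₚ.≤-<-connex y m
... | inj₁ x≤m | inj₁ y≤m = subst₂ _<_ (sym (raise-≤ x≤m)) (sym (raise-≤ y≤m)) x<y
... | inj₁ x≤m | inj₂ m<y = subst₂ _<_ (sym (raise-≤ x≤m)) (sym (raise-> m<y)) (ℕₚ.<-≤-trans x<y (ℕₚ.m≤n+m y d))
... | inj₂ m<x | inj₁ y≤m = contradiction y≤m (ℕₚ.<⇒≱ (ℕₚ.<-trans m<x x<y))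
... | inj₂ m<x | inj₂ m<y = subst₂ _<_ (sym (raise-> m<x)) (sym (raise-> m<y)) (ℕₚ.+-monoʳ-< d x<y)

map-raise-≤ : ∀ {m d X} → All (_≤ m) X → map (raise m d) X ≡ X
map-raise-≤ p = Lₚ.map-id-local (All.map raise-≤ p)

-- Only relative order matters, so a gap between X and the tail can be closed. Gaps arise whenever a
-- part of a permutation inherits the tail of the whole.
count-tail-shift : ∀ {X p} d k → All (_≤ p) X → count (X ++ seg (d + p) k) ≡ count (X ++ seg p k)
count-tail-shift {X} {p} d k X≤p = trans (cong count (sym (trans (Lₚ.map-++ (raise p d) X (seg p k))
    (cong₂ _++_ (map-raise-≤ X≤p) (map-seg p (d + p) k λ i →
      trans (raise-> (s≤s (ℕₚ.m≤m+n p i))) (trans (ℕₚ.+-suc d _) (cong suc (sym (ℕₚ.+-assoc d p i)))))))))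
  (count-map (raise-mono p d) (X ++ seg p k))

count-seg : ∀ d k → count (seg d k) ≡ count (seg 0 k)
count-seg d k = trans (cong (λ e → count (seg e k)) (sym (ℕₚ.+-identityʳ d))) (count-tail-shift {[]} d k [])

-- A cut inside an increasing run of consecutive values leaves such a run on the right, whose
-- fertility depends on its length alone; the sum over cuts is therefore a Cauchy product with
-- Catalan numbers.
∑-splits-seg : ∀ Y p j →
  ∑ℤ (splits (seg p j)) (λ q → count (Y ++ proj₁ q) ℤ.* count (proj₂ q))
  ≡ U.mul (λ i → count (Y ++ seg p i)) (λ i → count (seg 0 i)) j
∑-splits-seg Y p zero    = ℤₚ.+-identityʳ _
∑-splits-seg Y p (suc j) = cong₂ ℤ._+_ (cong (count (Y ++ []) ℤ.*_) (count-seg p (suc j))) (begin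
  ∑ℤ (map (λ q → suc p ∷ proj₁ q , proj₂ q) (splits (seg (suc p) j))) (λ q → count (Y ++ proj₁ q) ℤ.* count (proj₂ q))
    ≡⟨ ∑ℤ-map _ (splits (seg (suc p) j)) ⟩
  ∑ℤ (splits (seg (suc p) j)) (λ q → count (Y ++ suc p ∷ proj₁ q) ℤ.* count (proj₂ q))
    ≡⟨ ∑ℤ-cong (splits (seg (suc p) j)) (λ {q} _ → cong (λ z → count z ℤ.* count (proj₂ q)) (sym (Lₚ.++-assoc Y [ suc p ] (proj₁ q)))) ⟩
  ∑ℤ (splits (seg (suc p) j)) (λ q → count ((Y ∷ʳ suc p) ++ proj₁ q) ℤ.* count (proj₂ q))
    ≡⟨ ∑-splits-seg (Y ∷ʳ suc p) (suc p) j ⟩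
  U.mul (λ i → count ((Y ∷ʳ suc p) ++ seg (suc p) i)) (λ i → count (seg 0 i)) j
    ≡⟨ U.mul-cong (λ i → cong count (Lₚ.++-assoc Y [ suc p ] (seg (suc p) i))) (λ _ → refl) j ⟩
  U.mul (λ i → count (Y ++ suc p ∷ seg (suc p) i)) (λ i → count (seg 0 i)) j ∎)
  where open ≡-Reasoning

catalanCount : ℕ → ℤ
catalanCount k = count (seg 0 k)

catalanCount-suc : ∀ k → catalanCount (suc k) ≡ U.mul catalanCount catalanCount k
catalanCount-suc k = trans (cong count (seg-∷ʳ 0 k))
  (trans (count-rec (seg 0 k) (All.tabulate λ x∈ → s≤s (proj₂ (∈-seg⁻ 0 k x∈)))) (∑-splits-seg [] 0 k))

catalanCount≡catalan : ∀ k → catalanCount k ≡ + catalan k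
catalanCount≡catalan = CatalanSeries.≡catalan catalanCount refl catalanCount-suc

mul-cong-≤ : ∀ n {f f′ g : ℕ → ℤ} → (∀ i → i ≤ n → f i ≡ f′ i) → U.mul f g n ≡ U.mul f′ g n
mul-cong-≤ zero    {g = g} p = cong (λ z → z ℤ.* g 0) (p 0 z≤n)
mul-cong-≤ (suc n) {g = g} p = cong₂ (λ a b → a ℤ.* g (suc n) ℤ.+ b) (p 0 z≤n) (mul-cong-≤ n (λ i i≤n → p (suc i) (s≤s i≤n)))

All-prefix-seg : ∀ {m L} Y k → All (_≤ m) Y → All (_< m) L → All (_< suc (m + k)) (L ++ m ∷ Y ++ seg m k)
All-prefix-seg {m} Y k Y≤m L<m = Allₚ.++⁺ (All.map (λ z → ℕₚ.<-trans z m<) L<m)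
  (m< ∷ Allₚ.++⁺ (All.map (λ z → ℕₚ.≤-<-trans z m<) Y≤m) (All.tabulate (λ x∈ → s≤s (proj₂ (∈-seg⁻ m k x∈)))))
  where
  m< : m < suc (m + k)
  m< = s≤s (ℕₚ.m≤m+n m k)

-- The last tail entry is the maximum and is removed by `count-rec`. Cuts before m are kept apart
-- because they leave a word of the same shape with L shortened, which is what the induction in
-- `Hook` runs on.
count-seg-suc : ∀ {m L} Y k → All (_≤ m) Y → All (_< m) L →
  count (L ++ m ∷ Y ++ seg m (suc k)) ≡
    ∑ℤ (splits L) (λ p → count (proj₁ p) ℤ.* count (proj₂ p ++ m ∷ Y ++ seg m k))
    ℤ.+ ∑ℤ (splits (Y ++ seg m k)) (λ p → count (L ++ m ∷ proj₁ p) ℤ.* count (proj₂ p))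
count-seg-suc {m} {L} Y k Y≤m L<m = begin
  count (L ++ m ∷ Y ++ seg m (suc k))
    ≡⟨ cong (λ t → count (L ++ m ∷ Y ++ t)) (seg-∷ʳ m k) ⟩
  count (L ++ m ∷ Y ++ (seg m k ∷ʳ suc (m + k)))
    ≡⟨ cong (λ t → count (L ++ m ∷ t)) (sym (Lₚ.++-assoc Y (seg m k) _)) ⟩
  count (L ++ m ∷ (Y ++ seg m k) ∷ʳ suc (m + k))
    ≡⟨ cong count (sym (Lₚ.++-assoc L (m ∷ Y ++ seg m k) _)) ⟩
  count ((L ++ m ∷ Y ++ seg m k) ∷ʳ suc (m + k))
    ≡⟨ count-rec (L ++ m ∷ Y ++ seg m k) (All-prefix-seg Y k Y≤m L<m) ⟩
  ∑ℤ (splits (L ++ m ∷ Y ++ seg m k)) (λ p → count (proj₁ p) ℤ.* count (proj₂ p))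
    ≡⟨ ∑-splits L (λ α β → count α ℤ.* count β) ⟩
  _ ∎
  where open ≡-Reasoning

-- For π = L m ρ m+1 ⋯ m+k the hooks leaving m end at one of the tail entries,
-- and each of them splits π into an unsheltered part L m m+1 ⋯ and a sheltered part ρ m+1 ⋯.
module Hook {m x R} (R<m : All (_< m) (x ∷ R)) where
  private
    ρ : List ℕ
    ρ = x ∷ R

    hooked unsheltered : List ℕ → ℕ → ℤ
    hooked      L k = count (L ++ m ∷ ρ ++ seg m k)
    unsheltered L k = count (L ++ m ∷ seg m k)

    sheltered : ℕ → ℤ
    sheltered k = count (ρ ++ seg m k)

    branch : (List ℕ → ℕ → ℤ) → List ℕ → ℕ → ℤ
    branch F L k = ∑ℤ (splits L) (λ p → count (proj₁ p) ℤ.* F (proj₂ p) k)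

    unsheltered-suc : ∀ {L} k → All (_< m) L →
      unsheltered L (suc k) ≡ branch unsheltered L k ℤ.+ U.mul (unsheltered L) catalanCount k
    unsheltered-suc {L} k L<m = trans (count-seg-suc [] k [] L<m) (cong (λ z → branch unsheltered L k ℤ.+ z) (begin
      ∑ℤ (splits (seg m k)) (λ p → count (L ++ m ∷ proj₁ p) ℤ.* count (proj₂ p))
        ≡⟨ ∑ℤ-cong (splits (seg m k)) (λ {p} _ → cong (λ z → count z ℤ.* count (proj₂ p)) (sym (Lₚ.++-assoc L [ m ] (proj₁ p)))) ⟩
      ∑ℤ (splits (seg m k)) (λ p → count ((L ∷ʳ m) ++ proj₁ p) ℤ.* count (proj₂ p))
        ≡⟨ ∑-splits-seg (L ∷ʳ m) m k ⟩
      U.mul (λ i → count ((L ∷ʳ m) ++ seg m i)) catalanCount k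
        ≡⟨ U.mul-cong (λ i → cong count (Lₚ.++-assoc L [ m ] (seg m i))) (λ _ → refl) k ⟩
      U.mul (unsheltered L) catalanCount k ∎))
      where open ≡-Reasoning

    count-inside : ∀ L Y {p} → All (_< m) (x ∷ Y) → p ∈ splits Y → count (L ++ m ∷ x ∷ proj₁ p) ≡ + 0
    count-inside L Y {α , β} (x<m ∷ Y<m) p∈ =
      count-descent L (x<m ∷ Allₚ.++⁻ˡ α (subst (All (_< m)) (sym (splits-++ Y p∈)) Y<m))

    hooked-zero : ∀ L → hooked L 0 ≡ + 0
    hooked-zero L = trans (cong (λ z → count (L ++ m ∷ z)) (Lₚ.++-identityʳ ρ)) (count-descent L R<m)

    -- A cut before the first tail entry leaves a left factor that ends below m and has fertility 0.
    -- The surviving cuts come after at least one tail entry, which delays the convolution by one.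
    delayed : List ℕ → ℕ → ℤ
    delayed L zero    = + 0
    delayed L (suc k) = U.mul (hooked L ∘ suc) catalanCount k

    sum-over-R : ∀ L k → ∑ℤ (splits (R ++ seg m k)) (λ p → count (L ++ m ∷ x ∷ proj₁ p) ℤ.* count (proj₂ p)) ≡ delayed L k
    sum-over-R L zero = ∑ℤ-zero (splits (R ++ [])) λ {p} p∈ →
      cong (λ z → z ℤ.* count (proj₂ p)) (count-inside L R R<m (subst (λ X → p ∈ splits X) (Lₚ.++-identityʳ R) p∈))
    sum-over-R L (suc k) = begin
      ∑ℤ (splits (R ++ suc m ∷ seg (suc m) k)) (λ p → count (L ++ m ∷ x ∷ proj₁ p) ℤ.* count (proj₂ p))
        ≡⟨ ∑-splits R (λ α β → count (L ++ m ∷ x ∷ α) ℤ.* count β) ⟩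
      ∑ℤ (splits R) (λ p → count (L ++ m ∷ x ∷ proj₁ p) ℤ.* count (proj₂ p ++ seg m (suc k)))
        ℤ.+ ∑ℤ (splits (seg (suc m) k)) (λ p → count (L ++ m ∷ ρ ++ suc m ∷ proj₁ p) ℤ.* count (proj₂ p))
        ≡⟨ cong₂ ℤ._+_
             (∑ℤ-zero (splits R) λ {p} p∈ → cong (λ z → z ℤ.* count (proj₂ p ++ seg m (suc k))) (count-inside L R R<m p∈))
             (∑ℤ-cong (splits (seg (suc m) k)) λ {p} _ → cong (λ z → count z ℤ.* count (proj₂ p)) (assoc (proj₁ p))) ⟩
      + 0 ℤ.+ ∑ℤ (splits (seg (suc m) k)) (λ p → count ((L ++ m ∷ ρ ++ [ suc m ]) ++ proj₁ p) ℤ.* count (proj₂ p))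
        ≡⟨ ℤₚ.+-identityˡ _ ⟩
      ∑ℤ (splits (seg (suc m) k)) (λ p → count ((L ++ m ∷ ρ ++ [ suc m ]) ++ proj₁ p) ℤ.* count (proj₂ p))
        ≡⟨ ∑-splits-seg (L ++ m ∷ ρ ++ [ suc m ]) (suc m) k ⟩
      U.mul (λ i → count ((L ++ m ∷ ρ ++ [ suc m ]) ++ seg (suc m) i)) catalanCount k
        ≡⟨ U.mul-cong (λ i → cong count (sym (assoc (seg (suc m) i)))) (λ _ → refl) k ⟩
      U.mul (hooked L ∘ suc) catalanCount k ∎
      where
      open ≡-Reasoning
      assoc : ∀ t → L ++ m ∷ ρ ++ suc m ∷ t ≡ (L ++ m ∷ ρ ++ [ suc m ]) ++ t
      assoc t = sym (trans (Lₚ.++-assoc L (m ∷ ρ ++ [ suc m ]) t) (cong (λ z → L ++ m ∷ z) (Lₚ.++-assoc ρ [ suc m ] t)))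

    -- The three summands are the cuts before m, the cut right after m, and the cuts further right.
    hooked-suc : ∀ {L} k → All (_< m) L →
      hooked L (suc k) ≡ branch hooked L k ℤ.+ (unsheltered L 0 ℤ.* sheltered k ℤ.+ delayed L k)
    hooked-suc {L} k L<m = trans (count-seg-suc ρ k (All.map ℕₚ.<⇒≤ R<m) L<m)
      (cong (λ z → branch hooked L k ℤ.+ (unsheltered L 0 ℤ.* sheltered k ℤ.+ z))
        (trans (∑ℤ-map (λ p → x ∷ proj₁ p , proj₂ p) (splits (R ++ seg m k))) (sum-over-R L k)))

    All-suffix : ∀ {L p} → All (_< m) L → p ∈ splits L → All (_< m) (proj₂ p)
    All-suffix {L} {α , β} L<m p∈ = Allₚ.++⁻ʳ α (subst (All (_< m)) (sym (splits-++ L p∈)) L<m)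

    -- Both sides obey one recurrence: `unsheltered-suc` multiplied by `sheltered` becomes
    -- `hooked-suc`, since products with `sheltered` and `catalanCount` can be exchanged. The bound
    -- k makes the induction strong, as the delayed convolution uses all shorter tails; L stays
    -- general because cuts before m replace it by its suffixes.
    hook-≤ : ∀ k j → j ≤ k → ∀ {L} → All (_< m) L → hooked L (suc j) ≡ U.mul (unsheltered L) sheltered j
    hook-≤ k zero _ {L} L<m = begin
      hooked L 1
        ≡⟨ hooked-suc 0 L<m ⟩
      branch hooked L 0 ℤ.+ (unsheltered L 0 ℤ.* sheltered 0 ℤ.+ + 0)
        ≡⟨ cong₂ ℤ._+_ (∑ℤ-zero (splits L) λ {p} _ →
             trans (cong (λ z → count (proj₁ p) ℤ.* z) (hooked-zero (proj₂ p))) (ℤₚ.*-zeroʳ (count (proj₁ p))))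
             (ℤₚ.+-identityʳ (unsheltered L 0 ℤ.* sheltered 0)) ⟩
      + 0 ℤ.+ unsheltered L 0 ℤ.* sheltered 0
        ≡⟨ ℤₚ.+-identityˡ (unsheltered L 0 ℤ.* sheltered 0) ⟩
      unsheltered L 0 ℤ.* sheltered 0 ∎
      where open ≡-Reasoning
    hook-≤ (suc k) (suc j) (s≤s j≤k) {L} L<m = begin
      hooked L (suc (suc j))
        ≡⟨ hooked-suc (suc j) L<m ⟩
      branch hooked L (suc j) ℤ.+ (a ℤ.+ U.mul (hooked L ∘ suc) catalanCount j)
        ≡⟨ cong₂ (λ u v → u ℤ.+ (a ℤ.+ v))
             (∑ℤ-cong (splits L) λ {p} p∈ → cong (λ z → count (proj₁ p) ℤ.* z) (hook-≤ k j j≤k (All-suffix L<m p∈)))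
             (mul-cong-≤ j λ i i≤j → hook-≤ k i (ℕₚ.≤-trans i≤j j≤k) L<m) ⟩
      ∑ℤ (splits L) (λ p → count (proj₁ p) ℤ.* U.mul (unsheltered (proj₂ p)) sheltered j)
        ℤ.+ (a ℤ.+ U.mul (U.mul (unsheltered L) sheltered) catalanCount j)
        ≡⟨ cong₂ (λ u v → u ℤ.+ (a ℤ.+ v))
             (sym (mul-∑ (splits L) (λ p → count (proj₁ p)) (λ p → unsheltered (proj₂ p)) sheltered j))
             (exchange j) ⟩
      U.mul (branch unsheltered L) sheltered j ℤ.+ (a ℤ.+ U.mul (U.mul (unsheltered L) catalanCount) sheltered j)
        ≡⟨ x∙yz≈y∙xz (U.mul (branch unsheltered L) sheltered j) a (U.mul (U.mul (unsheltered L) catalanCount) sheltered j) ⟩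
      a ℤ.+ (U.mul (branch unsheltered L) sheltered j ℤ.+ U.mul (U.mul (unsheltered L) catalanCount) sheltered j)
        ≡⟨ cong (λ z → a ℤ.+ z) (trans
             (sym (U.mul-distribʳ sheltered (branch unsheltered L) (U.mul (unsheltered L) catalanCount) j))
             (U.mul-cong (λ i → sym (unsheltered-suc i L<m)) (λ _ → refl) j)) ⟩
      U.mul (unsheltered L) sheltered (suc j) ∎
      where
      open ≡-Reasoning
      open CSG ℤₚ.+-commutativeSemigroup using (x∙yz≈y∙xz)
      a = unsheltered L 0 ℤ.* sheltered (suc j)
      exchange : ∀ j → U.mul (U.mul (unsheltered L) sheltered) catalanCount j ≡ U.mul (U.mul (unsheltered L) catalanCount) sheltered j
      exchange j = trans (U.mul-assoc (unsheltered L) sheltered catalanCount j)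
        (trans (U.mul-cong {f = unsheltered L} (λ _ → refl) (U.mul-comm sheltered catalanCount) j)
               (sym (U.mul-assoc (unsheltered L) catalanCount sheltered j)))

  count-hook-zero : ∀ L → count (L ++ m ∷ x ∷ R ++ seg m 0) ≡ + 0
  count-hook-zero = hooked-zero

  count-hook : ∀ {L} k → All (_< m) L → count (L ++ m ∷ x ∷ R ++ seg m (suc k))
    ≡ U.mul (λ i → count (L ++ m ∷ seg m i)) (λ i → count (x ∷ R ++ seg m i)) k
  count-hook k L<m = hook-≤ k k ℕₚ.≤-refl L<m

-- Finite sets as lists without repetition

module _ {A : Set} where
  unique-↭ : ∀ {xs ys : List A} → Unique xs → Unique ys →
    (∀ {x} → x ∈ xs → x ∈ ys) → (∀ {x} → x ∈ ys → x ∈ xs) → xs ↭ ys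
  unique-↭ u v f g = ∼bag⇒↭ (unique∧set⇒bag u v (mk⇔ f g))

  pigeonhole : ∀ {xs ys : List A} → Unique xs → (∀ {x} → x ∈ xs → x ∈ ys) → length xs ≤ length ys
  pigeonhole-↭ : ∀ {xs ys : List A} → Unique xs → (∀ {x} → x ∈ xs → x ∈ ys) → ∃[ zs ] ys ↭ xs ++ zs
  pigeonhole-↭ {[]}     {ys} _ _ = ys , ↭-refl
  pigeonhole-↭ {x ∷ xs} (x∉ ∷ u) f with ∈-∃++ (f (here refl))
  ... | as , bs , refl =
    let zs , p = pigeonhole-↭ u (λ {y} y∈ → rest y∈ (∈-++⁻ as (f (there y∈))))
    in zs , ↭-trans (Permₚ.shift x as bs) (↭-prep x p)
    where
    rest : ∀ {y} → y ∈ xs → y ∈ as ⊎ y ∈ x ∷ bs → y ∈ as ++ bs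
    rest y∈ (inj₁ y∈as)         = ∈-++⁺ˡ y∈as
    rest y∈ (inj₂ (here refl))  = contradiction refl (All.lookup x∉ y∈)
    rest y∈ (inj₂ (there y∈bs)) = ∈-++⁺ʳ as y∈bs
  pigeonhole {xs} {ys} u f = let zs , p = pigeonhole-↭ u f in
    subst (length xs ≤_) (sym (trans (Permₚ.↭-length p) (Lₚ.length-++ xs))) (ℕₚ.m≤m+n _ _)

  pigeonhole-exact : ∀ {xs ys : List A} → Unique xs → (∀ {x} → x ∈ xs → x ∈ ys) → length ys ≤ length xs → ys ↭ xs
  pigeonhole-exact {xs} {ys} u f le with pigeonhole-↭ u f
  ... | []     , p = ↭-trans p (↭-reflexive (Lₚ.++-identityʳ xs))
  ... | z ∷ zs , p = contradiction
    (ℕₚ.≤-trans (ℕₚ.≤-reflexive (sym (trans (Permₚ.↭-length p) (trans (Lₚ.length-++ xs) (ℕₚ.+-suc _ _))))) le)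
    (ℕₚ.<⇒≱ (s≤s (ℕₚ.m≤m+n _ _)))

  module _ {B : Set} where
    ∈-concatMap⇒ : ∀ (f : B → List A) {y} xs → y ∈ concatMap f xs → ∃[ x ] x ∈ xs × y ∈ f x
    ∈-concatMap⇒ f xs y∈ = find (∈-concatMap⁻ f y∈)

    ⇒∈-concatMap : ∀ (f : B → List A) {x y xs} → x ∈ xs → y ∈ f x → y ∈ concatMap f xs
    ⇒∈-concatMap f x∈ y∈ = ∈-concatMap⁺ f (lose x∈ y∈)

    concatMap-unique : ∀ (f : B → List A) {xs} → Unique xs → (∀ {x} → x ∈ xs → Unique (f x)) →
      (∀ {x x′ y} → x ∈ xs → x′ ∈ xs → y ∈ f x → y ∈ f x′ → x ≡ x′) → Unique (concatMap f xs)
    concatMap-unique f []       _ _ = []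
    concatMap-unique f {x ∷ xs} (x∉ ∷ u) v inj = Uniqueₚ.++⁺ (v (here refl))
      (concatMap-unique f u (v ∘ there) (λ p q → inj (there p) (there q)))
      λ (y∈ , y∈′) → let x′ , x′∈ , y∈″ = ∈-concatMap⇒ f xs y∈′ in
        All.lookup x∉ x′∈ (inj (here refl) (there x′∈) y∈ y∈″)

map-unique-local : ∀ {A B : Set} (f : A → B) {xs} → Unique xs →
  (∀ {x y} → x ∈ xs → y ∈ xs → f x ≡ f y → x ≡ y) → Unique (map f xs)
map-unique-local f []       _   = []
map-unique-local f (x∉ ∷ u) inj =
  Allₚ.map⁺ (All.tabulate λ y∈ eq → All.lookup x∉ y∈ (inj (here refl) (there y∈) eq))
  ∷ map-unique-local f u (λ p q → inj (there p) (there q))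

split-at-injective : ∀ {m : ℕ} A {A′ B B′} → m ∉ A → m ∉ A′ → A ++ m ∷ B ≡ A′ ++ m ∷ B′ → A ≡ A′ × B ≡ B′
split-at-injective []      {[]}     _  _   refl = refl , refl
split-at-injective []      {_ ∷ _}  _  m∉′ refl = contradiction (here refl) m∉′
split-at-injective (_ ∷ _) {[]}     m∉ _   refl = contradiction (here refl) m∉
split-at-injective (a ∷ A) {a′ ∷ A′} m∉ m∉′ eq with Lₚ.∷-injective eq
... | refl , eq′ = let p , q = split-at-injective A (m∉ ∘ there) (m∉′ ∘ there) eq′ in cong (a ∷_) p , q

<-∉ : ∀ {m A} → All (_< m) A → m ∉ A
<-∉ A<m m∈ = ℕₚ.<-irrefl refl (All.lookup A<m m∈)

join : ℕ → List (List ℕ) → List (List ℕ) → List (List ℕ)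
join m As Bs = concatMap (λ A → map (λ B → A ++ m ∷ B) Bs) As

-- The recursion of `countFuel` with lists in place of numbers, so that its cardinality is
-- `countFuel` by construction; what remains is that the list is sound, complete and free of
-- repetitions.
preimagesFuel : ℕ → ∀ {π : List ℕ} → InitLast π → List (List ℕ)
preimagesFuel _       []        = [ [] ]
preimagesFuel zero    (X ∷ʳ′ m) = []
preimagesFuel (suc k) (X ∷ʳ′ m) with All.all? (ℕₚ._<? m) X
... | yes _ = concatMap (λ p → join m (preimagesFuel k (initLast (proj₁ p))) (preimagesFuel k (initLast (proj₂ p)))) (splits X)
... | no  _ = []

card : List (List ℕ) → ℤ
card xs = ∑ℤ xs (λ _ → + 1)

card≡length : ∀ xs → card xs ≡ + length xs
card≡length []       = refl
card≡length (x ∷ xs) = cong (λ z → + 1 ℤ.+ z) (card≡length xs)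

card-join : ∀ m As Bs → card (join m As Bs) ≡ card As ℤ.* card Bs
card-join m As Bs = begin
  card (join m As Bs)
    ≡⟨ ∑ℤ-concatMap (λ A → map (λ B → A ++ m ∷ B) Bs) As ⟩
  ∑ℤ As (λ A → card (map (λ B → A ++ m ∷ B) Bs))
    ≡⟨ ∑ℤ-cong As (λ {A} _ → trans (∑ℤ-map (λ B → A ++ m ∷ B) Bs) (sym (ℤₚ.*-identityˡ (card Bs)))) ⟩
  ∑ℤ As (λ _ → + 1 ℤ.* card Bs)
    ≡⟨ sym (∑ℤ-*ʳ As (card Bs)) ⟩
  card As ℤ.* card Bs ∎
  where open ≡-Reasoning

card-preimages : ∀ k {π} (v : InitLast π) → card (preimagesFuel k v) ≡ countFuel k v
card-preimages k       []        = refl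
card-preimages zero    (X ∷ʳ′ m) = refl
card-preimages (suc k) (X ∷ʳ′ m) with All.all? (ℕₚ._<? m) X
... | no  _ = refl
... | yes _ = trans (∑ℤ-concatMap _ (splits X)) (∑ℤ-cong (splits X) λ {p} _ →
  let v₁ = initLast (proj₁ p) ; v₂ = initLast (proj₂ p) in
  trans (card-join m (preimagesFuel k v₁) (preimagesFuel k v₂))
    (cong₂ ℤ._*_ (card-preimages k v₁) (card-preimages k v₂)))

Unique-splits : ∀ X {p} → Unique X → p ∈ splits X → Unique (proj₁ p) × Unique (proj₂ p) × Cross _≢_ (proj₁ p) (proj₂ p)
Unique-splits X {α , β} u p∈ = AllPairs-++⁻ α (subst Unique (sym (splits-++ X p∈)) u)

Unique-∷ʳ : ∀ X {m : ℕ} → Unique (X ∷ʳ m) → Unique X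
Unique-∷ʳ X u = proj₁ (AllPairs-++⁻ X u)

∈-join⁻ : ∀ {m As Bs σ} → σ ∈ join m As Bs → ∃[ A ] ∃[ B ] A ∈ As × B ∈ Bs × σ ≡ A ++ m ∷ B
∈-join⁻ {m} {As} {Bs} σ∈ with ∈-concatMap⇒ (λ A → map (λ B → A ++ m ∷ B) Bs) As σ∈
... | A , A∈ , σ∈′ with ∈-map⁻ (λ B → A ++ m ∷ B) σ∈′
... | B , B∈ , eq = A , B , A∈ , B∈ , eq

preimages-sound : ∀ k {π} (v : InitLast π) {σ} → Unique π → σ ∈ preimagesFuel k v → Unique σ × s σ ≡ π
preimages-sound k       []        u (here refl) = [] , refl
preimages-sound (suc k) (X ∷ʳ′ m) u σ∈ with All.all? (ℕₚ._<? m) X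
... | yes X<m with ∈-concatMap⇒ _ (splits X) σ∈
... | (α , β) , p∈ , σ∈′ with ∈-join⁻ {m} {preimagesFuel k (initLast α)} {preimagesFuel k (initLast β)} σ∈′
... | A , B , A∈ , B∈ , refl =
  let uα , uβ , c = Unique-splits X (Unique-∷ʳ X u) p∈
      uA , sA = preimages-sound k (initLast α) uα A∈
      uB , sB = preimages-sound k (initLast β) uβ B∈
      A↭α = subst (A ↭_) sA (↭-sym (s-↭ uA))
      B↭β = subst (B ↭_) sB (↭-sym (s-↭ uB))
      αβ<m = subst (All (_< m)) (sym (splits-++ X p∈)) X<m
      A<m = Permₚ.All-resp-↭ (↭-sym A↭α) (Allₚ.++⁻ˡ α αβ<m)
      B<m = Permₚ.All-resp-↭ (↭-sym B↭β) (Allₚ.++⁻ʳ α αβ<m)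
      uσ = AllPairs-++⁺ uA (All.map (λ z e → ℕₚ.<⇒≢ z (sym e)) B<m ∷ uB)
             (λ x∈ → λ { (here refl) → ℕₚ.<⇒≢ (All.lookup A<m x∈)
                       ; (there y∈) → c (Permₚ.∈-resp-↭ A↭α x∈) (Permₚ.∈-resp-↭ B↭β y∈) })
  in uσ , trans (s-node uσ A<m B<m) (trans (cong₂ (λ a b → a ++ b ++ [ m ]) sA sB)
            (trans (sym (Lₚ.++-assoc α β [ m ])) (cong (_∷ʳ m) (splits-++ X p∈))))

preimages-complete : ∀ k {π} (v : InitLast π) {σ} → length π ≤ k → Unique σ → s σ ≡ π → σ ∈ preimagesFuel k v
preimages-complete k v {σ} le u eq = go k v le (decompose u) u eq
  where
  go : ∀ k {π} (v : InitLast π) {σ} → length π ≤ k → Decomposed σ → Unique σ → s σ ≡ π → σ ∈ preimagesFuel k v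
  go k       []        _  leaf _ _ = here refl
  go k       []        _  (node {A} {m} {B} A<m B<m _ _) u eq =
    contradiction (trans (sym (length-∷ʳ (s A ++ s B) m))
      (cong length (trans (Lₚ.++-assoc (s A) (s B) [ m ]) (trans (sym (s-node u A<m B<m)) eq)))) λ ()
  go zero    (X ∷ʳ′ m) le _ _ _ = contradiction (subst (_≤ 0) (length-∷ʳ X m) le) λ ()
  go (suc k) (X ∷ʳ′ m) le leaf _ eq = contradiction (trans (cong length eq) (length-∷ʳ X m)) λ ()
  go (suc k) (X ∷ʳ′ m) le (node {A} {m′} {B} A<m B<m dA dB) u eq
    with Lₚ.∷ʳ-injective (s A ++ s B) X
           (trans (Lₚ.++-assoc (s A) (s B) [ m′ ]) (trans (sym (s-node u A<m B<m)) eq))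
  ... | refl , refl with All.all? (ℕₚ._<? m) (s A ++ s B)
  ...   | no ¬p = contradiction (Allₚ.++⁺ (Permₚ.All-resp-↭ (↭-sym (s-↭ uA)) A<m) (Permₚ.All-resp-↭ (↭-sym (s-↭ uB)) B<m)) ¬p
    where
    uA = proj₁ (Unique-parts A u)
    uB = proj₂ (Unique-parts A u)
  ...   | yes _ = ⇒∈-concatMap (λ p → join m (preimagesFuel k (initLast (proj₁ p))) (preimagesFuel k (initLast (proj₂ p))))
      (∈-splits (s A))
      (⇒∈-concatMap (λ A → map (λ B → A ++ m ∷ B) (preimagesFuel k (initLast (s B))))
        (go k (initLast (s A)) (ℕₚ.≤-trans l₁ le′) dA (proj₁ (Unique-parts A u)) refl)
        (∈-map⁺ (λ B → A ++ m ∷ B) (go k (initLast (s B)) (ℕₚ.≤-trans l₂ le′) dB (proj₂ (Unique-parts A u)) refl)))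
    where
    le′ = ℕₚ.≤-pred (subst (_≤ suc k) (length-∷ʳ (s A ++ s B) m) le)
    l₁ = proj₁ (splits-length (s A ++ s B) (∈-splits (s A)))
    l₂ = proj₂ (splits-length (s A ++ s B) (∈-splits (s A)))

-- The position of m recovers A and B from A m B, and applying `s` to A and B recovers the
-- factorisation they came from.
preimages-unique : ∀ k {π} (v : InitLast π) → Unique π → Unique (preimagesFuel k v)
preimages-unique k       []        u = [] ∷ []
preimages-unique zero    (X ∷ʳ′ m) u = []
preimages-unique (suc k) (X ∷ʳ′ m) u with All.all? (ℕₚ._<? m) X
... | no  _   = []
... | yes X<m = concatMap-unique _ (splits-unique X)
  (λ {p} p∈ → let α , β = p ; uα , uβ , _ = Unique-splits X uX p∈ in
     concatMap-unique (λ A → map (λ B → A ++ m ∷ B) (preimagesFuel k (initLast β))) (preimages-unique k (initLast α) uα)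
       (λ {A} _ → Uniqueₚ.map⁺ (λ eq → Lₚ.∷-injectiveʳ (Lₚ.++-cancelˡ A _ _ eq)) (preimages-unique k (initLast β) uβ))
       λ {A} {A′} A∈ A′∈ y∈ y∈′ →
         let B , _ , eq = ∈-map⁻ (λ B → A ++ m ∷ B) y∈ ; B′ , _ , eq′ = ∈-map⁻ (λ B → A′ ++ m ∷ B) y∈′ in
         proj₁ (split-at-injective A (∉-left p∈ A∈) (∉-left p∈ A′∈) (trans (sym eq) eq′)))
  λ { {α , β} {α′ , β′} p∈ p′∈ y∈ y∈′ →
    let uα , uβ , _ = Unique-splits X uX p∈ ; uα′ , uβ′ , _ = Unique-splits X uX p′∈
        A , B , A∈ , B∈ , eq = ∈-join⁻ {m} {preimagesFuel k (initLast α)} {preimagesFuel k (initLast β)} y∈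
        A′ , B′ , A′∈ , B′∈ , eq′ = ∈-join⁻ {m} {preimagesFuel k (initLast α′)} {preimagesFuel k (initLast β′)} y∈′
        A≡A′ , B≡B′ = split-at-injective A (∉-left p∈ A∈) (∉-left p′∈ A′∈) (trans (sym eq) eq′)
    in cong₂ _,_ (trans (sym (proj₂ (preimages-sound k (initLast α) uα A∈)))
                   (trans (cong s A≡A′) (proj₂ (preimages-sound k (initLast α′) uα′ A′∈))))
                 (trans (sym (proj₂ (preimages-sound k (initLast β) uβ B∈)))
                   (trans (cong s B≡B′) (proj₂ (preimages-sound k (initLast β′) uβ′ B′∈)))) }
  where
  uX = Unique-∷ʳ X u
  ∉-left : ∀ {p A} → p ∈ splits X → A ∈ preimagesFuel k (initLast (proj₁ p)) → m ∉ A
  ∉-left {α , β} {A} p∈ A∈ =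
    let uα , _ , _ = Unique-splits X uX p∈
        uA , sA = preimages-sound k (initLast α) uα A∈
    in <-∉ (Permₚ.All-resp-↭ (subst (_↭ A) sA (s-↭ uA)) (Allₚ.++⁻ˡ α (subst (All (_< m)) (sym (splits-++ X p∈)) X<m)))

-- The permutations of 1, ..., n as a list

words-∈⁻ : ∀ n k {w} → w ∈ words n k → length w ≡ k × (∀ {x} → x ∈ w → x ∈ oneTo n)
words-∈⁻ n zero    (here refl) = refl , λ ()
words-∈⁻ n (suc k) w∈ with ∈-concatMap⇒ _ (words n k) w∈
... | w , w∈′ , x∷w∈ with ∈-map⁻ (_∷ w) x∷w∈
... | x , x∈ , refl = let l , f = words-∈⁻ n k w∈′ in
  cong suc l , λ { (here refl) → x∈ ; (there y∈) → f y∈ }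

words-∈⁺ : ∀ n k {w} → length w ≡ k → (∀ {x} → x ∈ w → x ∈ oneTo n) → w ∈ words n k
words-∈⁺ n zero    {[]}    _ _ = here refl
words-∈⁺ n (suc k) {x ∷ w} l f =
  ⇒∈-concatMap (λ w → map (_∷ w) (oneTo n)) (words-∈⁺ n k (ℕₚ.suc-injective l) (f ∘ there)) (∈-map⁺ (_∷ w) (f (here refl)))

oneTo-unique : ∀ n → Unique (oneTo n)
oneTo-unique n = subst Unique (sym (oneTo≡seg n)) (seg-Unique 0 n)

words-unique : ∀ n k → Unique (words n k)
words-unique n zero    = [] ∷ []
words-unique n (suc k) = concatMap-unique _ (words-unique n k)
  (λ {w} _ → Uniqueₚ.map⁺ Lₚ.∷-injectiveˡ (oneTo-unique n))
  λ {w} {w′} _ _ y∈ y∈′ →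
    let _ , _ , eq = ∈-map⁻ (_∷ w) y∈ ; _ , _ , eq′ = ∈-map⁻ (_∷ w′) y∈′ in
    Lₚ.∷-injectiveʳ (trans (sym eq) eq′)

elemᵇ⇒∈ : ∀ x l → T (elemᵇ x l) → x ∈ l
elemᵇ⇒∈ x l t = Any.map (λ {y} → ℕₚ.≡ᵇ⇒≡ x y) (Anyₚ.any⁻ (x ≡ᵇ_) l t)

∈⇒elemᵇ : ∀ {x l} → x ∈ l → T (elemᵇ x l)
∈⇒elemᵇ {x} x∈ = Anyₚ.any⁺ (x ≡ᵇ_) (Any.map (λ {y} → ℕₚ.≡⇒≡ᵇ x y) x∈)

length-oneTo : ∀ n → length (oneTo n) ≡ n
length-oneTo n = Lₚ.length-applyUpTo suc n

-- `S` only tests that each of 1, ..., n occurs; in a word of length n each then occurs exactly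
-- once, by the pigeonhole principle.
S-∈⁻ : ∀ {n w} → w ∈ S n → w ↭ oneTo n
S-∈⁻ {n} {w} w∈ =
  let w∈′ , t = ∈-filter⁻ _ {xs = words n n} w∈
      l , _ = words-∈⁻ n n w∈′
  in pigeonhole-exact (oneTo-unique n)
       (λ {x} x∈ → elemᵇ⇒∈ x w (All.lookup (Allₚ.all⁺ (λ i → elemᵇ i w) (oneTo n) t) x∈))
       (ℕₚ.≤-reflexive (trans l (sym (length-oneTo n))))

S-∈⁺ : ∀ {n w} → w ↭ oneTo n → w ∈ S n
S-∈⁺ {n} {w} p = ∈-filter⁺ _
  (words-∈⁺ n n (trans (Permₚ.↭-length p) (length-oneTo n)) (Permₚ.∈-resp-↭ p))
  (Allₚ.all⁻ (λ i → elemᵇ i w) (All.tabulate λ x∈ → ∈⇒elemᵇ (Permₚ.∈-resp-↭ (↭-sym p) x∈)))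

S-unique : ∀ n → Unique (S n)
S-unique n = Uniqueₚ.filter⁺ _ (words-unique n n)

perm-unique : ∀ {n π} → π ↭ oneTo n → Unique π
perm-unique {n} p = Unique-resp-↭ (↭-sym p) (oneTo-unique n)

eqListᵇ⇒≡ : ∀ xs ys → T (eqListᵇ xs ys) → xs ≡ ys
eqListᵇ⇒≡ []       []       _ = refl
eqListᵇ⇒≡ (x ∷ xs) (y ∷ ys) t =
  let t₁ , t₂ = Equivalence.to Bₚ.T-∧ t in cong₂ _∷_ (ℕₚ.≡ᵇ⇒≡ x y t₁) (eqListᵇ⇒≡ xs ys t₂)

eqListᵇ-refl : ∀ xs → T (eqListᵇ xs xs)
eqListᵇ-refl []       = tt
eqListᵇ-refl (x ∷ xs) = Equivalence.from Bₚ.T-∧ (ℕₚ.≡⇒≡ᵇ x x refl , eqListᵇ-refl xs)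

preimageCount≡count : ∀ {n π} → π ↭ oneTo n → + preimageCount n π ≡ count π
preimageCount≡count {n} {π} p = trans (cong +_ (Permₚ.↭-length perm))
  (trans (sym (card≡length (preimagesFuel (length π) (initLast π)))) (card-preimages (length π) (initLast π)))
  where
  u = perm-unique p
  perm : filterᵇ (λ σ → eqListᵇ (s σ) π) (S n) ↭ preimagesFuel (length π) (initLast π)
  perm = unique-↭ (Uniqueₚ.filter⁺ _ (S-unique n)) (preimages-unique (length π) (initLast π) u)
    (λ {σ} σ∈ → let σ∈S , t = ∈-filter⁻ _ {xs = S n} σ∈ in
      preimages-complete (length π) (initLast π) ℕₚ.≤-refl (perm-unique (S-∈⁻ {n} σ∈S)) (eqListᵇ⇒≡ (s σ) π t))
    (λ {σ} σ∈ → let uσ , eq = preimages-sound (length π) (initLast π) u σ∈ in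
      ∈-filter⁺ _ (S-∈⁺ (↭-trans (↭-sym (s-↭ uσ)) (subst (_↭ oneTo n) (sym eq) p)))
        (subst (λ z → T (eqListᵇ z π)) (sym eq) (eqListᵇ-refl π)))

-- Legal spaces

T-ext : ∀ {a b} → (T a → T b) → (T b → T a) → a ≡ b
T-ext {true}  {true}  _ _ = refl
T-ext {true}  {false} f _ = ⊥-elim (f tt)
T-ext {false} {true}  _ g = ⊥-elim (g tt)
T-ext {false} {false} _ _ = refl

T-not⁻ : ∀ {b} → T (not b) → ¬ T b
T-not⁻ {false} _ ()

T-not⁺ : ∀ {b} → ¬ T b → T (not b)
T-not⁺ {false} _ = tt
T-not⁺ {true}  p = ⊥-elim (p tt)

increasingᵇ⇒Sorted : ∀ xs → T (increasingᵇ xs) → Sorted xs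
increasingᵇ⇒Sorted []          _ = []
increasingᵇ⇒Sorted (x ∷ [])    _ = [] ∷ []
increasingᵇ⇒Sorted (x ∷ y ∷ r) t =
  let t₁ , t₂ = Equivalence.to Bₚ.T-∧ t
      x<y = ℕₚ.<ᵇ⇒< x y t₁
      ih  = increasingᵇ⇒Sorted (y ∷ r) t₂
  in (x<y ∷ All.map (ℕₚ.<-trans x<y) (AllPairs.head ih)) ∷ ih

Sorted⇒increasingᵇ : ∀ {xs} → Sorted xs → T (increasingᵇ xs)
Sorted⇒increasingᵇ []                     = tt
Sorted⇒increasingᵇ ([] ∷ [])              = tt
Sorted⇒increasingᵇ ((x<y ∷ _) ∷ p@(_ ∷ _)) = Equivalence.from Bₚ.T-∧ (ℕₚ.<⇒<ᵇ x<y , Sorted⇒increasingᵇ p)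

W-∈⁻ : ∀ {n π} → π ∈ W 2 n → π ↭ oneTo n × Sortable₂ π
W-∈⁻ {n} {π} π∈ = let π∈S , t = ∈-filter⁻ _ {xs = S n} π∈ in S-∈⁻ {n} π∈S , increasingᵇ⇒Sorted (s (s π)) t

W-∈⁺ : ∀ {n π} → π ↭ oneTo n → Sortable₂ π → π ∈ W 2 n
W-∈⁺ p σ = ∈-filter⁺ _ (S-∈⁺ p) (Sorted⇒increasingᵇ σ)

W-unique : ∀ n → Unique (W 2 n)
W-unique n = Uniqueₚ.filter⁺ _ (S-unique n)

module _ {L m R} (u : Unique (L ++ m ∷ R)) (L<m : All (_< m) L) (R<m : All (_< m) R) where
  private
    uL = proj₁ (Unique-parts L u)
    uR = proj₂ (Unique-parts L u)

    X = s L ++ s R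

    s≡X∷ʳm : s (L ++ m ∷ R) ≡ X ∷ʳ m
    s≡X∷ʳm = trans (s-node u L<m R<m) (sym (Lₚ.++-assoc (s L) (s R) [ m ]))

    uXm : Unique (X ∷ʳ m)
    uXm = subst Unique s≡X∷ʳm (s-Unique u)

    X<m : All (_< m) X
    X<m = Allₚ.++⁺ (Permₚ.All-resp-↭ (↭-sym (s-↭ uL)) L<m) (Permₚ.All-resp-↭ (↭-sym (s-↭ uR)) R<m)

  -- The first pass puts m last and the second leaves it there, so the second pass really acts on
  -- s(L) s(R).
  Sortable₂-node⁻ : Sortable₂ (L ++ m ∷ R) → Sortable₁ (s L ++ s R)
  Sortable₂-node⁻ σ = proj₁ (AllPairs-s-node⁻ id uXm X<m [] (subst Sortable₁ s≡X∷ʳm σ))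

  Sortable₂-node⁺ : Sortable₁ (s L ++ s R) → Sortable₂ (L ++ m ∷ R)
  Sortable₂-node⁺ σ = subst Sortable₁ (sym s≡X∷ʳm) (AllPairs-s-node⁺ id uXm X<m [] σ [] (λ _ ()))

module _ {L₁ M L₂ m R} (u : Unique ((L₁ ++ M ∷ L₂) ++ m ∷ R))
         (L₁<M : All (_< M) L₁) (L₂<M : All (_< M) L₂)
         (L<m : All (_< m) (L₁ ++ M ∷ L₂)) (R<m : All (_< m) R) where
  private
    L = L₁ ++ M ∷ L₂
    A = s L₁ ++ s L₂
    uL = proj₁ (Unique-parts L u)
    uR = proj₂ (Unique-parts L u)
    uL₁ = proj₁ (Unique-parts L₁ uL)
    uL₂ = proj₂ (Unique-parts L₁ uL)

    A↭ : A ↭ L₁ ++ L₂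
    A↭ = Permₚ.++⁺ (s-↭ uL₁) (s-↭ uL₂)

    A<M : All (_< M) A
    A<M = Permₚ.All-resp-↭ (↭-sym A↭) (Allₚ.++⁺ L₁<M L₂<M)

    shape : s L ++ s R ≡ A ++ M ∷ s R
    shape = trans (cong (_++ s R) (trans (s-node uL L₁<M L₂<M) (sym (Lₚ.++-assoc (s L₁) (s L₂) [ M ]))))
              (Lₚ.++-assoc A [ M ] (s R))

    uA : Unique (A ++ M ∷ s R)
    uA = subst Unique shape (proj₁ (AllPairs-++⁻ (s L ++ s R)
           (subst Unique (trans (s-node u L<m R<m) (sym (Lₚ.++-assoc (s L) (s R) [ m ]))) (s-Unique u))))

  -- Since s(L) = A M with A = s(L₁) s(L₂) below M, the word s(L) s(R) has the shape of the append
  -- criterion. There, sortability of A is 2-stack-sortability of L, and separation of s(R) at M is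
  -- by definition `Legal M R`.
  Sortable₂-split⁻ : Sortable₂ (L ++ m ∷ R) →
    Sortable₂ L × Sortable₂ R × Cross _<_ (L₁ ++ L₂) R × Legal M R
  Sortable₂-split⁻ σ =
    let σA , σR , c , sep = Sortable₁-append⁻ A<M (s-Unique uR) uA (subst Sortable₁ shape (Sortable₂-node⁻ u L<m R<m σ))
    in Sortable₂-node⁺ uL L₁<M L₂<M σA , σR
     , (λ x∈ y∈ → c (Permₚ.∈-resp-↭ (↭-sym A↭) x∈) (Permₚ.∈-resp-↭ (↭-sym (s-↭ uR)) y∈)) , sep

  Sortable₂-split⁺ : Sortable₂ L → Sortable₂ R → Cross _<_ (L₁ ++ L₂) R → Legal M R → Sortable₂ (L ++ m ∷ R)
  Sortable₂-split⁺ σL σR c sep = Sortable₂-node⁺ u L<m R<m (subst Sortable₁ (sym shape)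
    (Sortable₁-append⁺ A<M (s-Unique uR) uA (Sortable₂-node⁻ uL L₁<M L₂<M σL) σR
      (λ x∈ y∈ → c (Permₚ.∈-resp-↭ A↭ x∈) (Permₚ.∈-resp-↭ (s-↭ uR) y∈)) sep))

-- Positions start at 0 here and at 1 in `at`, which also returns 0 outside the word; hence the
-- `suc i` in the two conversions.
data At : List ℕ → ℕ → ℕ → Set where
  here  : ∀ {x xs} → At (x ∷ xs) 0 x
  there : ∀ {x y xs i} → At xs i x → At (y ∷ xs) (suc i) x

At-∈ : ∀ {xs i x} → At xs i x → x ∈ xs
At-∈ here      = here refl
At-∈ (there p) = there (At-∈ p)

∈-At : ∀ {xs x} → x ∈ xs → ∃[ i ] At xs i x
∈-At (here refl) = 0 , here
∈-At (there x∈)  = let i , p = ∈-At x∈ in suc i , there p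

At-< : ∀ {xs i x} → At xs i x → i < length xs
At-< here      = s≤s z≤n
At-< (there p) = s≤s (At-< p)

At-at : ∀ {xs i} → i < length xs → At xs i (at xs (suc i))
At-at {x ∷ xs} {zero}  _       = here
At-at {x ∷ xs} {suc i} (s≤s l) = there (At-at l)

at-At : ∀ {xs i x} → At xs i x → at xs (suc i) ≡ x
at-At here      = refl
at-At (there p) = at-At p

At-++ˡ : ∀ {L R i x} → At L i x → At (L ++ R) i x
At-++ˡ here      = here
At-++ˡ (there p) = there (At-++ˡ p)

At-++ʳ : ∀ L {R i x} → At R i x → At (L ++ R) (length L + i) x
At-++ʳ []      p = p
At-++ʳ (_ ∷ L) p = there (At-++ʳ L p)

At-++⁻ˡ : ∀ L {R i x} → i < length L → At (L ++ R) i x → At L i x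
At-++⁻ˡ (y ∷ L) _       here      = here
At-++⁻ˡ (y ∷ L) (s≤s l) (there p) = there (At-++⁻ˡ L l p)

At-++⁻ʳ : ∀ L {R i x} → At (L ++ R) (length L + i) x → At R i x
At-++⁻ʳ []      p         = p
At-++⁻ʳ (_ ∷ L) (there p) = At-++⁻ʳ L p

-- A 231 pattern with a separating its lowest entry from the other two: the witness that the
-- defining condition of a legal space fails.
record Obstruction (a : ℕ) (π : List ℕ) : Set where
  constructor obstruction
  field
    {i j k x y z} : ℕ
    i<j : i < j
    j<k : j < k
    at-i : At π i x
    at-j : At π j y
    at-k : At π k z
    z≤a : z ≤ a
    a<x : a < x
    x<y : x < y

module _ {a m : ℕ} {L R : List ℕ} (L<m : All (_< m) L) (R<m : All (_< m) R) where
  private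
    π = L ++ m ∷ R

    ≤m : ∀ {x} → x ∈ π → x ≤ m
    ≤m = ∈-split (λ x∈ → ℕₚ.<⇒≤ (All.lookup L<m x∈)) ℕₚ.≤-refl (λ x∈ → ℕₚ.<⇒≤ (All.lookup R<m x∈))

    data Side (i x : ℕ) : Set where
      left  : i < length L → At L i x → Side i x
      mid   : i ≡ length L → x ≡ m → Side i x
      right : ∀ {i′} → i ≡ length L + suc i′ → At R i′ x → Side i x

    side : ∀ i {x} → At π i x → Side i x
    side i {x} p with ℕₚ.<-cmp i (length L)
    ... | tri< i<l _ _ = left i<l (At-++⁻ˡ L i<l p)
    ... | tri≈ _ refl _ = mid refl (middle (At-++⁻ʳ L (subst (λ i → At π i x) (sym (ℕₚ.+-identityʳ (length L))) p)))
      where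
      middle : ∀ {x} → At (m ∷ R) 0 x → x ≡ m
      middle here = refl
    ... | tri> _ _ l<i with ℕₚ.m≤n⇒∃[o]m+o≡n l<i
    ...   | o , refl = right (sym (ℕₚ.+-suc (length L) o))
      (tail (At-++⁻ʳ L (subst (λ i → At π i x) (sym (ℕₚ.+-suc (length L) o)) p)))
      where
      tail : ∀ {i x} → At (m ∷ R) (suc i) x → At R i x
      tail (there p) = p

    after : ∀ {i i′ j} → i ≡ length L + suc i′ → i < j → length L < j
    after {i′ = i′} refl i<j = ℕₚ.≤-<-trans (ℕₚ.m≤m+n (length L) (suc i′)) i<j

    shift-< : ∀ {i j i′ j′} → i ≡ length L + suc i′ → j ≡ length L + suc j′ → i < j → i′ < j′
    shift-< refl refl i<j = ℕₚ.≤-pred (ℕₚ.+-cancelˡ-< (length L) _ _ i<j)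

  -- The maximum m is too large to be x or z. If x lies in L and z in R, the middle entry can be
  -- forgotten, because m can always take its place (`obstruction-cross`); otherwise all three
  -- entries lie on one side.
  obstruction-node⁻ : Obstruction a π → Obstruction a L ⊎ Obstruction a R ⊎ (∃[ x ] ∃[ z ] x ∈ L × z ∈ R × z ≤ a × a < x)
  obstruction-node⁻ (obstruction {i} {j} {k} {x} {y} {z} i<j j<k pi pj pk z≤a a<x x<y)
    with side i pi | side k pk
  ... | _              | left k<l pk′ = inj₁ (obstruction i<j j<k
        (At-++⁻ˡ L (ℕₚ.<-trans i<j (ℕₚ.<-trans j<k k<l)) pi) (At-++⁻ˡ L (ℕₚ.<-trans j<k k<l) pj) pk′ z≤a a<x x<y)
  ... | _              | mid _ refl   = contradiction (≤m (At-∈ pi)) (ℕₚ.<⇒≱ (ℕₚ.≤-<-trans z≤a a<x))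
  ... | left _ pi′     | right _ pk′  = inj₂ (inj₂ (x , z , At-∈ pi′ , At-∈ pk′ , z≤a , a<x))
  ... | mid _ refl     | right _ _    = contradiction (≤m (At-∈ pj)) (ℕₚ.<⇒≱ x<y)
  ... | right ei pi′   | right ek pk′ with side j pj
  ...   | left j<l _   = contradiction (after ei i<j) (ℕₚ.<-asym j<l)
  ...   | mid ej _     = contradiction (after ei i<j) (ℕₚ.<-irrefl (sym ej))
  ...   | right ej pj′ = inj₂ (inj₁ (obstruction (shift-< ei ej i<j) (shift-< ej ek j<k) pi′ pj′ pk′ z≤a a<x x<y))

  obstruction-left : Obstruction a L → Obstruction a π
  obstruction-left (obstruction i<j j<k pi pj pk z≤a a<x x<y) =
    obstruction i<j j<k (At-++ˡ pi) (At-++ˡ pj) (At-++ˡ pk) z≤a a<x x<y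

  obstruction-right : Obstruction a R → Obstruction a π
  obstruction-right (obstruction i<j j<k pi pj pk z≤a a<x x<y) =
    obstruction (ℕₚ.+-monoʳ-< (length L) (s≤s i<j)) (ℕₚ.+-monoʳ-< (length L) (s≤s j<k))
      (At-++ʳ L (there pi)) (At-++ʳ L (there pj)) (At-++ʳ L (there pk)) z≤a a<x x<y

  obstruction-cross : ∀ {x z} → x ∈ L → z ∈ R → z ≤ a → a < x → Obstruction a π
  obstruction-cross x∈ z∈ z≤a a<x =
    let i , pi = ∈-At x∈ ; k , pk = ∈-At z∈ in
    obstruction (ℕₚ.<-≤-trans (At-< pi) (ℕₚ.≤-reflexive (sym (ℕₚ.+-identityʳ _)))) (ℕₚ.+-monoʳ-< (length L) (s≤s z≤n))
      (At-++ˡ pi) (At-++ʳ L here) (At-++ʳ L (there pk)) z≤a a<x (All.lookup L<m x∈)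

-- Both sides follow the same recursion at the maximum: nothing wrong within L, within R, or between
-- an entry of L and a later one of R. This passes from the pattern definition to a condition on
-- s(π).
legal⇔¬obstruction : ∀ {a π} → Unique π → Legal a π ⇔ (¬ Obstruction a π)
legal⇔¬obstruction {a} = split-induction (λ π → Legal a π ⇔ (¬ Obstruction a π))
  (mk⇔ (λ { _ (obstruction _ _ () _ _ _ _ _) }) (λ _ → [])) λ {L} {m} {R} u L<m R<m ihL ihR → mk⇔
  (λ legal o → let lL , lR , c = AllPairs-s-node⁻ Separated-< u L<m R<m legal in
    case obstruction-node⁻ L<m R<m o of λ
      { (inj₁ oL) → Equivalence.to ihL lL oL
      ; (inj₂ (inj₁ oR)) → Equivalence.to ihR lR oR
      ; (inj₂ (inj₂ (x , z , x∈ , z∈ , z≤a , a<x))) → ℕₚ.<⇒≱ a<x (c x∈ z∈ z≤a) })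
  λ ¬o → AllPairs-s-node⁺ Separated-< u L<m R<m
    (Equivalence.from ihL (¬o ∘ obstruction-left L<m R<m)) (Equivalence.from ihR (¬o ∘ obstruction-right L<m R<m))
    λ x∈ z∈ z≤a → ℕₚ.≮⇒≥ (λ a<x → ¬o (obstruction-cross L<m R<m x∈ z∈ z≤a a<x))

∈-oneTo⁻ : ∀ {n x} → x ∈ oneTo n → 0 < x × x ≤ n
∈-oneTo⁻ {n} {x} x∈ = ∈-seg⁻ 0 n (subst (x ∈_) (oneTo≡seg n) x∈)

∈-oneTo⁺ : ∀ {n x} → 0 < x → x ≤ n → x ∈ oneTo n
∈-oneTo⁺ {n} {x} l u = subst (x ∈_) (sym (oneTo≡seg n)) (∈-seg⁺ 0 n l u)

any-oneTo⁻ : ∀ p n → T (any p (oneTo n)) → ∃[ i ] i < n × T (p (suc i))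
any-oneTo⁻ p n t with find (Anyₚ.any⁻ p (oneTo n) t)
... | x , x∈ , px with ∈-oneTo⁻ {n} x∈
any-oneTo⁻ p n t | suc i , x∈ , px | _ , i<n = i , i<n , px

any-oneTo⁺ : ∀ p {n i} → i < n → T (p (suc i)) → T (any p (oneTo n))
any-oneTo⁺ p i<n px = Anyₚ.any⁺ p (lose (∈-oneTo⁺ (s≤s z≤n) i<n) px)

legalᵇ⇒¬obstruction : ∀ {a} π → T (legalᵇ π a) → ¬ Obstruction a π
legalᵇ⇒¬obstruction π t (obstruction i<j j<k pi pj pk z≤a a<x x<y) = T-not⁻ t
  (any-oneTo⁺ _ (At-< pi) (any-oneTo⁺ _ (At-< pj) (any-oneTo⁺ _ (At-< pk)
    (T-∧⁺ (ℕₚ.<⇒<ᵇ (s≤s i<j)) (T-∧⁺ (ℕₚ.<⇒<ᵇ (s≤s j<k))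
      (T-∧⁺ (ℕₚ.≤⇒≤ᵇ (subst (_≤ _) (sym (at-At pk)) z≤a)) (T-∧⁺ (ℕₚ.<⇒<ᵇ (subst (_ <_) (sym (at-At pi)) a<x))
        (ℕₚ.<⇒<ᵇ (subst₂ _<_ (sym (at-At pi)) (sym (at-At pj)) x<y)))))))))
  where
  T-∧⁺ : ∀ {a b} → T a → T b → T (a ∧ b)
  T-∧⁺ p q = Equivalence.from Bₚ.T-∧ (p , q)

¬obstruction⇒legalᵇ : ∀ {a} π → ¬ Obstruction a π → T (legalᵇ π a)
¬obstruction⇒legalᵇ {a} π ¬o = T-not⁺ λ t →
  let i , i< , t₁ = any-oneTo⁻ _ (length π) t
      j , j< , t₂ = any-oneTo⁻ _ (length π) t₁
      k , k< , t₃ = any-oneTo⁻ _ (length π) t₂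
      e₁ , t₄ = T-∧⁻ (suc i <ᵇ suc j) t₃
      e₂ , t₅ = T-∧⁻ (suc j <ᵇ suc k) t₄
      e₃ , t₆ = T-∧⁻ (at π (suc k) ≤ᵇ a) t₅
      e₄ , e₅ = T-∧⁻ (a <ᵇ at π (suc i)) t₆
  in ¬o (obstruction (ℕₚ.≤-pred (ℕₚ.<ᵇ⇒< (suc i) (suc j) e₁)) (ℕₚ.≤-pred (ℕₚ.<ᵇ⇒< (suc j) (suc k) e₂))
    (At-at i<) (At-at j<) (At-at k<) (ℕₚ.≤ᵇ⇒≤ _ a e₃) (ℕₚ.<ᵇ⇒< a _ e₄) (ℕₚ.<ᵇ⇒< _ _ e₅))
  where
  T-∧⁻ : ∀ a {b} → T (a ∧ b) → T a × T b
  T-∧⁻ a t = Equivalence.to (Bₚ.T-∧ {a}) t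

legalᵇ⇒Legal : ∀ {a π} → Unique π → T (legalᵇ π a) → Legal a π
legalᵇ⇒Legal {π = π} u t = Equivalence.from (legal⇔¬obstruction u) (legalᵇ⇒¬obstruction π t)

Legal⇒legalᵇ : ∀ {a π} → Unique π → Legal a π → T (legalᵇ π a)
Legal⇒legalᵇ {π = π} u l = ¬obstruction⇒legalᵇ π (Equivalence.to (legal⇔¬obstruction u) l)

-- Counting along an index range, unlike filtering a list, lets the spaces of a permutation be cut
-- into consecutive blocks by `cnt-+`.
cnt : (ℕ → Bool) → ℕ → ℕ
cnt p zero    = 0
cnt p (suc n) = (if p 0 then 1 else 0) + cnt (p ∘ suc) n

cnt-cong : ∀ {p q} n → (∀ i → i < n → p i ≡ q i) → cnt p n ≡ cnt q n
cnt-cong zero    _ = refl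
cnt-cong (suc n) e = cong₂ (λ b c → (if b then 1 else 0) + c) (e 0 (s≤s z≤n)) (cnt-cong n (λ i i<n → e (suc i) (s≤s i<n)))

cnt-zero : ∀ {p} n → (∀ i → i < n → p i ≡ false) → cnt p n ≡ 0
cnt-zero zero    _ = refl
cnt-zero (suc n) e rewrite e 0 (s≤s z≤n) = cnt-zero n (λ i i<n → e (suc i) (s≤s i<n))

cnt-+ : ∀ p i j → cnt p (i + j) ≡ cnt p i + cnt (λ k → p (i + k)) j
cnt-+ p zero    j = refl
cnt-+ p (suc i) j = trans (cong ((if p 0 then 1 else 0) ℕ.+_) (cnt-+ (p ∘ suc) i j))
  (sym (ℕₚ.+-assoc (if p 0 then 1 else 0) (cnt (p ∘ suc) i) _))

length-filter-applyUpTo : ∀ (p : ℕ → Bool) (f : ℕ → ℕ) n → length (filterᵇ p (applyUpTo f n)) ≡ cnt (p ∘ f) n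
length-filter-applyUpTo p f zero = refl
length-filter-applyUpTo p f (suc n) with p (f 0)
... | true  = cong suc (length-filter-applyUpTo p (f ∘ suc) n)
... | false = length-filter-applyUpTo p (f ∘ suc) n

length-filter-upTo : ∀ (p : ℕ → Bool) n → length (filterᵇ p (upTo n)) ≡ cnt p n
length-filter-upTo p n = length-filter-applyUpTo p id n

leg≡cnt : ∀ π {n} → length π ≡ n → leg π ≡ cnt (legalᵇ π) (suc n)
leg≡cnt π {n} eq = begin
  leg π
    ≡⟨⟩
  length (filterᵇ (legalᵇ π) (upTo (suc (length π))))
    ≡⟨ length-filter-upTo (legalᵇ π) (suc (length π)) ⟩
  cnt (legalᵇ π) (suc (length π))
    ≡⟨ cong (λ k → cnt (legalᵇ π) (suc k)) eq ⟩
  cnt (legalᵇ π) (suc n) ∎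
  where open ≡-Reasoning

Legal-top : ∀ {a π} → Unique π → All (_≤ a) π → Legal a π
Legal-top u p = Separated-≤ (Permₚ.All-resp-↭ (↭-sym (s-↭ u)) p)

Legal-bottom : ∀ {a π} → Unique π → All (a <_) π → Legal a π
Legal-bottom u p = Separated-> (Permₚ.All-resp-↭ (↭-sym (s-↭ u)) p)

legalᵇ-top : ∀ {a π} → Unique π → All (_≤ a) π → legalᵇ π a ≡ true
legalᵇ-top u p = T⇒≡true (Legal⇒legalᵇ u (Legal-top u p))

legalᵇ-cong : ∀ {a b π π′} → Unique π → Unique π′ → (Legal a π → Legal b π′) → (Legal b π′ → Legal a π) →
  legalᵇ π a ≡ legalᵇ π′ b
legalᵇ-cong u u′ f g = T-ext (Legal⇒legalᵇ u′ ∘ f ∘ legalᵇ⇒Legal u) (Legal⇒legalᵇ u ∘ g ∘ legalᵇ⇒Legal u′)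

perm-length : ∀ {n π} → π ↭ oneTo n → length π ≡ n
perm-length {n} p = trans (Permₚ.↭-length p) (length-oneTo n)

perm-≤ : ∀ {n π} → π ↭ oneTo n → All (_≤ n) π
perm-≤ p = All.tabulate λ x∈ → proj₂ (∈-oneTo⁻ (Permₚ.∈-resp-↭ p x∈))

perm-pos : ∀ {n π} → π ↭ oneTo n → All (0 <_) π
perm-pos {n} p = All.tabulate λ x∈ → proj₁ (∈-oneTo⁻ {n} (Permₚ.∈-resp-↭ p x∈))

perm-complete : ∀ {n π x} → π ↭ oneTo n → 0 < x → x ≤ n → x ∈ π
perm-complete p l u = Permₚ.∈-resp-↭ (↭-sym p) (∈-oneTo⁺ l u)

-- Spaces 0, ..., n correspond; the only new one lies above all entries and is always legal.
leg-suc : ∀ {n π π′} → π ↭ oneTo n → π′ ↭ oneTo (suc n) →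
  (∀ a → Legal a π → Legal a π′) → (∀ a → Legal a π′ → Legal a π) → leg π′ ≡ suc (leg π)
leg-suc {n} {π} {π′} p p′ f g = begin
  leg π′
    ≡⟨ leg≡cnt π′ (perm-length p′) ⟩
  cnt (legalᵇ π′) (suc (suc n))
    ≡⟨ cong (cnt (legalᵇ π′)) (ℕₚ.+-comm 1 (suc n)) ⟩
  cnt (legalᵇ π′) (suc n + 1)
    ≡⟨ cnt-+ (legalᵇ π′) (suc n) 1 ⟩
  cnt (legalᵇ π′) (suc n) + cnt (λ k → legalᵇ π′ (suc n + k)) 1
    ≡⟨ cong₂ (λ a b → a + ((if b then 1 else 0) + 0))
         (cnt-cong (suc n) (λ i _ → legalᵇ-cong u′ u (g i) (f i)))
         (legalᵇ-top u′ (subst (λ m → All (_≤ m) π′) (sym (ℕₚ.+-identityʳ (suc n))) (perm-≤ p′))) ⟩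
  cnt (legalᵇ π) (suc n) + 1
    ≡⟨ ℕₚ.+-comm (cnt (legalᵇ π) (suc n)) 1 ⟩
  suc (cnt (legalᵇ π) (suc n))
    ≡⟨ cong suc (sym (leg≡cnt π (perm-length p))) ⟩
  suc (leg π) ∎
  where
  open ≡-Reasoning
  u = perm-unique p
  u′ = perm-unique p′

insert-max-perm : ∀ {n} L {R} → L ++ R ↭ oneTo n → L ++ suc n ∷ R ↭ oneTo (suc n)
insert-max-perm {n} L {R} p = ↭-trans (Permₚ.shift (suc n) L R) (↭-trans (↭-prep (suc n) p)
  (↭-trans (Permₚ.∷↭∷ʳ (suc n) (oneTo n)) (↭-reflexive (Lₚ.applyUpTo-∷ʳ suc n))))

remove-max-perm : ∀ {n} L {R} → L ++ suc n ∷ R ↭ oneTo (suc n) → L ++ R ↭ oneTo n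
remove-max-perm {n} L {R} p = Permₚ.drop-∷ (↭-trans (↭-sym (Permₚ.shift (suc n) L R)) (↭-trans p
  (↭-sym (↭-trans (Permₚ.∷↭∷ʳ (suc n) (oneTo n)) (↭-reflexive (Lₚ.applyUpTo-∷ʳ suc n))))))

perm-< : ∀ {n π} → π ↭ oneTo n → All (_< suc n) π
perm-< p = All.map s≤s (perm-≤ p)

module _ {n π} (p : π ↭ oneTo n) where
  private
    pʳ : π ++ suc n ∷ [] ↭ oneTo (suc n)
    pʳ = insert-max-perm π (↭-trans (↭-reflexive (Lₚ.++-identityʳ π)) p)
    pˡ : suc n ∷ π ↭ oneTo (suc n)
    pˡ = insert-max-perm [] p

  leg-∷ʳ : leg (π ∷ʳ suc n) ≡ suc (leg π)
  leg-∷ʳ = leg-suc p pʳ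
    (λ a l → AllPairs-s-node⁺ Separated-< (perm-unique pʳ) (perm-< p) [] l [] (λ _ ()))
    (λ a l → proj₁ (AllPairs-s-node⁻ Separated-< (perm-unique pʳ) (perm-< p) [] l))

  leg-∷ : leg (suc n ∷ π) ≡ suc (leg π)
  leg-∷ = leg-suc p pˡ
    (λ a l → AllPairs-s-node⁺ Separated-< (perm-unique pˡ) [] (perm-< p) [] l (λ ()))
    (λ a l → proj₁ (proj₂ (AllPairs-s-node⁻ Separated-< (perm-unique pˡ) [] (perm-< p) l)))

  W-∷ʳ⁺ : Sortable₂ π → π ∷ʳ suc n ∈ W 2 (suc n)
  W-∷ʳ⁺ σ = W-∈⁺ pʳ (Sortable₂-node⁺ (perm-unique pʳ) (perm-< p) [] (subst Sortable₁ (sym (Lₚ.++-identityʳ (s π))) σ))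

  W-∷⁺ : Sortable₂ π → suc n ∷ π ∈ W 2 (suc n)
  W-∷⁺ σ = W-∈⁺ pˡ (Sortable₂-node⁺ (perm-unique pˡ) [] (perm-< p) σ)

-- The space below all entries is always legal. Hence the exponent `leg π ∸ 1` never truncates.
leg-pos : ∀ {n π} → π ↭ oneTo n → ∃[ k ] leg π ≡ suc k
leg-pos {n} {π} p = cnt (legalᵇ π ∘ suc) n , trans (leg≡cnt π (perm-length p))
  (cong (λ b → (if b then 1 else 0) + cnt (legalᵇ π ∘ suc) n)
    (T⇒≡true {legalᵇ π 0} (Legal⇒legalᵇ (perm-unique p) (Legal-bottom (perm-unique p) (perm-pos p)))))

module _ {f : ℕ → ℕ} (f< : StrictlyMonotone f) {π : List ℕ} (u : Unique π) where
  Legal-map⁺ : ∀ {a b} → (∀ {x} → f x ≤ a → x ≤ b) → (∀ {x} → x ≤ b → f x ≤ a) → Legal b π → Legal a (map f π)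
  Legal-map⁺ to from l = subst (AllPairs (Separated _)) (sym (s-map f< u))
    (AllPairsₚ.map⁺ (AllPairs.map (λ p z≤a → from (p (to z≤a))) l))

  Legal-map⁻ : ∀ {a b} → (∀ {x} → f x ≤ a → x ≤ b) → (∀ {x} → x ≤ b → f x ≤ a) → Legal a (map f π) → Legal b π
  Legal-map⁻ to from l = AllPairs.map (λ p z≤b → to (p (from z≤b))) (AllPairsₚ.map⁻ (subst (AllPairs (Separated _)) (s-map f< u) l))

  ss-map : s (s (map f π)) ≡ map f (s (s π))
  ss-map = trans (cong s (s-map f< u)) (s-map f< (s-Unique u))

  Sortable₂-map⁺ : Sortable₂ π → Sortable₂ (map f π)
  Sortable₂-map⁺ σ = subst Sorted (sym ss-map) (AllPairsₚ.map⁺ (AllPairs.map f< σ))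

  Sortable₂-map⁻ : Sortable₂ (map f π) → Sortable₂ π
  Sortable₂-map⁻ σ = AllPairs.map (mono-reflects f<) (AllPairsₚ.map⁻ (subst Sorted ss-map σ))

-- On a permutation L of length l′ + 1, `glueˡ` moves only the maximum, up by q to l′ + 1 + q.
-- `glueʳ` lifts R above the other entries of L and skips exactly this value, so q entries of R end
-- up below max L.
glueˡ glueʳ : ℕ → ℕ → ℕ → ℕ
glueˡ l′ q = raise l′ q
glueʳ l′ q x = l′ + raise q 1 x

-- In a 2-stack-sortable L m R with L and R nonempty, the entries of L other than max L lie
-- below R, and max L sits in a legal space (q, q+1) of R; l′ + 1 is the length of L.
glue : ℕ → ℕ → List ℕ → List ℕ → ℕ → List ℕ
glue n l′ L R q = map (glueˡ l′ q) L ++ suc n ∷ map (glueʳ l′ q) R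

module _ (l′ q : ℕ) where
  glueʳ-mono : StrictlyMonotone (glueʳ l′ q)
  glueʳ-mono x<y = ℕₚ.+-monoʳ-< l′ (raise-mono q 1 x<y)

  glueʳ-≤ : ∀ {x} → x ≤ q → glueʳ l′ q x ≡ l′ + x
  glueʳ-≤ x≤q = cong (l′ ℕ.+_) (raise-≤ x≤q)

  glueʳ-> : ∀ {x} → q < x → glueʳ l′ q x ≡ suc l′ + x
  glueʳ-> {x} q<x = trans (cong (l′ ℕ.+_) (raise-> q<x)) (ℕₚ.+-suc l′ x)

  glueʳ-lower : ∀ {x} → 0 < x → l′ < glueʳ l′ q x
  glueʳ-lower {x} 0<x with ℕₚ.≤-<-connex x q
  ... | inj₁ x≤q = subst (l′ <_) (sym (glueʳ-≤ x≤q)) (ℕₚ.m<m+n l′ 0<x)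
  ... | inj₂ q<x = subst (l′ <_) (sym (glueʳ-> q<x)) (s≤s (ℕₚ.m≤m+n l′ x))

  glueʳ-upper : ∀ x → glueʳ l′ q x ≤ suc l′ + x
  glueʳ-upper x with ℕₚ.≤-<-connex x q
  ... | inj₁ x≤q = subst (_≤ suc l′ + x) (sym (glueʳ-≤ x≤q)) (ℕₚ.n≤1+n _)
  ... | inj₂ q<x = ℕₚ.≤-reflexive (glueʳ-> q<x)

  -- With `⇒glueʳ-≤` this identifies the space l′ + 1 + (q + j) of the glued word, at or above max
  -- L, with the space q + j of R.
  glueʳ-≤⇒ : ∀ {j x} → glueʳ l′ q x ≤ suc l′ + (q + j) → x ≤ q + j
  glueʳ-≤⇒ {j} {x} le with ℕₚ.≤-<-connex x q
  ... | inj₁ x≤q = ℕₚ.≤-trans x≤q (ℕₚ.m≤m+n q j)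
  ... | inj₂ q<x = ℕₚ.+-cancelˡ-≤ (suc l′) _ _ (subst (_≤ suc l′ + (q + j)) (glueʳ-> q<x) le)

  ⇒glueʳ-≤ : ∀ {j x} → x ≤ q + j → glueʳ l′ q x ≤ suc l′ + (q + j)
  ⇒glueʳ-≤ {j} {x} le = ℕₚ.≤-trans (glueʳ-upper x) (ℕₚ.+-monoʳ-≤ (suc l′) le)

  glueʳ-≢ : ∀ x → suc l′ + q ≢ glueʳ l′ q x
  glueʳ-≢ x eq with ℕₚ.≤-<-connex x q
  ... | inj₁ x≤q = ℕₚ.<⇒≢ (s≤s (ℕₚ.+-monoʳ-≤ l′ x≤q)) (sym (trans eq (glueʳ-≤ x≤q)))
  ... | inj₂ q<x = ℕₚ.<⇒≢ (ℕₚ.+-monoʳ-< (suc l′) q<x) (trans eq (glueʳ-> q<x))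

  glueˡ-≤ : ∀ {a x} → a ≤ l′ → glueˡ l′ q x ≤ a → x ≤ a
  glueˡ-≤ {a} {x} a≤l′ le with ℕₚ.≤-<-connex x l′
  ... | inj₁ x≤l′ = subst (_≤ a) (raise-≤ x≤l′) le
  ... | inj₂ l′<x = ℕₚ.≤-trans (ℕₚ.m≤n+m x q) (subst (_≤ a) (raise-> l′<x) le)

  ⇒glueˡ-≤ : ∀ {a x} → a ≤ l′ → x ≤ a → glueˡ l′ q x ≤ a
  ⇒glueˡ-≤ a≤l′ x≤a = subst (_≤ _) (sym (raise-≤ (ℕₚ.≤-trans x≤a a≤l′))) x≤a

  glueˡ-max : glueˡ l′ q (suc l′) ≡ suc l′ + q
  glueˡ-max = trans (raise-> ℕₚ.≤-refl) (ℕₚ.+-comm q (suc l′))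

  glueˡ-upper : ∀ {x} → x ≤ suc l′ → glueˡ l′ q x ≤ suc l′ + q
  glueˡ-upper {x} x≤l with ℕₚ.m≤n⇒m<n∨m≡n x≤l
  ... | inj₁ x<l  = subst (_≤ suc l′ + q) (sym (raise-≤ (ℕₚ.≤-pred x<l))) (ℕₚ.≤-trans x≤l (ℕₚ.m≤m+n (suc l′) q))
  ... | inj₂ refl = ℕₚ.≤-reflexive glueˡ-max

  -- Truncation at l′ + 1 undoes `glueˡ` without reference to q, so that `glue-injective` can
  -- recover L before q is known.
  glueˡ-left-inverse : ∀ {x} → x ≤ suc l′ → glueˡ l′ q x ⊓ suc l′ ≡ x
  glueˡ-left-inverse {x} x≤l with ℕₚ.m≤n⇒m<n∨m≡n x≤l
  ... | inj₁ x<l  = trans (cong (_⊓ suc l′) (raise-≤ (ℕₚ.≤-pred x<l))) (ℕₚ.m≤n⇒m⊓n≡m x≤l)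
  ... | inj₂ refl = trans (cong (_⊓ suc l′) glueˡ-max) (ℕₚ.m≥n⇒m⊓n≡n (ℕₚ.m≤m+n (suc l′) q))

module Glue {l′ r q L R} (pL : L ↭ oneTo (suc l′)) (pR : R ↭ oneTo r) (q≤r : q ≤ r) where
  private
    f = glueˡ l′ q
    g = glueʳ l′ q
    n = suc l′ + r

    uL = perm-unique pL
    uR = perm-unique pR

    f< : StrictlyMonotone f
    f< = raise-mono l′ q

    g< : StrictlyMonotone g
    g< = glueʳ-mono l′ q

    π : List ℕ
    π = glue n l′ L R q

  glueˡ≤n : All (_≤ n) (map f L)
  glueˡ≤n = Allₚ.map⁺ (All.map (λ x≤ → ℕₚ.≤-trans (glueˡ-upper l′ q x≤) (ℕₚ.+-monoʳ-≤ (suc l′) q≤r)) (perm-≤ pL))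

  glueʳ≤n : All (_≤ n) (map g R)
  glueʳ≤n = Allₚ.map⁺ (All.map (λ {x} x≤ → ℕₚ.≤-trans (glueʳ-upper l′ q x) (ℕₚ.+-monoʳ-≤ (suc l′) x≤)) (perm-≤ pR))

  private
    L<m : All (_< suc n) (map f L)
    L<m = All.map s≤s glueˡ≤n

    R<m : All (_< suc n) (map g R)
    R<m = All.map s≤s glueʳ≤n

    l′<gR : ∀ {y} → y ∈ map g R → l′ < y
    l′<gR y∈ = All.lookup {P = l′ <_} (Allₚ.map⁺ (All.map (glueʳ-lower l′ q) (perm-pos pR))) y∈

    f≢g : ∀ {x y} → x ≤ suc l′ → y ∈ map g R → f x ≢ y
    f≢g {x} x≤l y∈ eq with ℕₚ.m≤n⇒m<n∨m≡n x≤l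
    ... | inj₁ x<l = ℕₚ.<⇒≢ (ℕₚ.≤-<-trans (ℕₚ.≤-trans (ℕₚ.≤-reflexive (raise-≤ (ℕₚ.≤-pred x<l))) (ℕₚ.≤-pred x<l)) (l′<gR y∈)) eq
    ... | inj₂ refl with ∈-map⁻ g y∈
    ...   | z , _ , refl = glueʳ-≢ l′ q z (trans (sym (glueˡ-max l′ q)) eq)

  uniqueLR : Unique (map f L ++ map g R)
  uniqueLR = AllPairs-++⁺ (Unique-map f< uL) (Unique-map g< uR) λ {x} x∈ y∈ → case ∈-map⁻ f x∈ of λ
    { (z , z∈ , refl) → f≢g (All.lookup (perm-≤ pL) z∈) y∈ }

  glue-perm : π ↭ oneTo (suc n)
  glue-perm = insert-max-perm (map f L) (↭-sym (pigeonhole-exact uniqueLR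
    (λ {x} x∈ → ∈-oneTo⁺ (positive (∈-++⁻ (map f L) x∈)) (All.lookup (Allₚ.++⁺ glueˡ≤n glueʳ≤n) x∈))
    (ℕₚ.≤-reflexive (trans (length-oneTo n) (sym (trans (Lₚ.length-++ (map f L))
      (cong₂ _+_ (trans (Lₚ.length-map f L) (perm-length pL)) (trans (Lₚ.length-map g R) (perm-length pR)))))))))
    where
    positive : ∀ {x} → x ∈ map f L ⊎ x ∈ map g R → 0 < x
    positive (inj₂ x∈) = ℕₚ.≤-<-trans z≤n (l′<gR x∈)
    positive (inj₁ x∈) with ∈-map⁻ f x∈
    ... | z , z∈ , refl = ℕₚ.≰⇒> λ fz≤0 → ℕₚ.<⇒≱ (All.lookup (perm-pos pL) z∈) (glueˡ-≤ l′ q z≤n fz≤0)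

  private
    uπ : Unique π
    uπ = perm-unique glue-perm

  glue-Sortable₂ : Sortable₂ L → Sortable₂ R → Legal q R → Sortable₂ π
  glue-Sortable₂ σL σR legal with ∈-∃++ (perm-complete pL (s≤s z≤n) ℕₚ.≤-refl)
  ... | L₁ , L₂ , refl = subst (λ z → Sortable₂ (z ++ suc n ∷ map g R)) (sym shape)
    (Sortable₂-split⁺ (subst (λ z → Unique (z ++ suc n ∷ map g R)) shape uπ)
      (Allₚ.map⁺ (All.map f< L₁<)) (Allₚ.map⁺ (All.map f< L₂<))
      (subst (All (_< suc n)) shape L<m) R<m
      (subst Sortable₂ shape (Sortable₂-map⁺ f< uL σL)) (Sortable₂-map⁺ g< uR σR)
      (λ x∈ y∈ → ℕₚ.≤-<-trans (small x∈) (l′<gR y∈))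
      -- The case j = 0 of the translation of spaces: max L lands at l′ + 1 + q, which is the space
      -- q of R.
      (subst (λ M → Legal M (map g R)) (sym (trans (glueˡ-max l′ q) (cong (suc l′ ℕ.+_) (sym (ℕₚ.+-identityʳ q)))))
        (Legal-map⁺ g< uR (glueʳ-≤⇒ l′ q) (⇒glueʳ-≤ l′ q) (subst (λ a → Legal a R) (sym (ℕₚ.+-identityʳ q)) legal))))
    where
    shape : map f (L₁ ++ suc l′ ∷ L₂) ≡ map f L₁ ++ f (suc l′) ∷ map f L₂
    shape = Lₚ.map-++ f L₁ (suc l′ ∷ L₂)

    L₁L₂ : L₁ ++ L₂ ↭ oneTo l′
    L₁L₂ = remove-max-perm L₁ pL

    L₁< : All (_< suc l′) L₁
    L₁< = Allₚ.++⁻ˡ L₁ (perm-< L₁L₂)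

    L₂< : All (_< suc l′) L₂
    L₂< = Allₚ.++⁻ʳ L₁ (perm-< L₁L₂)

    small : ∀ {x} → x ∈ map f L₁ ++ map f L₂ → x ≤ l′
    small x∈ = All.lookup {P = _≤ l′} (subst (All (_≤ l′)) (Lₚ.map-++ f L₁ L₂)
      (Allₚ.map⁺ (All.map (λ z≤l′ → ⇒glueˡ-≤ l′ q ℕₚ.≤-refl z≤l′) (perm-≤ L₁L₂)))) x∈

  -- The spaces fall into four blocks: those up to l′ behave as in L; the next q are illegal, since
  -- max L lies above them and stands before the lowest entry of R; the following ones behave as in
  -- R from q on; the topmost is legal. The last one makes up for the top space of L, which is legal
  -- in L but missing from the first block.
  leg-glue : leg π ≡ leg L + cnt (λ j → legalᵇ R (q + j)) (suc (r ∸ q))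
  leg-glue = begin
    leg π
      ≡⟨ leg≡cnt π (perm-length glue-perm) ⟩
    cnt (legalᵇ π) (suc (suc n))
      ≡⟨ cong (cnt (legalᵇ π)) range ⟩
    cnt (legalᵇ π) (suc l′ + (q + (suc d + 1)))
      ≡⟨ trans (cnt-+ (legalᵇ π) (suc l′) _) (cong (cnt (legalᵇ π) (suc l′) ℕ.+_)
           (trans (cnt-+ (λ k → legalᵇ π (suc l′ + k)) q _) (cong (cnt (λ k → legalᵇ π (suc l′ + k)) q ℕ.+_)
             (cnt-+ (λ k → legalᵇ π (suc l′ + (q + k))) (suc d) 1)))) ⟩
    cnt (legalᵇ π) (suc l′) + (cnt (λ k → legalᵇ π (suc l′ + k)) q
      + (cnt (λ k → legalᵇ π (suc l′ + (q + k))) (suc d) + ((if legalᵇ π (suc l′ + (q + (suc d + 0))) then 1 else 0) + 0)))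
      ≡⟨ cong₂ _+_ (cnt-cong (suc l′) low) (cong₂ _+_ (cnt-zero q middle) (cong₂ _+_ (cnt-cong (suc d) high)
           (cong (λ b → (if b then 1 else 0) + 0) (legalᵇ-top uπ (subst (λ a → All (_≤ a) π) top (perm-≤ glue-perm)))))) ⟩
    cnt (legalᵇ L) (suc l′) + (c + 1)
      ≡⟨ trans (cong (cnt (legalᵇ L) (suc l′) ℕ.+_) (ℕₚ.+-comm c 1)) (sym (ℕₚ.+-assoc (cnt (legalᵇ L) (suc l′)) 1 c)) ⟩
    (cnt (legalᵇ L) (suc l′) + 1) + c
      ≡⟨ cong (_+ c) (sym leg-L) ⟩
    leg L + c ∎
    where
    open ≡-Reasoning
    d = r ∸ q
    c = cnt (λ j → legalᵇ R (q + j)) (suc d)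

    q+d : q + d ≡ r
    q+d = ℕₚ.m+[n∸m]≡n q≤r

    range : suc (suc n) ≡ suc l′ + (q + (suc d + 1))
    range = trans (cong (λ r → suc (suc (suc l′ + r))) (sym q+d)) (eq l′ q d)
      where
      eq : ∀ a b c → suc (suc (suc a + (b + c))) ≡ suc a + (b + (suc c + 1))
      eq = ℕSolver.solve-∀

    top : suc n ≡ suc l′ + (q + (suc d + 0))
    top = trans (cong (λ r → suc (suc l′ + r)) (sym q+d)) (eq l′ q d)
      where
      eq : ∀ a b c → suc (suc a + (b + c)) ≡ suc a + (b + (suc c + 0))
      eq = ℕSolver.solve-∀

    leg-L : leg L ≡ cnt (legalᵇ L) (suc l′) + 1
    leg-L = trans (leg≡cnt L (perm-length pL)) (trans (cong (cnt (legalᵇ L)) (ℕₚ.+-comm 1 (suc l′)))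
      (trans (cnt-+ (legalᵇ L) (suc l′) 1) (cong (λ b → cnt (legalᵇ L) (suc l′) + ((if b then 1 else 0) + 0))
        (legalᵇ-top uL (subst (λ a → All (_≤ a) L) (sym (ℕₚ.+-identityʳ (suc l′))) (perm-≤ pL))))))

    low : ∀ a → a < suc l′ → legalᵇ π a ≡ legalᵇ L a
    low a (s≤s a≤l′) = legalᵇ-cong uπ uL
      (λ l → Legal-map⁻ f< uL (glueˡ-≤ l′ q a≤l′) (⇒glueˡ-≤ l′ q a≤l′) (proj₁ (AllPairs-s-node⁻ Separated-< uπ L<m R<m l)))
      (λ l → AllPairs-s-node⁺ Separated-< uπ L<m R<m
        (Legal-map⁺ f< uL (glueˡ-≤ l′ q a≤l′) (⇒glueˡ-≤ l′ q a≤l′) l)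
        (Legal-bottom (Unique-map g< uR) (All.tabulate a<gR))
        (λ _ z∈ z≤a → contradiction z≤a (ℕₚ.<⇒≱ (a<gR z∈))))
      where
      a<gR : ∀ {y} → y ∈ map g R → a < y
      a<gR y∈ = ℕₚ.≤-<-trans a≤l′ (l′<gR y∈)

    middle : ∀ j → j < q → legalᵇ π (suc l′ + j) ≡ false
    middle j j<q = ¬T⇒≡false λ t →
      let _ , _ , cross = AllPairs-s-node⁻ Separated-< uπ L<m R<m (legalᵇ⇒Legal uπ t)
          0<q = ℕₚ.≤-<-trans z≤n j<q
      -- The offending pair is max L and the entry 1 of R, which becomes l′ + 1 because q is
      -- positive.
      in ℕₚ.<⇒≱ (ℕₚ.+-monoʳ-< (suc l′) j<q) (subst (_≤ suc l′ + j) (glueˡ-max l′ q)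
           (cross (∈-map⁺ f (perm-complete pL (s≤s z≤n) ℕₚ.≤-refl))
                  (∈-map⁺ g (perm-complete pR (s≤s z≤n) (ℕₚ.≤-trans 0<q q≤r)))
                  (ℕₚ.≤-trans (ℕₚ.≤-reflexive (trans (glueʳ-≤ l′ q 0<q) (ℕₚ.+-comm l′ 1))) (ℕₚ.m≤m+n (suc l′) j))))

    high : ∀ j → j < suc d → legalᵇ π (suc l′ + (q + j)) ≡ legalᵇ R (q + j)
    high j _ = legalᵇ-cong uπ uR
      (λ l → Legal-map⁻ g< uR (glueʳ-≤⇒ l′ q) (⇒glueʳ-≤ l′ q) (proj₁ (proj₂ (AllPairs-s-node⁻ Separated-< uπ L<m R<m l))))
      (λ l → AllPairs-s-node⁺ Separated-< uπ L<m R<m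
        (Legal-top (Unique-map f< uL) fL≤) (Legal-map⁺ g< uR (glueʳ-≤⇒ l′ q) (⇒glueʳ-≤ l′ q) l)
        (λ x∈ _ _ → All.lookup fL≤ x∈))
      where
      fL≤ : All (_≤ suc l′ + (q + j)) (map f L)
      fL≤ = Allₚ.map⁺ (All.map (λ x≤ → ℕₚ.≤-trans (glueˡ-upper l′ q x≤) (ℕₚ.+-monoʳ-≤ (suc l′) (ℕₚ.m≤m+n q j))) (perm-≤ pL))

-- Splitting 2-stack-sortable permutations at their maximum

map-[] : ∀ {f : ℕ → ℕ} xs → map f xs ≡ [] → xs ≡ []
map-[] [] _ = refl

map-agree : ∀ {f g : ℕ → ℕ} {xs x} → map f xs ≡ map g xs → x ∈ xs → f x ≡ g x
map-agree eq (here refl) = Lₚ.∷-injectiveˡ eq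
map-agree eq (there x∈)  = map-agree (Lₚ.∷-injectiveʳ eq) x∈

image : ∀ {g : ℕ → ℕ} {P : ℕ → Set} ys → (∀ {y} → y ∈ ys → ∃[ x ] y ≡ g x × P x) →
  ∃[ xs ] ys ≡ map g xs × All P xs
image []       _ = [] , refl , []
image (y ∷ ys) h with h (here refl) | image ys (h ∘ there)
... | x , refl , px | xs , refl , pxs = x ∷ xs , refl , px ∷ pxs

W⁺ : ℕ → List (List ℕ)
W⁺ zero    = []
W⁺ (suc n) = W 2 (suc n)

W⁺⊆W : ∀ n {π} → π ∈ W⁺ n → π ∈ W 2 n
W⁺⊆W (suc n) π∈ = π∈

W⁺-nonempty : ∀ n {π} → π ∈ W⁺ n → π ≢ []
W⁺-nonempty (suc n) π∈ refl = contradiction (perm-length (proj₁ (W-∈⁻ {suc n} π∈))) λ ()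

W⁺-∈⁺ : ∀ {n π} → π ≢ [] → π ↭ oneTo n → Sortable₂ π → π ∈ W⁺ n
W⁺-∈⁺ {zero}  ≢[] p σ = contradiction (Permₚ.↭-empty-inv p) ≢[]
W⁺-∈⁺ {suc n} ≢[] p σ = W-∈⁺ p σ

W⁺-unique : ∀ n → Unique (W⁺ n)
W⁺-unique zero    = []
W⁺-unique (suc n) = W-unique (suc n)

spaces : List ℕ → ℕ → List ℕ
spaces R r = filterᵇ (legalᵇ R) (upTo (suc r))

module Layers (n : ℕ) where
  layer₃ : ℕ → List ℕ → List ℕ → List (List ℕ)
  layer₃ l′ L R = map (glue n l′ L R) (spaces R (n ∸ suc l′))

  layer₂ : ℕ → List ℕ → List (List ℕ)
  layer₂ l′ L = concatMap (layer₃ l′ L) (W⁺ (n ∸ suc l′))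

  layer₁ : ℕ → List (List ℕ)
  layer₁ l′ = concatMap (layer₂ l′) (W 2 (suc l′))

glued : ℕ → List (List ℕ)
glued n = concatMap (Layers.layer₁ n) (upTo n)

-- What membership in the nested lists of `glued` amounts to. Keeping r with an equation for n
-- confines the subtraction in `Layers` to the conversions.
record Glued (n : ℕ) (π : List ℕ) : Set where
  constructor mkGlued
  field
    {l′ r q} : ℕ
    {L R}    : List ℕ
    n≡   : n ≡ suc l′ + r
    L∈   : L ∈ W 2 (suc l′)
    R∈   : R ∈ W⁺ r
    q≤r  : q ≤ r
    legal : Legal q R
    π≡   : π ≡ glue n l′ L R q

  pL : L ↭ oneTo (suc l′)
  pL = proj₁ (W-∈⁻ {suc l′} L∈)

  pR : R ↭ oneTo r
  pR = proj₁ (W-∈⁻ {r} (W⁺⊆W r R∈))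

spaces-∈⁻ : ∀ r {R q} → R ∈ W⁺ r → q ∈ spaces R r → q ≤ r × Legal q R
spaces-∈⁻ r {R} R∈ q∈ = let q∈′ , t = ∈-filter⁻ (Bₚ.T? ∘ legalᵇ R) {xs = upTo (suc r)} q∈ in
  ℕₚ.≤-pred (∈-upTo⁻ q∈′) , legalᵇ⇒Legal (perm-unique (proj₁ (W-∈⁻ {r} (W⁺⊆W r R∈)))) t

spaces-∈⁺ : ∀ r {R q} → R ∈ W⁺ r → q ≤ r → Legal q R → q ∈ spaces R r
spaces-∈⁺ r {R} R∈ q≤r l = ∈-filter⁺ (Bₚ.T? ∘ legalᵇ R) (∈-upTo⁺ (s≤s q≤r))
  (Legal⇒legalᵇ (perm-unique (proj₁ (W-∈⁻ {r} (W⁺⊆W r R∈)))) l)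

glued-no-max : ∀ {n π} (G : Glued n π) → suc n ∉ map (glueˡ (Glued.l′ G) (Glued.q G)) (Glued.L G)
glued-no-max G@(mkGlued refl _ _ q≤r _ _) = <-∉ (All.map s≤s (Glue.glueˡ≤n (Glued.pL G) (Glued.pR G) q≤r))

-- The position of n + 1 separates the parts; then the length of the left part gives l′, truncation
-- gives L, the image of max L gives q, and injectivity of `glueʳ` gives R.
glue-injective : ∀ {n π} (G G′ : Glued n π) → let module G = Glued G ; module G′ = Glued G′ in
  G.l′ ≡ G′.l′ × G.L ≡ G′.L × G.R ≡ G′.R × G.q ≡ G′.q
glue-injective {n} G@(mkGlued {l₁} {r₁} {q₁} {L₁} {R₁} n≡₁ L₁∈ R₁∈ q≤₁ _ eq₁)
                   G′@(mkGlued {l₂} {r₂} {q₂} {L₂} {R₂} n≡₂ L₂∈ R₂∈ q≤₂ _ eq₂)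
  with split-at-injective (map (glueˡ l₁ q₁) L₁) (glued-no-max G) (glued-no-max G′) (trans (sym eq₁) eq₂)
... | eqL , eqR with ℕₚ.suc-injective (trans (sym (len (Glued.pL G))) (trans (cong length eqL) (len (Glued.pL G′))))
  where
  len : ∀ {l q L} → L ↭ oneTo (suc l) → length (map (glueˡ l q) L) ≡ suc l
  len {l} {q} {L} p = trans (Lₚ.length-map (glueˡ l q) L) (perm-length p)
... | refl with trans (sym (restore (Glued.pL G))) (trans (cong (map (_⊓ suc l₁)) eqL) (restore (Glued.pL G′)))
  where
  restore : ∀ {l q L} → L ↭ oneTo (suc l) → map (_⊓ suc l) (map (glueˡ l q) L) ≡ L
  restore {l} {q} {L} p = trans (sym (Lₚ.map-∘ L))
    (Lₚ.map-id-local (All.map (glueˡ-left-inverse l q) (perm-≤ p)))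
... | refl with ℕₚ.+-cancelˡ-≡ (suc l₁) q₁ q₂ (trans (sym (glueˡ-max l₁ q₁))
  (trans (map-agree eqL (perm-complete (Glued.pL G) (s≤s z≤n) ℕₚ.≤-refl)) (glueˡ-max l₁ q₂)))
... | refl = refl , refl , Lₚ.map-injective (mono-injective (glueʳ-mono l₁ q₁)) eqR , refl

module _ (n : ℕ) where
  open Layers n
  private
    layer₃-∈⁻ : ∀ {l′ L R π} → l′ ∈ upTo n → L ∈ W 2 (suc l′) → R ∈ W⁺ (n ∸ suc l′) → π ∈ layer₃ l′ L R →
      Σ[ G ∈ Glued n π ] l′ ≡ Glued.l′ G × L ≡ Glued.L G × R ≡ Glued.R G
    layer₃-∈⁻ {l′} {L} {R} l′∈ L∈′ R∈′ π∈ with ∈-map⁻ (glue n l′ L R) π∈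
    ... | q , q∈ , eq = let q≤r , legal = spaces-∈⁻ (n ∸ suc l′) R∈′ q∈ in
      mkGlued (sym (ℕₚ.m+[n∸m]≡n (∈-upTo⁻ l′∈))) L∈′ R∈′ q≤r legal eq , refl , refl , refl

    layer₂-∈⁻ : ∀ {l′ L π} → l′ ∈ upTo n → L ∈ W 2 (suc l′) → π ∈ layer₂ l′ L →
      Σ[ G ∈ Glued n π ] l′ ≡ Glued.l′ G × L ≡ Glued.L G
    layer₂-∈⁻ {l′} {L} l′∈ L∈′ π∈ with ∈-concatMap⇒ (layer₃ l′ L) (W⁺ (n ∸ suc l′)) π∈
    ... | R , R∈′ , π∈₃ = let G , e₁ , e₂ , _ = layer₃-∈⁻ l′∈ L∈′ R∈′ π∈₃ in G , e₁ , e₂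

    layer₁-∈⁻ : ∀ {l′ π} → l′ ∈ upTo n → π ∈ layer₁ l′ → Σ[ G ∈ Glued n π ] l′ ≡ Glued.l′ G
    layer₁-∈⁻ {l′} l′∈ π∈ with ∈-concatMap⇒ (layer₂ l′) (W 2 (suc l′)) π∈
    ... | L , L∈′ , π∈₂ = let G , e₁ , _ = layer₂-∈⁻ l′∈ L∈′ π∈₂ in G , e₁

  glued-∈⁻ : ∀ {π} → π ∈ glued n → Glued n π
  glued-∈⁻ π∈ with ∈-concatMap⇒ layer₁ (upTo n) π∈
  ... | l′ , l′∈ , π∈₁ = proj₁ (layer₁-∈⁻ l′∈ π∈₁)

  glued-∈⁺ : ∀ {π} → Glued n π → π ∈ glued n
  glued-∈⁺ (mkGlued {l′} {r} {q} {L} {R} n≡ L∈′ R∈′ q≤r legal eq) =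
    ⇒∈-concatMap layer₁ (∈-upTo⁺ (subst (l′ <_) (sym n≡) (s≤s (ℕₚ.m≤m+n l′ r))))
      (⇒∈-concatMap (layer₂ l′) L∈′ (⇒∈-concatMap (layer₃ l′ L) (subst (λ r → R ∈ W⁺ r) (sym r≡) R∈′)
        (subst (_∈ layer₃ l′ L R) (sym eq) (∈-map⁺ (glue n l′ L R)
          (subst (λ r → q ∈ spaces R r) (sym r≡) (spaces-∈⁺ r R∈′ q≤r legal))))))
    where
    r≡ : n ∸ suc l′ ≡ r
    r≡ = trans (cong (_∸ suc l′) n≡) (ℕₚ.m+n∸m≡n (suc l′) r)

  glued-unique : Unique (glued n)
  glued-unique = concatMap-unique layer₁ (Uniqueₚ.upTo⁺ n) unique₁ λ l∈ l∈′ π∈ π∈′ →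
    let G , e = layer₁-∈⁻ l∈ π∈ ; G′ , e′ = layer₁-∈⁻ l∈′ π∈′ in
    trans e (trans (proj₁ (glue-injective G G′)) (sym e′))
    where
    unique₃ : ∀ {l′ L R} → l′ ∈ upTo n → L ∈ W 2 (suc l′) → R ∈ W⁺ (n ∸ suc l′) → Unique (layer₃ l′ L R)
    unique₃ {l′} {L} {R} l′∈ L∈′ R∈′ = map-unique-local (glue n l′ L R) (Uniqueₚ.filter⁺ (Bₚ.T? ∘ legalᵇ R) (Uniqueₚ.upTo⁺ (suc (n ∸ suc l′))))
      λ {q} {q′} q∈ q′∈ eq → proj₂ (proj₂ (proj₂ (glue-injective (mk q∈ refl) (mk q′∈ eq))))
      where
      mk : ∀ {q π} → q ∈ spaces R (n ∸ suc l′) → π ≡ glue n l′ L R q → Glued n π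
      mk q∈ eq = let q≤r , legal = spaces-∈⁻ (n ∸ suc l′) R∈′ q∈ in
        mkGlued (sym (ℕₚ.m+[n∸m]≡n (∈-upTo⁻ l′∈))) L∈′ R∈′ q≤r legal eq

    unique₂ : ∀ {l′ L} → l′ ∈ upTo n → L ∈ W 2 (suc l′) → Unique (layer₂ l′ L)
    unique₂ {l′} {L} l′∈ L∈′ = concatMap-unique (layer₃ l′ L) (W⁺-unique (n ∸ suc l′)) (unique₃ l′∈ L∈′)
      λ R∈ R∈′ π∈ π∈′ →
        let G , _ , _ , e = layer₃-∈⁻ l′∈ L∈′ R∈ π∈ ; G′ , _ , _ , e′ = layer₃-∈⁻ l′∈ L∈′ R∈′ π∈′ in
        trans e (trans (proj₁ (proj₂ (proj₂ (glue-injective G G′)))) (sym e′))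

    unique₁ : ∀ {l′} → l′ ∈ upTo n → Unique (layer₁ l′)
    unique₁ {l′} l′∈ = concatMap-unique (layer₂ l′) (W-unique (suc l′)) (unique₂ l′∈)
      λ L∈ L∈′ π∈ π∈′ →
        let G , _ , e = layer₂-∈⁻ l′∈ L∈ π∈ ; G′ , _ , e′ = layer₂-∈⁻ l′∈ L∈′ π∈′ in
        trans e (trans (proj₁ (proj₂ (glue-injective G G′))) (sym e′))

-- The criterion places A = L₁ L₂ below B, and M exceeds A, so A is a permutation of 1, ..., l′.
-- Then M = l′ + 1 + q defines q, and B fills the remaining values above l′, which are those taken
-- by `glueʳ`.
unglue : ∀ {n} L₁ {M L₂ B} → (L₁ ++ M ∷ L₂) ++ suc n ∷ B ↭ oneTo (suc n) →
  All (_< M) L₁ → All (_< M) L₂ → B ≢ [] → Sortable₂ ((L₁ ++ M ∷ L₂) ++ suc n ∷ B) →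
  Glued n ((L₁ ++ M ∷ L₂) ++ suc n ∷ B)
unglue {n} L₁ {M} {L₂} {B} p L₁<M L₂<M B≢[] σ
  with Sortable₂-split⁻ (perm-unique p) L₁<M L₂<M
         (Allₚ.++⁻ˡ (L₁ ++ M ∷ L₂) (perm-< (remove-max-perm (L₁ ++ M ∷ L₂) p)))
         (Allₚ.++⁻ʳ (L₁ ++ M ∷ L₂) (perm-< (remove-max-perm (L₁ ++ M ∷ L₂) p))) σ
     | image {glueʳ (length (L₁ ++ L₂)) (M ∸ suc (length (L₁ ++ L₂)))}
             {λ x → 0 < x × x ≤ length B} B
... | σA , σB , A<B , legal | imageB = result
  where
  A = L₁ ++ L₂
  l′ = length A
  r = length B
  q = M ∸ suc l′

  p′ : (L₁ ++ M ∷ L₂) ++ B ↭ oneTo n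
  p′ = remove-max-perm (L₁ ++ M ∷ L₂) p

  u′ : Unique ((L₁ ++ M ∷ L₂) ++ B)
  u′ = perm-unique p′

  n≡ : n ≡ suc l′ + r
  n≡ = trans (sym (perm-length p′)) (trans (Lₚ.length-++ (L₁ ++ M ∷ L₂))
    (cong (_+ r) (Permₚ.↭-length (Permₚ.shift M L₁ L₂))))

  uMA : Unique (M ∷ A)
  uMA = Unique-resp-↭ (Permₚ.shift M L₁ L₂) (proj₁ (AllPairs-++⁻ (L₁ ++ M ∷ L₂) u′))

  A<M : All (_< M) A
  A<M = Allₚ.++⁺ L₁<M L₂<M

  A⊆ : ∀ {x} → x ∈ A → x ∈ L₁ ++ M ∷ L₂
  A⊆ x∈ = Permₚ.∈-resp-↭ (↭-sym (Permₚ.shift M L₁ L₂)) (there x∈)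

  M∈ : M ∈ L₁ ++ M ∷ L₂
  M∈ = ∈-++⁺ʳ L₁ (here refl)

  ≤n : ∀ {x} → x ∈ (L₁ ++ M ∷ L₂) ++ B → x ≤ n
  ≤n = All.lookup (perm-≤ p′)

  -- All of 1, ..., x lie in A, because M and the entries of B exceed x; so x is at most the length
  -- of A.
  A≤l′ : ∀ {x} → x ∈ A → x ≤ l′
  A≤l′ {x} x∈ = subst (_≤ l′) (length-oneTo x) (pigeonhole (oneTo-unique x) λ {y} y∈ →
    let 0<y , y≤x = ∈-oneTo⁻ y∈ in
    below y≤x (∈-++⁻ (L₁ ++ M ∷ L₂) (perm-complete p′ 0<y (ℕₚ.≤-trans y≤x (≤n (∈-++⁺ˡ (A⊆ x∈)))))))
    where
    below : ∀ {y} → y ≤ x → y ∈ L₁ ++ M ∷ L₂ ⊎ y ∈ B → y ∈ A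
    below y≤x (inj₂ y∈B) = contradiction y≤x (ℕₚ.<⇒≱ (A<B x∈ y∈B))
    below y≤x (inj₁ y∈) with Permₚ.∈-resp-↭ (Permₚ.shift M L₁ L₂) y∈
    ... | here refl = contradiction y≤x (ℕₚ.<⇒≱ (All.lookup A<M x∈))
    ... | there y∈A = y∈A

  A↭ : A ↭ oneTo l′
  A↭ = ↭-sym (pigeonhole-exact (AllPairs.tail uMA)
    (λ x∈ → ∈-oneTo⁺ (All.lookup (perm-pos p′) (∈-++⁺ˡ (A⊆ x∈))) (A≤l′ x∈))
    (ℕₚ.≤-reflexive (length-oneTo l′)))

  l′<M : l′ < M
  l′<M = ℕₚ.≰⇒> λ M≤l′ → ℕₚ.<-irrefl refl
    (All.lookup A<M (perm-complete A↭ (All.lookup (perm-pos p′) (∈-++⁺ˡ M∈)) M≤l′))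

  M≡ : suc l′ + q ≡ M
  M≡ = ℕₚ.m+[n∸m]≡n l′<M

  q≤r : q ≤ r
  q≤r = ℕₚ.+-cancelˡ-≤ (suc l′) q r (subst₂ _≤_ (sym M≡) n≡ (≤n (∈-++⁺ˡ M∈)))

  L = L₁ ++ suc l′ ∷ L₂

  pL : L ↭ oneTo (suc l′)
  pL = insert-max-perm L₁ A↭

  mapL : map (glueˡ l′ q) L ≡ L₁ ++ M ∷ L₂
  mapL = trans (Lₚ.map-++ (glueˡ l′ q) L₁ (suc l′ ∷ L₂)) (cong₂ _++_
    (map-raise-≤ (Allₚ.++⁻ˡ L₁ (perm-≤ A↭)))
    (cong₂ _∷_ (trans (glueˡ-max l′ q) M≡) (map-raise-≤ (Allₚ.++⁻ʳ L₁ (perm-≤ A↭)))))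

  preimage : ∀ {y} → y ∈ B → ∃[ x ] y ≡ glueʳ l′ q x × 0 < x × x ≤ r
  preimage {y} y∈ with ℕₚ.<-cmp y M
  ... | tri≈ _ refl _ = contradiction refl (proj₂ (proj₂ (AllPairs-++⁻ (L₁ ++ M ∷ L₂) u′)) M∈ y∈)
  ... | tri< y<M _ _  = y ∸ l′ , sym (trans (glueʳ-≤ l′ q y∸l′≤q) (ℕₚ.m+[n∸m]≡n (ℕₚ.<⇒≤ l′<y)))
      , ℕₚ.m<n⇒0<n∸m l′<y , ℕₚ.≤-trans y∸l′≤q q≤r
    where
    l′<y : l′ < y
    l′<y = ℕₚ.≰⇒> λ y≤l′ → ℕₚ.<-irrefl refl
      (A<B (perm-complete A↭ (All.lookup (perm-pos p′) (∈-++⁺ʳ (L₁ ++ M ∷ L₂) y∈)) y≤l′) y∈)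
    y∸l′≤q : y ∸ l′ ≤ q
    y∸l′≤q = ℕₚ.≤-trans (ℕₚ.∸-monoˡ-≤ l′ (ℕₚ.≤-pred (subst (y <_) (sym M≡) y<M)))
      (ℕₚ.≤-reflexive (ℕₚ.m+n∸m≡n l′ q))
  ... | tri> _ _ M<y  = y ∸ suc l′ , sym (trans (glueʳ-> l′ q q<) (ℕₚ.m+[n∸m]≡n (ℕₚ.<-trans l′<M M<y)))
      , ℕₚ.≤-<-trans z≤n q<
      , ℕₚ.≤-trans (ℕₚ.∸-monoˡ-≤ (suc l′) (subst (y ≤_) n≡ (≤n (∈-++⁺ʳ (L₁ ++ M ∷ L₂) y∈)))) (ℕₚ.≤-reflexive (ℕₚ.m+n∸m≡n (suc l′) r))
    where
    q< : q < y ∸ suc l′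
    q< = ℕₚ.∸-monoˡ-< M<y l′<M

  result : Glued n ((L₁ ++ M ∷ L₂) ++ suc n ∷ B)
  result with imageB preimage
  ... | R , B≡ , R-bounds = mkGlued n≡ (W-∈⁺ pL σL) (W⁺-∈⁺ R≢[] pR σR) q≤r legalR
      (cong₂ (λ a b → a ++ suc n ∷ b) (sym mapL) B≡)
    where
    g< = glueʳ-mono l′ q

    uR : Unique R
    uR = Uniqueₚ.map⁻ (subst Unique B≡ (proj₁ (proj₂ (AllPairs-++⁻ (L₁ ++ M ∷ L₂) u′))))

    R≢[] : R ≢ []
    R≢[] refl = B≢[] B≡

    pR : R ↭ oneTo r
    pR = ↭-sym (pigeonhole-exact uR
      (λ x∈ → let l , u = All.lookup R-bounds x∈ in ∈-oneTo⁺ l u)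
      (ℕₚ.≤-reflexive (trans (length-oneTo r) (trans (cong length B≡) (Lₚ.length-map (glueʳ l′ q) R)))))

    σL : Sortable₂ L
    σL = Sortable₂-map⁻ (raise-mono l′ q) (perm-unique pL) (subst Sortable₂ (sym mapL) σA)

    σR : Sortable₂ R
    σR = Sortable₂-map⁻ g< uR (subst Sortable₂ B≡ σB)

    legalR : Legal q R
    legalR = subst (λ a → Legal a R) (ℕₚ.+-identityʳ q) (Legal-map⁻ g< uR (glueʳ-≤⇒ l′ q) (⇒glueʳ-≤ l′ q)
      (subst₂ Legal (trans (sym M≡) (cong (suc l′ ℕ.+_) (sym (ℕₚ.+-identityʳ q)))) B≡ legal))

module _ (n : ℕ) where
  private
    glued-shape : ∀ {π} → Glued n π → ∃[ A ] ∃[ B ] π ≡ A ++ suc n ∷ B × A ≢ [] × B ≢ [] × suc n ∉ A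
    glued-shape {π} G = map (glueˡ G.l′ G.q) G.L , map (glueʳ G.l′ G.q) G.R , G.π≡
      , (λ e → L≢[] (map-[] G.L e)) , (λ e → W⁺-nonempty G.r G.R∈ (map-[] G.R e)) , glued-no-max G
      where
      module G = Glued G
      L≢[] : G.L ≢ []
      L≢[] e = case trans (sym (perm-length G.pL)) (cong length e) of λ ()

    n∉ : ∀ {L} → L ∈ W 2 n → suc n ∉ L
    n∉ L∈ = <-∉ (perm-< (proj₁ (W-∈⁻ {n} L∈)))

    ends prepends : List (List ℕ)
    ends     = map (_∷ʳ suc n) (W 2 n)
    prepends = map (suc n ∷_) (W⁺ n)

    ∈-ends⁻ : ∀ {π} → π ∈ ends → ∃[ A ] A ∈ W 2 n × π ≡ A ∷ʳ suc n
    ∈-ends⁻ = ∈-map⁻ (_∷ʳ suc n)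

    ∈-prepends⁻ : ∀ {π} → π ∈ prepends → ∃[ B ] B ∈ W⁺ n × π ≡ suc n ∷ B
    ∈-prepends⁻ = ∈-map⁻ (suc n ∷_)

    prepend≢glued : ∀ {π B} → π ≡ suc n ∷ B → ¬ Glued n π
    prepend≢glued e G =
      let A , B′ , eq , A≢[] , _ , ∉A = glued-shape G in
      A≢[] (sym (proj₁ (split-at-injective [] (λ ()) ∉A (trans (sym e) eq))))

    end≢glued : ∀ {π A} → A ∈ W 2 n → π ≡ A ∷ʳ suc n → ¬ Glued n π
    end≢glued {A = A} A∈ e G =
      let A′ , B , eq , _ , B≢[] , ∉A = glued-shape G in
      B≢[] (sym (proj₂ (split-at-injective A (n∉ A∈) ∉A (trans (sym e) eq))))

    end≢prepend : ∀ {π A B} → A ∈ W 2 n → π ≡ A ∷ʳ suc n → B ∈ W⁺ n → π ≢ suc n ∷ B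
    end≢prepend {A = A} A∈ e B∈ e′ =
      W⁺-nonempty n B∈ (sym (proj₂ (split-at-injective A {[]} (n∉ A∈) (λ ()) (trans (sym e) e′))))

    disjoint₂ : ∀ {π} → ¬ (π ∈ prepends × π ∈ glued n)
    disjoint₂ (π∈ , π∈′) = let B , _ , e = ∈-prepends⁻ π∈ in prepend≢glued e (glued-∈⁻ n π∈′)

    disjoint₁ : ∀ {π} → ¬ (π ∈ ends × π ∈ prepends ++ glued n)
    disjoint₁ (π∈ , π∈′) = let A , A∈ , e = ∈-ends⁻ π∈ in case ∈-++⁻ prepends π∈′ of λ
      { (inj₁ π∈₂) → let B , B∈ , e′ = ∈-prepends⁻ π∈₂ in end≢prepend A∈ e B∈ e′
      ; (inj₂ π∈₃) → end≢glued A∈ e (glued-∈⁻ n π∈₃) }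

    from-end : ∀ {π} → π ∈ ends → π ∈ W 2 (suc n)
    from-end π∈ = let A , A∈ , e = ∈-ends⁻ π∈ ; p , σ = W-∈⁻ {n} A∈ in
      subst (_∈ W 2 (suc n)) (sym e) (W-∷ʳ⁺ p σ)

    from-prepend : ∀ {π} → π ∈ prepends → π ∈ W 2 (suc n)
    from-prepend π∈ = let B , B∈ , e = ∈-prepends⁻ π∈ ; p , σ = W-∈⁻ {n} (W⁺⊆W n B∈) in
      subst (_∈ W 2 (suc n)) (sym e) (W-∷⁺ p σ)

    from-glued : ∀ {π} → Glued n π → π ∈ W 2 (suc n)
    from-glued (mkGlued {l′} {r} {q} {L} {R} n≡ L∈ R∈ q≤r legal e) =
      let pL , σL = W-∈⁻ {suc l′} L∈ ; pR , σR = W-∈⁻ {r} (W⁺⊆W r R∈) in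
      subst (_∈ W 2 (suc n)) (sym e) (subst (λ k → glue k l′ L R q ∈ W 2 (suc k)) (sym n≡)
        (W-∈⁺ {suc (suc l′ + r)} (Glue.glue-perm pL pR q≤r) (Glue.glue-Sortable₂ pL pR q≤r σL σR legal)))

    from : ∀ {π} → π ∈ ends ++ prepends ++ glued n → π ∈ W 2 (suc n)
    from π∈ = case ∈-++⁻ ends π∈ of λ
      { (inj₁ π∈₁) → from-end π∈₁
      ; (inj₂ π∈′) → case ∈-++⁻ prepends π∈′ of λ
        { (inj₁ π∈₂) → from-prepend π∈₂
        ; (inj₂ π∈₃) → from-glued (glued-∈⁻ n π∈₃) } }

    classify : ∀ A B → A ++ suc n ∷ B ↭ oneTo (suc n) → Sortable₂ (A ++ suc n ∷ B) →
      A ++ suc n ∷ B ∈ ends ++ prepends ++ glued n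
    classify A [] p σ = ∈-++⁺ˡ (∈-map⁺ (_∷ʳ suc n) (W-∈⁺ {n}
      (↭-trans (↭-reflexive (sym (Lₚ.++-identityʳ A))) p′)
      (subst Sortable₁ (Lₚ.++-identityʳ (s A)) (Sortable₂-node⁻ (perm-unique p) (Allₚ.++⁻ˡ A (perm-< p′)) [] σ))))
      where
      p′ = remove-max-perm A p
    classify [] (b ∷ B) p σ = ∈-++⁺ʳ ends (∈-++⁺ˡ (∈-map⁺ (suc n ∷_)
      (W⁺-∈⁺ {n} (λ ()) p′ (Sortable₂-node⁻ (perm-unique p) [] (perm-< p′) σ))))
      where
      p′ = remove-max-perm [] p
    classify (a ∷ A) (b ∷ B) p σ with split-max a A (proj₁ (Unique-parts (a ∷ A) (perm-unique p)))
    ... | L₁ , M , L₂ , eq , L₁<M , L₂<M = ∈-++⁺ʳ ends (∈-++⁺ʳ prepends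
      (glued-∈⁺ n (subst (λ z → Glued n (z ++ suc n ∷ b ∷ B)) (sym eq)
        (unglue L₁ (subst (λ z → z ++ suc n ∷ b ∷ B ↭ oneTo (suc n)) eq p) L₁<M L₂<M (λ ())
          (subst (λ z → Sortable₂ (z ++ suc n ∷ b ∷ B)) eq σ)))))

    to : ∀ {π} → π ∈ W 2 (suc n) → π ∈ ends ++ prepends ++ glued n
    to {π} π∈ =
      let p , σ = W-∈⁻ {suc n} π∈
          A , B , e = ∈-∃++ (perm-complete p (s≤s z≤n) ℕₚ.≤-refl)
      in subst (_∈ ends ++ prepends ++ glued n) (sym e)
           (classify A B (subst (_↭ oneTo (suc n)) e p) (subst Sortable₂ e σ))

    unique : Unique (ends ++ prepends ++ glued n)
    unique = Uniqueₚ.++⁺ (Uniqueₚ.map⁺ (λ {x} {y} → Lₚ.∷ʳ-injectiveˡ x y) (W-unique n))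
      (Uniqueₚ.++⁺ (Uniqueₚ.map⁺ Lₚ.∷-injectiveʳ (W⁺-unique n)) (glued-unique n) disjoint₂)
      disjoint₁

  -- The cases are R empty, then only L empty, then neither. `W⁺` in the second keeps the
  -- permutation of length one from being listed twice.
  W-suc-↭ : W 2 (suc n) ↭ map (_∷ʳ suc n) (W 2 n) ++ map (suc n ∷_) (W⁺ n) ++ glued n
  W-suc-↭ = unique-↭ (W-unique (suc n)) unique to from

  W-suc-disjoint : ∀ {π} → ¬ (π ∈ map (_∷ʳ suc n) (W 2 n) × π ∈ map (suc n ∷_) (W⁺ n) ++ glued n)
  W-suc-disjoint = disjoint₁

-- Tail length

maxL-upper : ∀ {x xs} → x ∈ xs → x ≤ maxL xs
maxL-upper {xs = y ∷ ys} (here refl) = ℕₚ.m≤m⊔n y (maxL ys)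
maxL-upper {xs = y ∷ ys} (there x∈)  = ℕₚ.≤-trans (maxL-upper x∈) (ℕₚ.m≤n⊔m y (maxL ys))

maxL-∈ : ∀ x xs → maxL (x ∷ xs) ∈ x ∷ xs
maxL-∈ x []       = here (ℕₚ.⊔-identityʳ x)
maxL-∈ x (y ∷ ys) with ℕₚ.⊔-sel x (maxL (y ∷ ys))
... | inj₁ eq = here eq
... | inj₂ eq = there (subst (_∈ y ∷ ys) (sym eq) (maxL-∈ y ys))

tailOK⁻ : ∀ π ℓ → T (tailOKᵇ π ℓ) → ∀ {i} → i < length π → length π ∸ ℓ < suc i → at π (suc i) ≡ suc i
tailOK⁻ π ℓ t {i} i< l< = ℕₚ.≡ᵇ⇒≡ _ _ (subst T
  (cong (λ b → if b then at π (suc i) ≡ᵇ suc i else true) (T⇒≡true (ℕₚ.<⇒<ᵇ l<)))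
  (All.lookup (Allₚ.all⁺ (λ i → if (length π ∸ ℓ) <ᵇ i then at π i ≡ᵇ i else true) (oneTo (length π)) t)
    (∈-oneTo⁺ (s≤s z≤n) i<)))

tailOK⁺ : ∀ π ℓ → (∀ {i} → i < length π → length π ∸ ℓ < suc i → at π (suc i) ≡ suc i) → T (tailOKᵇ π ℓ)
tailOK⁺ π ℓ h = Allₚ.all⁻ (λ i → if (length π ∸ ℓ) <ᵇ i then at π i ≡ᵇ i else true) (All.tabulate check)
  where
  check : ∀ {i} → i ∈ oneTo (length π) → T (if (length π ∸ ℓ) <ᵇ i then at π i ≡ᵇ i else true)
  check {i} i∈ with (length π ∸ ℓ) <ᵇ i in eq
  ... | false = tt
  ... | true  = go i (∈-oneTo⁻ i∈) (ℕₚ.<ᵇ⇒< _ i (subst T (sym eq) tt))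
    where
    go : ∀ i → 0 < i × i ≤ length π → length π ∸ ℓ < i → T (at π i ≡ᵇ i)
    go (suc i) (_ , i<) l< = ℕₚ.≡⇒≡ᵇ _ _ (h i< l<)

module _ (π : List ℕ) where
  private
    candidates : List ℕ
    candidates = filterᵇ (tailOKᵇ π) (upTo (suc (length π)))

  tl-max : ∀ {ℓ} → ℓ ≤ length π → T (tailOKᵇ π ℓ) → ℓ ≤ tl π
  tl-max ℓ≤ t = maxL-upper (∈-filter⁺ (Bₚ.T? ∘ tailOKᵇ π) (∈-upTo⁺ (s≤s ℓ≤)) t)

  private
    0∈ : 0 ∈ candidates
    0∈ = ∈-filter⁺ (Bₚ.T? ∘ tailOKᵇ π) (∈-upTo⁺ (s≤s z≤n)) (tailOK⁺ π 0 λ i< l< → contradiction (ℕₚ.≤-pred l<) (ℕₚ.<⇒≱ i<))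

    maxL-nonempty : ∀ {x} xs → x ∈ xs → maxL xs ∈ xs
    maxL-nonempty (x ∷ xs) _ = maxL-∈ x xs

    tl∈ : tl π ∈ upTo (suc (length π)) × T (tailOKᵇ π (tl π))
    tl∈ = ∈-filter⁻ (Bₚ.T? ∘ tailOKᵇ π) {xs = upTo (suc (length π))} (maxL-nonempty candidates 0∈)

  tl-≤ : tl π ≤ length π
  tl-≤ = ℕₚ.≤-pred (∈-upTo⁻ (proj₁ tl∈))

  tl-OK : T (tailOKᵇ π (tl π))
  tl-OK = proj₂ tl∈

at-∷ʳ : ∀ π x → at (π ∷ʳ x) (suc (length π)) ≡ x
at-∷ʳ []      x = refl
at-∷ʳ (y ∷ π) x = at-∷ʳ π x

at-∷ʳ-< : ∀ π x {i} → i < length π → at (π ∷ʳ x) (suc i) ≡ at π (suc i)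
at-∷ʳ-< π x i< = at-At (At-++ˡ {π} {[ x ]} (At-at i<))

module _ {n : ℕ} (π : List ℕ) (len : length π ≡ n) where
  private
    ρ = π ∷ʳ suc n

    lenρ : length ρ ≡ suc n
    lenρ = trans (length-∷ʳ π (suc n)) (cong suc len)

  tailOK-∷ʳ⁺ : ∀ ℓ → T (tailOKᵇ π ℓ) → T (tailOKᵇ ρ (suc ℓ))
  tailOK-∷ʳ⁺ ℓ t = tailOK⁺ ρ (suc ℓ) λ i< l< → go (ℕₚ.≤-pred (subst (_ <_) lenρ i<)) (subst (λ k → k ∸ suc ℓ < _) lenρ l<)
    where
    go : ∀ {i} → i ≤ n → n ∸ ℓ < suc i → at ρ (suc i) ≡ suc i
    go {i} i≤n l< with ℕₚ.m≤n⇒m<n∨m≡n i≤n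
    ... | inj₁ i<n  = trans (at-∷ʳ-< π (suc n) (subst (i <_) (sym len) i<n))
      (tailOK⁻ π ℓ t (subst (i <_) (sym len) i<n) (subst (λ k → k ∸ ℓ < suc i) (sym len) l<))
    ... | inj₂ refl = trans (cong (λ k → at ρ (suc k)) (sym len)) (at-∷ʳ π (suc n))

  tailOK-∷ʳ⁻ : ∀ ℓ → T (tailOKᵇ ρ (suc ℓ)) → T (tailOKᵇ π ℓ)
  tailOK-∷ʳ⁻ ℓ t = tailOK⁺ π ℓ λ {i} i< l< → trans (sym (at-∷ʳ-< π (suc n) i<))
    (tailOK⁻ ρ (suc ℓ) t (subst (i <_) (sym (length-∷ʳ π (suc n))) (ℕₚ.m<n⇒m<1+n i<))
      (subst (λ k → k ∸ suc ℓ < suc i) (sym (length-∷ʳ π (suc n))) l<))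

  tl-∷ʳ : tl ρ ≡ suc (tl π)
  tl-∷ʳ = ℕₚ.≤-antisym (upper (tl ρ) (subst (tl ρ ≤_) lenρ (tl-≤ ρ)) (tl-OK ρ))
    (tl-max ρ (subst (suc (tl π) ≤_) (sym lenρ) (s≤s (subst (tl π ≤_) len (tl-≤ π)))) (tailOK-∷ʳ⁺ (tl π) (tl-OK π)))
    where
    upper : ∀ t → t ≤ suc n → T (tailOKᵇ ρ t) → t ≤ suc (tl π)
    upper zero    _       _ = z≤n
    upper (suc t) (s≤s l) o = s≤s (tl-max π (subst (t ≤_) (sym len) l) (tailOK-∷ʳ⁻ t o))

tl-end : ∀ {n π} → π ∈ W 2 (suc n) → 0 < tl π → π ∈ map (_∷ʳ suc n) (W 2 n)
tl-end {n} {π} π∈ 0<tl = go π (initLast π) p σ last-entry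
  where
  p = proj₁ (W-∈⁻ {suc n} π∈)
  σ = proj₂ (W-∈⁻ {suc n} π∈)
  len = perm-length p

  last-entry : at π (suc n) ≡ suc n
  last-entry = tailOK⁻ π (tl π) (tl-OK π) (subst (n <_) (sym len) ℕₚ.≤-refl)
    (subst (λ k → k ∸ tl π < suc n) (sym len) (ℕₚ.∸-monoʳ-< 0<tl (subst (tl π ≤_) len (tl-≤ π))))

  go : ∀ π → InitLast π → π ↭ oneTo (suc n) → Sortable₂ π → at π (suc n) ≡ suc n → π ∈ map (_∷ʳ suc n) (W 2 n)
  go .[]       []        p _ _ = contradiction (perm-length p) λ ()
  go .(A ∷ʳ y) (A ∷ʳ′ y) p σ e = subst (λ z → A ∷ʳ z ∈ map (_∷ʳ suc n) (W 2 n)) (sym y≡)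
    (∈-map⁺ (_∷ʳ suc n) (W-∈⁺ {n} (↭-trans (↭-reflexive (sym (Lₚ.++-identityʳ A))) p″)
      (subst Sortable₁ (Lₚ.++-identityʳ (s A)) (Sortable₂-node⁻ (perm-unique p′) (Allₚ.++⁻ˡ A (perm-< p″)) []
        (subst (λ z → Sortable₂ (A ∷ʳ z)) y≡ σ)))))
    where
    y≡ : y ≡ suc n
    y≡ = trans (sym (at-∷ʳ A y)) (trans (cong (at (A ∷ʳ y))
      (trans (sym (length-∷ʳ A y)) (perm-length p))) e)

    p′ : A ++ suc n ∷ [] ↭ oneTo (suc n)
    p′ = subst (λ z → A ∷ʳ z ↭ oneTo (suc n)) y≡ p

    p″ : A ++ [] ↭ oneTo n
    p″ = remove-max-perm A p′

module _ {Ring : CommutativeRing 0ℓ 0ℓ} where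
  open ListSum Ring
  open CommutativeRing Ring using (Carrier; _≈_; 0#; +-congˡ; +-congʳ; +-cong; +-identityʳ)
    renaming (refl to ≈-refl; sym to ≈-sym; trans to ≈-trans)

  -- A positive tail length forces n + 1 into the last place, so the other two families drop out;
  -- removing that entry lowers the tail length by one.
  ∑-W-suc-tail : ∀ n b (φ : List ℕ → Carrier) →
    ∑ (W 2 (suc n)) (λ ρ → if suc b ≤ᵇ tl ρ then φ ρ else 0#)
    ≈ ∑ (W 2 n) (λ π → if b ≤ᵇ tl π then φ (π ∷ʳ suc n) else 0#)
  ∑-W-suc-tail n b φ = ≈-trans (∑-↭ (W-suc-↭ n)) (≈-trans (∑-++ (map (_∷ʳ suc n) (W 2 n)) _)
    (≈-trans (+-cong (≈-trans (∑-map (_∷ʳ suc n) (W 2 n)) (∑-cong (W 2 n) first))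
                     (∑-zero (map (suc n ∷_) (W⁺ n) ++ glued n) rest))
      (+-identityʳ _)))
    where
    first : ∀ {π} → π ∈ W 2 n → (if suc b ≤ᵇ tl (π ∷ʳ suc n) then φ (π ∷ʳ suc n) else 0#)
      ≈ (if b ≤ᵇ tl π then φ (π ∷ʳ suc n) else 0#)
    first {π} π∈ rewrite tl-∷ʳ π (perm-length (proj₁ (W-∈⁻ {n} π∈))) = ≈-reflexive (suc-≤ᵇ b (tl π))
      where
      open CommutativeRing Ring using () renaming (reflexive to ≈-reflexive)
      suc-≤ᵇ : ∀ a b → (if suc a ≤ᵇ suc b then φ (π ∷ʳ suc n) else 0#) ≡ (if a ≤ᵇ b then φ (π ∷ʳ suc n) else 0#)
      suc-≤ᵇ zero    b = refl
      suc-≤ᵇ (suc a) b = refl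

    rest : ∀ {ρ} → ρ ∈ map (suc n ∷_) (W⁺ n) ++ glued n → (if suc b ≤ᵇ tl ρ then φ ρ else 0#) ≈ 0#
    rest {ρ} ρ∈ with suc b ≤ᵇ tl ρ in eq
    ... | false = ≈-refl
    ... | true  = ⊥-elim (W-suc-disjoint n (tl-end ρ∈W (ℕₚ.≤-<-trans z≤n (ℕₚ.≤ᵇ⇒≤ (suc b) (tl ρ) (subst T (sym eq) tt))) , ρ∈))
      where
      ρ∈W : ρ ∈ W 2 (suc n)
      ρ∈W = Permₚ.∈-resp-↭ (↭-sym (W-suc-↭ n)) (∈-++⁺ʳ (map (_∷ʳ suc n) (W 2 n)) ρ∈)

-- Generating functions

-- `U`, `R` and `V` adjoin u, t and v in turn. The variable v is outermost because the index b of
-- its coefficients is the tail length, and v ↦ tuv then scales coefficient b by an element (tu)ᵇ of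
-- the ring below.
module R = PowerSeries U.psRing
module V = PowerSeries R.psRing

module _ (A : CommutativeRing 0ℓ 0ℓ) where
  open CommutativeRing A using (Carrier; _≈_; +-congˡ; +-congʳ; +-identityʳ)
    renaming (_*_ to _⊠_; refl to ≈-refl; sym to ≈-sym; trans to ≈-trans)
  open ListSum A
  open PowerSeries A using (mul)

  ∑-applyUpTo-∘ : ∀ (g h : ℕ → ℕ) n (F : ℕ → Carrier) → ∑ (applyUpTo (g ∘ h) n) F ≈ ∑ (applyUpTo h n) (F ∘ g)
  ∑-applyUpTo-∘ g h zero    F = ≈-refl
  ∑-applyUpTo-∘ g h (suc n) F = +-congˡ (∑-applyUpTo-∘ g (h ∘ suc) n F)

  mul-∑-upTo : ∀ f g n → mul f g n ≈ ∑ (upTo (suc n)) (λ i → f i ⊠ g (n ∸ i))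
  mul-∑-upTo f g zero    = ≈-sym (+-identityʳ _)
  mul-∑-upTo f g (suc n) = +-congˡ (≈-trans (mul-∑-upTo (f ∘ suc) g n)
    (≈-sym (∑-applyUpTo-∘ suc id (suc n) (λ i → f i ⊠ g (suc n ∸ i)))))

open ListSum U.psRing using () renaming
  (∑ to ∑U; ∑-cong to ∑U-cong; ∑-zero to ∑U-zero; ∑-++ to ∑U-++; ∑-+ to ∑U-+; ∑-*ˡ to ∑U-*ˡ; ∑-*ʳ to ∑U-*ʳ;
   ∑-map to ∑U-map; ∑-concatMap to ∑U-concatMap; ∑-↭ to ∑U-↭)

Poly : Set
Poly = ℕ → ℤ

_≈U_ : Poly → Poly → Set
_≈U_ = U._≈ₚ_

infix 4 _≈U_

_+U_ : Poly → Poly → Poly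
(f +U g) a = f a ℤ.+ g a

infixl 6 _+U_

0U : Poly
0U _ = + 0

module UR = CommutativeRing U.psRing

∑U-eval : ∀ {B : Set} (xs : List B) f a → ∑U xs f a ≡ ∑ℤ xs (λ x → f x a)
∑U-eval []       f a = refl
∑U-eval (x ∷ xs) f a = cong (λ z → f x a ℤ.+ z) (∑U-eval xs f a)

∑U-shift : ∀ {B : Set} (xs : List B) f → ∑U xs (λ x → U.shift (f x)) ≈U U.shift (∑U xs f)
∑U-shift []       f zero    = refl
∑U-shift []       f (suc a) = refl
∑U-shift (x ∷ xs) f a = trans (cong (λ z → U.shift (f x) a ℤ.+ z) (∑U-shift xs f a)) (sym (U.shift-+ (f x) (∑U xs f) a))

-- term c k = c uᵏ and ladder c k = c (1 + u + ⋯ + uᵏ⁻¹).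
shifts : ℕ → Poly → Poly
shifts zero    f = f
shifts (suc k) f = U.shift (shifts k f)

term : ℤ → ℕ → Poly
term c k = shifts k (U.const c)

ladder : ℤ → ℕ → Poly
ladder c zero    = 0U
ladder c (suc k) = term c k +U ladder c k

shifts-cong : ∀ k {f g} → f ≈U g → shifts k f ≈U shifts k g
shifts-cong zero    p = p
shifts-cong (suc k) p = U.shift-cong (shifts-cong k p)

shifts-+ : ∀ k f g → shifts k (f +U g) ≈U shifts k f +U shifts k g
shifts-+ zero    f g a = refl
shifts-+ (suc k) f g a = trans (U.shift-cong (shifts-+ k f g) a) (U.shift-+ (shifts k f) (shifts k g) a)

∑U-shifts : ∀ {B : Set} k (xs : List B) f → ∑U xs (λ x → shifts k (f x)) ≈U shifts k (∑U xs f)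
∑U-shifts zero    xs f a = refl
∑U-shifts (suc k) xs f a = trans (∑U-shift xs (λ x → shifts k (f x)) a) (U.shift-cong (∑U-shifts k xs f) a)

shifts-shifts : ∀ j k f → shifts (j + k) f ≡ shifts j (shifts k f)
shifts-shifts zero    k f = refl
shifts-shifts (suc j) k f = cong U.shift (shifts-shifts j k f)

term-+ : ∀ c d k → term (c ℤ.+ d) k ≈U term c k +U term d k
term-+ c d k a = trans (shifts-cong k (U.const-+ c d) a) (shifts-+ k (U.const c) (U.const d) a)

mul-shifts : ∀ k f g → U.mul (shifts k f) g ≈U shifts k (U.mul f g)
mul-shifts zero    f g a = refl
mul-shifts (suc k) f g a = trans (U.mul-shiftˡ (shifts k f) g a) (U.shift-cong (mul-shifts k f g) a)

const-mul-term : ∀ c d k → U.mul (U.const c) (term d k) ≈U term (c ℤ.* d) k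
const-mul-term c d k a = trans (U.mul-comm (U.const c) (term d k) a) (trans (mul-shifts k (U.const d) (U.const c) a)
  (shifts-cong k (λ i → trans (U.mul-comm (U.const d) (U.const c) i) (sym (U.const-* c d i))) a))

const-mul-ladder : ∀ c d k → U.mul (U.const c) (ladder d k) ≈U ladder (c ℤ.* d) k
const-mul-ladder c d zero    a = trans (U.mul-const c 0U a) (ℤₚ.*-zeroʳ c)
const-mul-ladder c d (suc k) a = trans (UR.distribˡ (U.const c) (term d k) (ladder d k) a)
  (cong₂ ℤ._+_ (const-mul-term c d k a) (const-mul-ladder c d k a))

term-mul-ladder : ∀ c j d k → U.mul (term c j) (ladder d k) ≈U shifts j (ladder (c ℤ.* d) k)
term-mul-ladder c j d k a = trans (mul-shifts j (U.const c) (ladder d k) a) (shifts-cong j (const-mul-ladder c d k) a)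

interchange : ∀ a b c d → (a ℤ.+ b) ℤ.+ (c ℤ.+ d) ≡ (a ℤ.+ c) ℤ.+ (b ℤ.+ d)
interchange = ℤSolver.solve-∀

ladder-+ : ∀ c d k → ladder (c ℤ.+ d) k ≈U ladder c k +U ladder d k
ladder-+ c d zero    a = refl
ladder-+ c d (suc k) a = trans (cong₂ ℤ._+_ (term-+ c d k a) (ladder-+ c d k a))
  (interchange (term c k a) (term d k a) (ladder c k a) (ladder d k a))

shift-ladder : ∀ c k → U.const c +U U.shift (ladder c k) ≈U ladder c (suc k)
shift-ladder c zero    zero    = refl
shift-ladder c zero    (suc a) = refl
shift-ladder c (suc k) a = begin
  U.const c a ℤ.+ U.shift (term c k +U ladder c k) a
    ≡⟨ cong (λ z → U.const c a ℤ.+ z) (U.shift-+ (term c k) (ladder c k) a) ⟩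
  U.const c a ℤ.+ (term c (suc k) a ℤ.+ U.shift (ladder c k) a)
    ≡⟨ x∙yz≈y∙xz (U.const c a) (term c (suc k) a) (U.shift (ladder c k) a) ⟩
  term c (suc k) a ℤ.+ (U.const c a ℤ.+ U.shift (ladder c k) a)
    ≡⟨ cong (λ z → term c (suc k) a ℤ.+ z) (shift-ladder c k a) ⟩
  ladder c (suc (suc k)) a ∎
  where
  open ≡-Reasoning
  open CSG ℤₚ.+-commutativeSemigroup using (x∙yz≈y∙xz)

-- Choosing an element of a filtered range and counting the chosen elements from there on
-- produces each count 1, 2, … exactly once.
∑-ranks : ∀ (p : ℕ → Bool) w f n (G : ℕ → Poly) →
  (∀ i → i < n → G (f i) ≈U term w (cnt (λ j → p (f (i + j))) (n ∸ i) ∸ 1)) →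
  ∑U (filterᵇ p (applyUpTo f n)) G ≈U ladder w (cnt (p ∘ f) n)
∑-ranks p w f zero    G h a = refl
∑-ranks p w f (suc n) G h with p (f 0) in eq
... | false = ∑-ranks p w (f ∘ suc) n G (λ i i<n → h (suc i) (s≤s i<n))
... | true  = λ a → cong₂ ℤ._+_
  (trans (h 0 (s≤s z≤n) a) (cong (λ b → term w (((if b then 1 else 0) + cnt (p ∘ f ∘ suc) n) ∸ 1) a) eq))
  (∑-ranks p w (f ∘ suc) n G (λ i i<n → h (suc i) (s≤s i<n)) a)

module _ (xs : ℕ → List (List ℕ)) (e : List ℕ → ℕ) where
  const-convolution : ∀ (α : ℕ → ℤ) (β : ℕ → List ℕ → ℕ → ℤ) b n →
    V.mul (λ k → R.const (U.const (α k))) (λ l n → ∑U (xs n) (λ x → term (β n x l) (e x))) b n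
    ≈U ∑U (xs n) (λ x → term (U.mul α (β n x) b) (e x))
  const-convolution α β b n = go α b
    where
    G : ℕ → ℕ → Poly
    G l n = ∑U (xs n) (λ x → term (β n x l) (e x))

    scaled : ∀ c l → R.mul (R.const (U.const c)) (G l) n ≈U ∑U (xs n) (λ x → term (c ℤ.* β n x l) (e x))
    scaled c l a = trans (R.mul-const (U.const c) (G l) n a) (trans (∑U-*ˡ (xs n) (U.const c) a)
      (∑U-cong (xs n) (λ {x} _ → const-mul-term c (β n x l) (e x)) a))

    go : ∀ α b → V.mul (λ k → R.const (U.const (α k))) G b n ≈U ∑U (xs n) (λ x → term (U.mul α (β n x) b) (e x))
    go α zero    a = scaled (α 0) 0 a
    go α (suc b) a = trans (cong₂ ℤ._+_ (scaled (α 0) (suc b) a) (go (α ∘ suc) b a))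
      (trans (sym (∑U-+ (xs n) a)) (∑U-cong (xs n) (λ {x} _ i → sym (term-+ (α 0 ℤ.* β n x (suc b)) (U.mul (α ∘ suc) (β n x) b) (e x) i)) a))

  module _ (ys : ℕ → List (List ℕ)) (d : List ℕ → ℕ) where
    -- By bilinearity, the product in t becomes a sum over pairs of permutations while the product
    -- in the tail length moves into their weights, where it matches the hook formula.
    convolution : ∀ (α β : ℕ → List ℕ → ℕ → ℤ) b n →
      V.mul (λ k n → ∑U (xs n) (λ x → term (α n x k) (e x))) (λ l n → ∑U (ys n) (λ y → ladder (β n y l) (d y))) b n
      ≈U ∑U (upTo (suc n)) (λ i → ∑U (xs i) (λ x → ∑U (ys (n ∸ i)) (λ y →
           shifts (e x) (ladder (U.mul (α i x) (β (n ∸ i) y) b) (d y)))))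
    convolution α β b n = go α b
      where
      F : (ℕ → List ℕ → ℕ → ℤ) → ℕ → ℕ → Poly
      F α k n = ∑U (xs n) (λ x → term (α n x k) (e x))

      G : ℕ → ℕ → Poly
      G l n = ∑U (ys n) (λ y → ladder (β n y l) (d y))

      ∑∑∑ : (ℕ → List ℕ → List ℕ → Poly) → Poly
      ∑∑∑ K = ∑U (upTo (suc n)) (λ i → ∑U (xs i) (λ x → ∑U (ys (n ∸ i)) (K i x)))

      ∑∑∑-cong : ∀ {K K′} → (∀ i x y → K i x y ≈U K′ i x y) → ∑∑∑ K ≈U ∑∑∑ K′
      ∑∑∑-cong h = ∑U-cong (upTo (suc n)) λ {i} _ → ∑U-cong (xs i) λ {x} _ → ∑U-cong (ys (n ∸ i)) λ {y} _ → h i x y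

      ∑∑∑-+ : ∀ K K′ → ∑∑∑ (λ i x y → K i x y +U K′ i x y) ≈U ∑∑∑ K +U ∑∑∑ K′
      ∑∑∑-+ K K′ a = trans (∑U-cong (upTo (suc n)) (λ {i} _ a → trans
        (∑U-cong (xs i) (λ {x} _ → ∑U-+ (ys (n ∸ i)) {K i x} {K′ i x}) a)
        (∑U-+ (xs i) {λ x → ∑U (ys (n ∸ i)) (K i x)} {λ x → ∑U (ys (n ∸ i)) (K′ i x)} a)) a)
        (∑U-+ (upTo (suc n)) {λ i → ∑U (xs i) (λ x → ∑U (ys (n ∸ i)) (K i x))}
          {λ i → ∑U (xs i) (λ x → ∑U (ys (n ∸ i)) (K′ i x))} a)

      product : ∀ α k l → R.mul (F α k) (G l) n ≈U ∑∑∑ (λ i x y → shifts (e x) (ladder (α i x k ℤ.* β (n ∸ i) y l) (d y)))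
      product α k l a = trans (mul-∑-upTo U.psRing (F α k) (G l) n a) (∑U-cong (upTo (suc n)) (λ {i} _ a →
        trans (∑U-*ʳ (xs i) (G l (n ∸ i)) a) (∑U-cong (xs i) (λ {x} _ a →
        trans (∑U-*ˡ (ys (n ∸ i)) (term (α i x k) (e x)) a) (∑U-cong (ys (n ∸ i)) (λ {y} _ →
          term-mul-ladder (α i x k) (e x) (β (n ∸ i) y l) (d y)) a)) a)) a)

      go : ∀ α b → V.mul (F α) G b n ≈U ∑∑∑ (λ i x y → shifts (e x) (ladder (U.mul (α i x) (β (n ∸ i) y) b) (d y)))
      go α zero    a = product α 0 0 a
      go α (suc b) a = trans (cong₂ ℤ._+_ (product α 0 (suc b) a) (go (λ i x k → α i x (suc k)) b a))
        (trans (sym (∑∑∑-+ (λ i x y → shifts (e x) (ladder (α i x 0 ℤ.* β (n ∸ i) y (suc b)) (d y)))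
                           (λ i x y → shifts (e x) (ladder (U.mul (λ k → α i x (suc k)) (β (n ∸ i) y) b) (d y))) a))
          (∑∑∑-cong (λ i x y a → sym (trans
            (shifts-cong (e x) (ladder-+ (α i x 0 ℤ.* β (n ∸ i) y (suc b)) (U.mul (λ k → α i x (suc k)) (β (n ∸ i) y) b) (d y)) a)
            (shifts-+ (e x) (ladder (α i x 0 ℤ.* β (n ∸ i) y (suc b)) (d y)) (ladder (U.mul (λ k → α i x (suc k)) (β (n ∸ i) y) b) (d y)) a))) a))

-- The recurrence in the tail length

weight : ℕ → ℕ → List ℕ → ℤ
weight b n π = count (π ++ seg n b)

weightTerm : ℕ → ℕ → List ℕ → Poly
weightTerm b n π = term (weight b n π) (leg π ∸ 1)

-- The coefficients of tⁿ, as polynomials in u, of h_b, h⁺_b, g⁺_b and C_b from the introduction.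
h h⁺ g⁺ c : ℕ → ℕ → Poly
h  b n = ∑U (W 2 n) (weightTerm b n)
h⁺ b n = ∑U (W⁺ n) (weightTerm b n)
g⁺ b n = ∑U (W⁺ n) (λ π → ladder (weight b n π) (leg π))
c  b   = R.const (U.const (catalanCount b))

-- The hook formula as an operation on the weights of the two sides. For b = 0 there is no tail
-- entry at which a hook from the maximum could end.
hookWeight : (ℕ → ℤ) → (ℕ → ℤ) → ℕ → ℤ
hookWeight α β zero    = + 0
hookWeight α β (suc b) = U.mul α β b

count-hooked : ∀ {m L} ρ b → ρ ≢ [] → All (_< m) ρ → All (_< m) L →
  count ((L ++ m ∷ ρ) ++ seg m b) ≡ hookWeight (λ i → count (L ++ m ∷ seg m i)) (λ i → count (ρ ++ seg m i)) b
count-hooked []      b ≢[] _ _ = contradiction refl ≢[]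
count-hooked {m} {L} (x ∷ R) b _ ρ<m L<m = trans (cong count (Lₚ.++-assoc L (m ∷ x ∷ R) (seg m b))) (go b)
  where
  go : ∀ b → count (L ++ m ∷ x ∷ R ++ seg m b) ≡ hookWeight (λ i → count (L ++ m ∷ seg m i)) (λ i → count (x ∷ R ++ seg m i)) b
  go zero    = Hook.count-hook-zero ρ<m L
  go (suc b) = Hook.count-hook ρ<m b L<m

hookWeight-cong : ∀ {α α′ β β′} b → (∀ i → α i ≡ α′ i) → (∀ i → β i ≡ β′ i) → hookWeight α β b ≡ hookWeight α′ β′ b
hookWeight-cong zero    p q = refl
hookWeight-cong (suc b) p q = U.mul-cong p q b

weight-prepend : ∀ {n π} b → π ≢ [] → π ↭ oneTo n →
  weight b (suc n) (suc n ∷ π) ≡ hookWeight (catalanCount ∘ suc) (λ l → weight l n π) b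
weight-prepend {n} {π} b π≢[] p = trans (count-hooked {suc n} {[]} π b π≢[] (perm-< p) [])
  (hookWeight-cong b (λ i → count-seg n (suc i)) (λ i → count-tail-shift 1 i (perm-≤ p)))

-- In the unsheltered part L m m+1 ⋯ the maximum m acts as a first tail entry after L, hence
-- `suc k`. The rest is relabelling.
weight-glue : ∀ {l′ r q L R} b → R ≢ [] → (pL : L ↭ oneTo (suc l′)) (pR : R ↭ oneTo r) → q ≤ r →
  weight b (suc (suc l′ + r)) (glue (suc l′ + r) l′ L R q)
  ≡ hookWeight (λ k → weight (suc k) (suc l′) L) (λ l → weight l r R) b
weight-glue {l′} {r} {q} {L} {R} b R≢[] pL pR q≤r = trans
  (count-hooked (map (glueʳ l′ q) R) b (R≢[] ∘ map-[] R) (All.map s≤s (Glue.glueʳ≤n pL pR q≤r)) (All.map s≤s (Glue.glueˡ≤n pL pR q≤r)))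
  (hookWeight-cong b left right)
  where
  n = suc l′ + r

  -- The gap of width r ∸ q between max L and the values from n + 1 on, to be closed by
  -- `count-tail-shift`.
  n≡ : n ≡ (r ∸ q) + (suc l′ + q)
  n≡ = trans (cong (suc l′ ℕ.+_) (sym (ℕₚ.m∸n+n≡m q≤r))) (eq l′ (r ∸ q) q)
    where
    eq : ∀ a b c → suc a + (b + c) ≡ b + (suc a + c)
    eq = ℕSolver.solve-∀

  left : ∀ i → count (map (glueˡ l′ q) L ++ seg n (suc i)) ≡ weight (suc i) (suc l′) L
  left i = begin
    count (map f L ++ seg n (suc i))
      ≡⟨ cong (λ k → count (map f L ++ seg k (suc i))) n≡ ⟩
    count (map f L ++ seg ((r ∸ q) + (suc l′ + q)) (suc i))
      ≡⟨ count-tail-shift (r ∸ q) (suc i) (Allₚ.map⁺ (All.map (glueˡ-upper l′ q) (perm-≤ pL))) ⟩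
    count (map f L ++ seg (suc l′ + q) (suc i))
      ≡⟨ cong (λ t → count (map f L ++ t)) (sym (map-seg (suc l′) (suc l′ + q) (suc i) λ j →
           trans (raise-> (s≤s (ℕₚ.≤-trans (ℕₚ.n≤1+n l′) (ℕₚ.m≤m+n (suc l′) j)))) (eq l′ q j))) ⟩
    count (map f L ++ map f (seg (suc l′) (suc i)))
      ≡⟨ cong count (sym (Lₚ.map-++ f L (seg (suc l′) (suc i)))) ⟩
    count (map f (L ++ seg (suc l′) (suc i)))
      ≡⟨ count-map (raise-mono l′ q) (L ++ seg (suc l′) (suc i)) ⟩
    count (L ++ seg (suc l′) (suc i)) ∎
    where
    open ≡-Reasoning
    f = glueˡ l′ q
    eq : ∀ a b c → b + suc (suc a + c) ≡ suc (suc a + b + c)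
    eq = ℕSolver.solve-∀

  right : ∀ i → count (map (glueʳ l′ q) R ++ seg (suc n) i) ≡ weight i r R
  right i = begin
    count (map g R ++ seg (suc n) i)
      ≡⟨ count-tail-shift 1 i (Glue.glueʳ≤n pL pR q≤r) ⟩
    count (map g R ++ seg n i)
      ≡⟨ cong (λ t → count (map g R ++ t)) (sym (map-seg r n i λ j →
           trans (glueʳ-> l′ q (s≤s (ℕₚ.≤-trans q≤r (ℕₚ.m≤m+n r j)))) (eq l′ r j))) ⟩
    count (map g R ++ map g (seg r i))
      ≡⟨ cong count (sym (Lₚ.map-++ g R (seg r i))) ⟩
    count (map g (R ++ seg r i))
      ≡⟨ count-map (glueʳ-mono l′ q) (R ++ seg r i) ⟩
    count (R ++ seg r i) ∎
    where
    open ≡-Reasoning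
    g = glueʳ l′ q
    eq : ∀ a b c → suc a + suc (b + c) ≡ suc (suc a + b + c)
    eq = ℕSolver.solve-∀

leg∸1 : ∀ {n π} → π ↭ oneTo n → leg π ≡ suc (leg π ∸ 1)
leg∸1 p = let k , e = leg-pos p in trans e (cong (λ z → suc (z ∸ 1)) (sym e))

weightTerm-∷ʳ : ∀ {n π} b → π ↭ oneTo n → weightTerm b (suc n) (π ∷ʳ suc n) ≡ U.shift (weightTerm (suc b) n π)
weightTerm-∷ʳ {n} {π} b p = cong₂ term (cong count (Lₚ.++-assoc π [ suc n ] (seg (suc n) b)))
  (trans (cong (_∸ 1) (leg-∷ʳ p)) (leg∸1 p))

weightTerm-∷ : ∀ {n π} b → π ≢ [] → π ↭ oneTo n →
  weightTerm b (suc n) (suc n ∷ π) ≡ U.shift (term (hookWeight (catalanCount ∘ suc) (λ l → weight l n π) b) (leg π ∸ 1))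
weightTerm-∷ b π≢[] p = cong₂ term (weight-prepend b π≢[] p) (trans (cong (_∸ 1) (leg-∷ p)) (leg∸1 p))

-- The number of legal spaces of R from q on. As q runs through the legal spaces it takes each value
-- 1, ..., leg R once, which is why R contributes a `ladder`.
rank : List ℕ → ℕ → ℕ → ℕ
rank R r q = cnt (λ j → legalᵇ R (q + j)) (suc r ∸ q)

rank-pos : ∀ {r q R} → R ↭ oneTo r → q ≤ r → rank R r q ≡ suc (rank R r q ∸ 1)
rank-pos {r} {q} {R} p q≤r = trans e (cong (λ z → suc (z ∸ 1)) (sym e))
  where
  d = r ∸ q
  top : legalᵇ R (q + (d + 0)) ≡ true
  top = legalᵇ-top (perm-unique p) (subst (λ a → All (_≤ a) R)
    (sym (trans (cong (q ℕ.+_) (ℕₚ.+-identityʳ d)) (ℕₚ.m+[n∸m]≡n q≤r))) (perm-≤ p))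

  e : rank R r q ≡ suc (cnt (λ j → legalᵇ R (q + j)) d)
  e = trans (cong (cnt (λ j → legalᵇ R (q + j))) (trans (ℕₚ.+-∸-assoc 1 q≤r) (ℕₚ.+-comm 1 d)))
    (trans (cnt-+ (λ j → legalᵇ R (q + j)) d 1)
      (trans (cong (λ b → cnt (λ j → legalᵇ R (q + j)) d + ((if b then 1 else 0) + 0)) top)
        (ℕₚ.+-comm (cnt (λ j → legalᵇ R (q + j)) d) 1)))

weightTerm-glue : ∀ {l′ r q L R} b → R ≢ [] → L ↭ oneTo (suc l′) → R ↭ oneTo r → q ≤ r →
  weightTerm b (suc (suc l′ + r)) (glue (suc l′ + r) l′ L R q)
  ≡ U.shift (shifts (leg L ∸ 1) (term (hookWeight (λ k → weight (suc k) (suc l′) L) (λ l → weight l r R) b) (rank R r q ∸ 1)))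
weightTerm-glue {l′} {r} {q} {L} {R} b R≢[] pL pR q≤r = trans
  (cong₂ term (weight-glue b R≢[] pL pR q≤r) legs)
  (cong U.shift (shifts-shifts (leg L ∸ 1) (rank R r q ∸ 1) _))
  where
  -- Both summands of leg are positive; lowering each by one leaves one unit over, the factor u that
  -- accompanies t.
  legs : leg (glue (suc l′ + r) l′ L R q) ∸ 1 ≡ suc ((leg L ∸ 1) + (rank R r q ∸ 1))
  legs = begin
    leg (glue (suc l′ + r) l′ L R q) ∸ 1
      ≡⟨ cong (_∸ 1) (Glue.leg-glue pL pR q≤r) ⟩
    leg L + cnt (λ j → legalᵇ R (q + j)) (suc (r ∸ q)) ∸ 1
      ≡⟨ cong (λ k → leg L + cnt (λ j → legalᵇ R (q + j)) k ∸ 1) (sym (ℕₚ.+-∸-assoc 1 q≤r)) ⟩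
    leg L + rank R r q ∸ 1
      ≡⟨ cong₂ (λ a b → a + b ∸ 1) (leg∸1 pL) (rank-pos pR q≤r) ⟩
    (leg L ∸ 1) + suc (rank R r q ∸ 1)
      ≡⟨ ℕₚ.+-suc (leg L ∸ 1) (rank R r q ∸ 1) ⟩
    suc ((leg L ∸ 1) + (rank R r q ∸ 1)) ∎
    where open ≡-Reasoning

gluedTerm : ℕ → ℕ → ℕ → List ℕ → List ℕ → Poly
gluedTerm b i r L R = shifts (leg L ∸ 1) (ladder (hookWeight (λ k → weight (suc k) i L) (λ l → weight l r R) b) (leg R))

∑-spaces : ∀ {n l′ L R} b → suc l′ ≤ n → L ∈ W 2 (suc l′) → R ∈ W⁺ (n ∸ suc l′) →
  ∑U (map (glue n l′ L R) (spaces R (n ∸ suc l′))) (weightTerm b (suc n))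
  ≈U U.shift (gluedTerm b (suc l′) (n ∸ suc l′) L R)
∑-spaces {n} {l′} {L} {R} b l≤n L∈ R∈ a = begin
  ∑U (map (glue n l′ L R) (spaces R r)) (weightTerm b (suc n)) a
    ≡⟨ ∑U-map (glue n l′ L R) (spaces R r) a ⟩
  ∑U (spaces R r) (λ q → weightTerm b (suc n) (glue n l′ L R q)) a
    ≡⟨ ∑U-cong (spaces R r) (λ {q} q∈ i → cong (λ f → f i)
         (subst (λ k → weightTerm b (suc k) (glue k l′ L R q) ≡ U.shift (shifts (leg L ∸ 1) (term w (rank R r q ∸ 1))))
           (ℕₚ.m+[n∸m]≡n l≤n) (weightTerm-glue b (W⁺-nonempty r R∈) pL pR (proj₁ (spaces-∈⁻ r R∈ q∈))))) a ⟩
  ∑U (spaces R r) (λ q → U.shift (shifts (leg L ∸ 1) (term w (rank R r q ∸ 1)))) a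
    ≡⟨ ∑U-shifts (suc (leg L ∸ 1)) (spaces R r) (λ q → term w (rank R r q ∸ 1)) a ⟩
  U.shift (shifts (leg L ∸ 1) (∑U (spaces R r) (λ q → term w (rank R r q ∸ 1)))) a
    ≡⟨ shifts-cong (suc (leg L ∸ 1)) (∑-ranks (legalᵇ R) w id (suc r) (λ q → term w (rank R r q ∸ 1)) (λ _ _ _ → refl)) a ⟩
  U.shift (shifts (leg L ∸ 1) (ladder w (cnt (legalᵇ R) (suc r)))) a
    ≡⟨ cong (λ k → U.shift (shifts (leg L ∸ 1) (ladder w k)) a) (sym (leg≡cnt R (perm-length pR))) ⟩
  U.shift (gluedTerm b (suc l′) r L R) a ∎
  where
  open ≡-Reasoning
  r = n ∸ suc l′
  w = hookWeight (λ k → weight (suc k) (suc l′) L) (λ l → weight l r R) b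

  pL : L ↭ oneTo (suc l′)
  pL = proj₁ (W-∈⁻ {suc l′} L∈)

  pR : R ↭ oneTo r
  pR = proj₁ (W-∈⁻ {r} (W⁺⊆W r R∈))

-- The range includes i = 0, where `W⁺` is empty, so that this is literally the sum produced by
-- `convolution`.
gluedSum : ℕ → ℕ → Poly
gluedSum b n = ∑U (upTo (suc n)) (λ i → ∑U (W⁺ i) (λ L → ∑U (W⁺ (n ∸ i)) (λ R → gluedTerm b i (n ∸ i) L R)))

∑-glued : ∀ b n → ∑U (glued n) (weightTerm b (suc n)) ≈U U.shift (gluedSum b n)
∑-glued b n a = begin
  ∑U (glued n) wt a
    ≡⟨ ∑U-concatMap layer₁ (upTo n) a ⟩
  ∑U (upTo n) (λ l′ → ∑U (layer₁ l′) wt) a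
    ≡⟨ ∑U-cong (upTo n) (λ {l′} l′∈ → step₁ l′ (∈-upTo⁻ l′∈)) a ⟩
  ∑U (upTo n) (λ l′ → U.shift (inner (suc l′))) a
    ≡⟨ ∑U-shift (upTo n) (inner ∘ suc) a ⟩
  U.shift (∑U (upTo n) (inner ∘ suc)) a
    ≡⟨ U.shift-cong (λ i → trans (sym (∑-applyUpTo-∘ U.psRing suc id n inner i)) (sym (ℤₚ.+-identityˡ _))) a ⟩
  U.shift (gluedSum b n) a ∎
  where
  open ≡-Reasoning
  open Layers n
  wt = weightTerm b (suc n)

  inner : ℕ → Poly
  inner i = ∑U (W⁺ i) (λ L → ∑U (W⁺ (n ∸ i)) (λ R → gluedTerm b i (n ∸ i) L R))

  step₂ : ∀ l′ L → suc l′ ≤ n → L ∈ W 2 (suc l′) →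
    ∑U (layer₂ l′ L) wt ≈U U.shift (∑U (W⁺ (n ∸ suc l′)) (λ R → gluedTerm b (suc l′) (n ∸ suc l′) L R))
  step₂ l′ L l≤n L∈ a = trans (∑U-concatMap (layer₃ l′ L) (W⁺ (n ∸ suc l′)) a)
    (trans (∑U-cong (W⁺ (n ∸ suc l′)) (λ R∈ → ∑-spaces b l≤n L∈ R∈) a)
      (∑U-shift (W⁺ (n ∸ suc l′)) (λ R → gluedTerm b (suc l′) (n ∸ suc l′) L R) a))

  step₁ : ∀ l′ → suc l′ ≤ n → ∑U (layer₁ l′) wt ≈U U.shift (inner (suc l′))
  step₁ l′ l≤n a = trans (∑U-concatMap (layer₂ l′) (W 2 (suc l′)) a)
    (trans (∑U-cong (W 2 (suc l′)) (λ {L} L∈ → step₂ l′ L l≤n L∈) a)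
      (∑U-shift (W 2 (suc l′)) (λ L → ∑U (W⁺ (n ∸ suc l′)) (λ R → gluedTerm b (suc l′) (n ∸ suc l′) L R)) a))

conv : ℕ → ℕ → Poly
conv zero    n = 0U
conv (suc b) n = V.mul (c ∘ suc) h⁺ b n +U V.mul (h⁺ ∘ suc) g⁺ b n

term-zero : ∀ k → term (+ 0) k ≈U 0U
term-zero zero    zero    = refl
term-zero zero    (suc a) = refl
term-zero (suc k) zero    = refl
term-zero (suc k) (suc a) = term-zero k a

shifts-zero : ∀ k {f} → f ≈U 0U → shifts k f ≈U 0U
shifts-zero zero    p = p
shifts-zero (suc k) p zero    = refl
shifts-zero (suc k) p (suc a) = shifts-zero k p a

ladder-zero : ∀ k → ladder (+ 0) k ≈U 0U
ladder-zero zero    a = refl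
ladder-zero (suc k) a = cong₂ ℤ._+_ (term-zero k a) (ladder-zero k a)

prependSum : ℕ → ℕ → Poly
prependSum b n = ∑U (W⁺ n) (λ π → term (hookWeight (catalanCount ∘ suc) (λ l → weight l n π) b) (leg π ∸ 1))

conv≈ : ∀ b n → conv b n ≈U prependSum b n +U gluedSum b n
conv≈ zero n a = sym (cong₂ ℤ._+_
  (∑U-zero (W⁺ n) (λ {π} _ → term-zero (leg π ∸ 1)) a)
  (∑U-zero (upTo (suc n)) (λ {i} _ → ∑U-zero (W⁺ i) (λ {L} _ → ∑U-zero (W⁺ (n ∸ i)) (λ {R} _ →
    shifts-zero (leg L ∸ 1) (ladder-zero (leg R))))) a))
conv≈ (suc b) n a = cong₂ ℤ._+_
  (const-convolution W⁺ (λ π → leg π ∸ 1) (catalanCount ∘ suc) (λ n π l → weight l n π) b n a)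
  (convolution W⁺ (λ π → leg π ∸ 1) W⁺ leg (λ n π k → weight (suc k) n π) (λ n π l → weight l n π) b n a)

-- Multiplication by tu on coefficients (`mul-z`).
zshift : (ℕ → Poly) → ℕ → Poly
zshift f zero    = 0U
zshift f (suc n) = U.shift (f n)

-- At n = 0 only the empty permutation with its tail remains and gives `c`. Above that, the families
-- of `W-suc-↭` give the other terms: a maximum in last place merges with the tail, whence `h` at b
-- + 1.
h-recurrence : ∀ b n → h b n ≈U c b n +U (zshift (h (suc b)) n +U zshift (conv b) n)
h-recurrence b zero    a = refl
h-recurrence b (suc n) a = begin
  ∑U (W 2 (suc n)) wt a
    ≡⟨ ∑U-↭ (W-suc-↭ n) a ⟩
  ∑U (ends ++ prepends ++ glued n) wt a
    ≡⟨ trans (∑U-++ ends (prepends ++ glued n) a) (cong (λ z → ∑U ends wt a ℤ.+ z) (∑U-++ prepends (glued n) a)) ⟩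
  ∑U ends wt a ℤ.+ (∑U prepends wt a ℤ.+ ∑U (glued n) wt a)
    ≡⟨ cong₂ ℤ._+_ (end-sum a) (cong₂ ℤ._+_ (prepend-sum a) (∑-glued b n a)) ⟩
  U.shift (h (suc b) n) a ℤ.+ (U.shift (prependSum b n) a ℤ.+ U.shift (gluedSum b n) a)
    ≡⟨ cong (λ z → U.shift (h (suc b) n) a ℤ.+ z) (trans (sym (U.shift-+ (prependSum b n) (gluedSum b n) a))
         (sym (U.shift-cong (conv≈ b n) a))) ⟩
  U.shift (h (suc b) n) a ℤ.+ U.shift (conv b n) a
    ≡⟨ sym (ℤₚ.+-identityˡ _) ⟩
  + 0 ℤ.+ (U.shift (h (suc b) n) a ℤ.+ U.shift (conv b n) a) ∎
  where
  open ≡-Reasoning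
  wt = weightTerm b (suc n)
  ends = map (_∷ʳ suc n) (W 2 n)
  prepends = map (suc n ∷_) (W⁺ n)

  end-sum : ∑U ends wt ≈U U.shift (h (suc b) n)
  end-sum a = trans (∑U-map (_∷ʳ suc n) (W 2 n) a) (trans
    (∑U-cong (W 2 n) (λ {π} π∈ i → cong (λ f → f i) (weightTerm-∷ʳ b (proj₁ (W-∈⁻ {n} π∈)))) a)
    (∑U-shift (W 2 n) (weightTerm (suc b) n) a))

  prepend-sum : ∑U prepends wt ≈U U.shift (prependSum b n)
  prepend-sum a = trans (∑U-map (suc n ∷_) (W⁺ n) a) (trans
    (∑U-cong (W⁺ n) (λ {π} π∈ i → cong (λ f → f i) (weightTerm-∷ b (W⁺-nonempty n π∈) (proj₁ (W-∈⁻ {n} (W⁺⊆W n π∈))))) a)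
    (∑U-shift (W⁺ n) (λ π → term (hookWeight (catalanCount ∘ suc) (λ l → weight l n π) b) (leg π ∸ 1)) a))

-- Algebra of the functional equation

module FinalStep (A : CommutativeRing 0ℓ 0ℓ) where
  open CommutativeRing A hiding (zero; setoid)
    renaming (refl to ≈-refl; sym to ≈-sym; trans to ≈-trans; _+_ to _⊞_; _*_ to _⊠_; _-_ to _⊟_)
  open SetoidReasoning (CommutativeRing.setoid A)
  open SemiringSolver commutativeSemiring
  private module G = GroupProps +-group

  move : ∀ {x y w} → x ⊞ y ≈ w → w ⊟ y ≈ x
  move {x} {y} {w} p = begin
    w ⊟ y             ≈⟨ +-congʳ (≈-sym p) ⟩
    (x ⊞ y) ⊞ (- y)   ≈⟨ +-assoc x y (- y) ⟩
    x ⊞ (y ⊞ (- y))   ≈⟨ +-congˡ (-‿inverseʳ y) ⟩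
    x ⊞ 0#            ≈⟨ +-identityʳ x ⟩
    x                 ∎

  -- Here i stands for 1/(1 - u), and A and B for the two brackets of the equation. The hypotheses
  -- give A = Y, iB = G⁺ + vD and H⁺ = J₁ + vY; with these the equation is the recurrence for H
  -- after cancelling P + 1.
  functional-equation : ∀ {t u v i J J₁ P H H⁺ C D Y G⁺ A B} →
    J ⊞ (P ⊞ 1#) ≈ H → J₁ ⊞ (v ⊠ P ⊞ 1#) ≈ H → H ≈ H⁺ ⊞ C → C ≈ v ⊠ D ⊞ 1# →
    H ≈ (P ⊞ C) ⊞ t ⊠ u ⊠ v ⊠ (D ⊠ H⁺ ⊞ Y ⊠ G⁺) → P ≈ Y ⊞ D → A ≈ P ⊟ D → i ⊠ B ≈ (G⁺ ⊞ C) ⊟ 1# →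
    J ≈ (C ⊟ 1#) ⊠ (1# ⊞ t ⊠ u ⊠ J₁) ⊞ t ⊠ u ⊠ v ⊠ i ⊠ A ⊠ B
  functional-equation {t} {u} {v} {i} {J} {J₁} {P} {H} {H⁺} {C} {D} {Y} {G⁺} {A} {B} hJ hJ₁ hH hC hR hP hA hB = begin
    J
      ≈⟨ G.∙-cancelʳ (P ⊞ 1#) _ _ (≈-trans hJ (≈-trans hR (≈-trans (+-congʳ (+-congˡ hC))
           (solve 4 (λ P d o r → (P :+ (d :+ o)) :+ r := (d :+ r) :+ (P :+ o)) ≈-refl
             P (v ⊠ D) 1# (t ⊠ u ⊠ v ⊠ (D ⊠ H⁺ ⊞ Y ⊠ G⁺)))))) ⟩
    v ⊠ D ⊞ t ⊠ u ⊠ v ⊠ (D ⊠ H⁺ ⊞ Y ⊠ G⁺)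
      ≈⟨ +-congˡ (*-congˡ (+-congʳ (*-congˡ H⁺≈))) ⟩
    v ⊠ D ⊞ t ⊠ u ⊠ v ⊠ (D ⊠ (J₁ ⊞ v ⊠ Y) ⊞ Y ⊠ G⁺)
      ≈⟨ solve 7 (λ t u v D J₁ Y G⁺ → v :* D :+ t :* u :* v :* (D :* (J₁ :+ v :* Y) :+ Y :* G⁺)
           := (v :* D) :* (con 1 :+ t :* u :* J₁) :+ t :* u :* v :* Y :* (G⁺ :+ v :* D)) ≈-refl t u v D J₁ Y G⁺ ⟩
    (v ⊠ D) ⊠ (1# ⊞ t ⊠ u ⊠ J₁) ⊞ t ⊠ u ⊠ v ⊠ Y ⊠ (G⁺ ⊞ v ⊠ D)
      ≈⟨ +-cong (*-congʳ (≈-sym C-1)) (*-cong (*-congˡ (≈-sym A≈)) (≈-sym iB)) ⟩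
    (C ⊟ 1#) ⊠ (1# ⊞ t ⊠ u ⊠ J₁) ⊞ t ⊠ u ⊠ v ⊠ A ⊠ (i ⊠ B)
      ≈⟨ +-congˡ (solve 6 (λ t u v i A B → t :* u :* v :* A :* (i :* B) := t :* u :* v :* i :* A :* B) ≈-refl t u v i A B) ⟩
    (C ⊟ 1#) ⊠ (1# ⊞ t ⊠ u ⊠ J₁) ⊞ t ⊠ u ⊠ v ⊠ i ⊠ A ⊠ B ∎
    where
    C-1 : C ⊟ 1# ≈ v ⊠ D
    C-1 = move (≈-sym hC)

    A≈ : A ≈ Y
    A≈ = ≈-trans hA (move (≈-sym hP))

    H⁺≈ : H⁺ ≈ J₁ ⊞ v ⊠ Y
    H⁺≈ = G.∙-cancelʳ C _ _ (≈-trans (≈-sym hH) (≈-trans (≈-sym hJ₁) (≈-trans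
      (+-congˡ (+-congʳ (≈-trans (*-congˡ hP) (distribˡ v Y D))))
      (≈-trans (solve 4 (λ j y d o → j :+ ((y :+ d) :+ o) := (j :+ y) :+ (d :+ o)) ≈-refl J₁ (v ⊠ Y) (v ⊠ D) 1#)
        (+-congˡ (≈-sym hC))))))

    iB : i ⊠ B ≈ G⁺ ⊞ v ⊠ D
    iB = ≈-trans hB (move (≈-trans (+-assoc _ _ _) (+-congˡ (≈-sym hC))))

module RR = CommutativeRing R.psRing
module VR = CommutativeRing V.psRing

tR uR z : ℕ → Poly
tR = R.X
uR = R.const U.X
z  = R.mul tR uR

mul-uR : ∀ f n → R.mul uR f n ≈U U.shift (f n)
mul-uR f n a = trans (R.mul-const U.X f n a) (U.mul-X (f n) a)

zshift-cong : ∀ {f g} → (∀ n → f n ≈U g n) → ∀ n → zshift f n ≈U zshift g n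
zshift-cong p zero    a = refl
zshift-cong p (suc n) a = U.shift-cong (p n) a

mul-z : ∀ f n → R.mul z f n ≈U zshift f n
mul-z f n a = trans (R.mul-assoc tR uR f n a) (trans (R.mul-X (R.mul uR f) n a) (go n))
  where
  go : ∀ n → R.shift (R.mul uR f) n a ≡ zshift f n a
  go zero    = refl
  go (suc n) = mul-uR f n a

zshifts : ℕ → (ℕ → Poly) → ℕ → Poly
zshifts zero    f = f
zshifts (suc b) f = zshift (zshifts b f)

pow-z : ∀ b f n → R.mul (V.pow z b) f n ≈U zshifts b f n
pow-z zero    f n a = R.mul-identityˡ f n a
pow-z (suc b) f n a = trans (R.mul-assoc z (V.pow z b) f n a)
  (trans (mul-z (R.mul (V.pow z b) f) n a) (zshift-cong (pow-z b f) n a))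

-- `κ` is `h` at u = 1, kept as a constant in u; it enters because (1 - u) g = κ - u h.
κ g : ℕ → ℕ → Poly
κ b n = ∑U (W 2 n) (λ π → term (weight b n π) 0)
g b n = ∑U (W 2 n) (λ π → ladder (weight b n π) (leg π))

gf : (ℕ → ℕ → Poly) → ℕ → ℕ → Poly
gf = V.scale z

-- The exponent of u is a parameter because two are needed: leg - 1 for J itself and the tail length
-- b for J(t,1,uv).
module Tails (w : ℕ → List ℕ → ℕ) (w-∷ʳ : ∀ {n π} b → π ↭ oneTo n → w (suc b) (π ∷ʳ suc n) ≡ suc (w b π)) where
  base : ℕ → ℕ → Poly
  base c n = ∑U (W 2 n) (λ π → term (weight c n π) (w 0 π))

  -- Here b is a tail inside ρ and c a tail still to be appended; `tailed-suc` moves one entry from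
  -- the former to the latter.
  tailed : ℕ → ℕ → ℕ → Poly
  tailed b c n = ∑U (W 2 n) (λ ρ → if b ≤ᵇ tl ρ then term (weight c n ρ) (w b ρ) else 0U)

  private
    if-shift : ∀ (x : Bool) f → (if x then U.shift f else 0U) ≈U U.shift (if x then f else 0U)
    if-shift true  f a       = refl
    if-shift false f zero    = refl
    if-shift false f (suc a) = refl

    tailed-suc : ∀ b c n → tailed (suc b) c n ≈U zshift (tailed b (suc c)) n
    tailed-suc b c zero    a = refl
    tailed-suc b c (suc n) a = trans
      (∑-W-suc-tail {U.psRing} n b (λ ρ → term (weight c (suc n) ρ) (w (suc b) ρ)) a)
      (trans (∑U-cong (W 2 n) (λ {π} π∈ i → trans
        (cong (λ f → (if b ≤ᵇ tl π then f else 0U) i)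
          (cong₂ term (cong count (Lₚ.++-assoc π [ suc n ] (seg (suc n) c))) (w-∷ʳ b (proj₁ (W-∈⁻ {n} π∈)))))
        (if-shift (b ≤ᵇ tl π) (term (weight (suc c) n π) (w b π)) i)) a)
        (∑U-shift (W 2 n) (λ π → if b ≤ᵇ tl π then term (weight (suc c) n π) (w b π) else 0U) a))

    tailed≈ : ∀ b c n → tailed b c n ≈U zshifts b (base (b + c)) n
    tailed≈ zero    c n a = refl
    tailed≈ (suc b) c n a = trans (tailed-suc b c n a) (zshift-cong (λ n a → trans (tailed≈ b (suc c) n a)
      (cong (λ k → zshifts b (base k) n a) (ℕₚ.+-suc b c))) n a)

  gf≈tailed : ∀ b n → gf base b n ≈U tailed b 0 n
  gf≈tailed b n a = trans (pow-z b (base b) n a)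
    (sym (trans (tailed≈ b 0 n a) (cong (λ k → zshifts b (base k) n a) (ℕₚ.+-identityʳ b))))

-- From coefficient functions to nested series

τ : Series → ℕ → ℕ → Poly
τ F b n a = F n a b

sumTo-cong : ∀ n {f g} → (∀ i → f i ≡ g i) → sumTo n f ≡ sumTo n g
sumTo-cong zero    p = p 0
sumTo-cong (suc n) p = cong₂ ℤ._+_ (sumTo-cong n p) (p (suc n))

sumTo-+ : ∀ n f g → sumTo n (λ i → f i ℤ.+ g i) ≡ sumTo n f ℤ.+ sumTo n g
sumTo-+ zero    f g = refl
sumTo-+ (suc n) f g = trans (cong (λ x → x ℤ.+ (f (suc n) ℤ.+ g (suc n))) (sumTo-+ n f g))
  (interchange (sumTo n f) (sumTo n g) (f (suc n)) (g (suc n)))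

sumTo-swap : ∀ m n (f : ℕ → ℕ → ℤ) → sumTo m (λ i → sumTo n (f i)) ≡ sumTo n (λ j → sumTo m (λ i → f i j))
sumTo-swap zero    n f = refl
sumTo-swap (suc m) n f = trans (cong (λ x → x ℤ.+ sumTo n (f (suc m))) (sumTo-swap m n f))
  (sym (sumTo-+ n (λ j → sumTo m (λ i → f i j)) (f (suc m))))

U-mul-sumTo : ∀ f g a → U.mul f g a ≡ sumTo a (λ j → f j ℤ.* g (a ∸ j))
U-mul-sumTo f g a = trans (sym (U.sumUpTo-mul a f g)) (go a (λ j → f j ℤ.* g (a ∸ j)))
  where
  go : ∀ n F → U.sumUpTo n F ≡ sumTo n F
  go zero    F = refl
  go (suc n) F = cong (λ x → x ℤ.+ F (suc n)) (go n F)

R-mul-sumTo : ∀ f g n a → R.mul f g n a ≡ sumTo n (λ i → U.mul (f i) (g (n ∸ i)) a)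
R-mul-sumTo f g n a = trans (sym (R.sumUpTo-mul n f g a)) (go n (λ i → U.mul (f i) (g (n ∸ i))))
  where
  go : ∀ n F → R.sumUpTo n F a ≡ sumTo n (λ i → F i a)
  go zero    F = refl
  go (suc n) F = cong (λ x → x ℤ.+ F (suc n) a) (go n F)

V-mul-sumTo : ∀ f g b n a → V.mul f g b n a ≡ sumTo b (λ k → R.mul (f k) (g (b ∸ k)) n a)
V-mul-sumTo f g b n a = trans (sym (V.sumUpTo-mul b f g n a)) (go b (λ k → R.mul (f k) (g (b ∸ k))))
  where
  go : ∀ b F → V.sumUpTo b F n a ≡ sumTo b (λ k → F k n a)
  go zero    F = refl
  go (suc b) F = cong (λ x → x ℤ.+ F (suc b) n a) (go b F)

τ-⊛ : ∀ F G b n a → τ (F ⊛ G) b n a ≡ V.mul (τ F) (τ G) b n a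
τ-⊛ F G b n a = begin
  sumTo n (λ i → sumTo a (λ j → sumTo b (λ k → F i j k ℤ.* G (n ∸ i) (a ∸ j) (b ∸ k))))
    ≡⟨ sumTo-cong n (λ i → sumTo-swap a b (λ j k → F i j k ℤ.* G (n ∸ i) (a ∸ j) (b ∸ k))) ⟩
  sumTo n (λ i → sumTo b (λ k → sumTo a (λ j → F i j k ℤ.* G (n ∸ i) (a ∸ j) (b ∸ k))))
    ≡⟨ sumTo-swap n b (λ i k → sumTo a (λ j → F i j k ℤ.* G (n ∸ i) (a ∸ j) (b ∸ k))) ⟩
  sumTo b (λ k → sumTo n (λ i → sumTo a (λ j → F i j k ℤ.* G (n ∸ i) (a ∸ j) (b ∸ k))))
    ≡⟨ sumTo-cong b (λ k → sumTo-cong n (λ i → sym (U-mul-sumTo (τ F k i) (τ G (b ∸ k) (n ∸ i)) a))) ⟩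
  sumTo b (λ k → sumTo n (λ i → U.mul (τ F k i) (τ G (b ∸ k) (n ∸ i)) a))
    ≡⟨ sumTo-cong b (λ k → sym (R-mul-sumTo (τ F k) (τ G (b ∸ k)) n a)) ⟩
  sumTo b (λ k → R.mul (τ F k) (τ G (b ∸ k)) n a)
    ≡⟨ sym (V-mul-sumTo (τ F) (τ G) b n a) ⟩
  V.mul (τ F) (τ G) b n a ∎
  where open ≡-Reasoning

_≈V_ : (ℕ → ℕ → Poly) → (ℕ → ℕ → Poly) → Set
f ≈V g = ∀ b n a → f b n a ≡ g b n a

infix 4 _≈V_

τ𝟙 : τ 𝟙 ≈V VR.1#
τ𝟙 zero    zero    zero    = refl
τ𝟙 zero    zero    (suc a) = refl
τ𝟙 zero    (suc n) a       = refl
τ𝟙 (suc b) zero    zero    = refl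
τ𝟙 (suc b) zero    (suc a) = refl
τ𝟙 (suc b) (suc n) a       = refl

τt : τ tS ≈V V.const tR
τt zero    zero          a       = refl
τt zero    (suc zero)    zero    = refl
τt zero    (suc zero)    (suc a) = refl
τt zero    (suc (suc n)) a       = refl
τt (suc b) zero          a       = refl
τt (suc b) (suc zero)    zero    = refl
τt (suc b) (suc zero)    (suc a) = refl
τt (suc b) (suc (suc n)) a       = refl

τu : τ uS ≈V V.const uR
τu zero    zero    zero          = refl
τu zero    zero    (suc zero)    = refl
τu zero    zero    (suc (suc a)) = refl
τu zero    (suc n) a             = refl
τu (suc b) zero    zero          = refl
τu (suc b) zero    (suc zero)    = refl
τu (suc b) zero    (suc (suc a)) = refl
τu (suc b) (suc n) a             = refl

τv : τ vS ≈V V.X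
τv zero          zero    zero    = refl
τv zero          zero    (suc a) = refl
τv zero          (suc n) a       = refl
τv (suc zero)    zero    zero    = refl
τv (suc zero)    zero    (suc a) = refl
τv (suc zero)    (suc n) a       = refl
τv (suc (suc b)) zero    zero    = refl
τv (suc (suc b)) zero    (suc a) = refl
τv (suc (suc b)) (suc n) a       = refl

pow-1 : ∀ a → U.pow (+ 1) a ≡ + 1
pow-1 zero    = refl
pow-1 (suc a) = trans (ℤₚ.*-identityˡ _) (pow-1 a)

τ-inv1-u : τ inv1-u ≈V V.const (R.const (U.pow (+ 1)))
τ-inv1-u zero    zero    a = sym (pow-1 a)
τ-inv1-u zero    (suc n) a = refl
τ-inv1-u (suc b) zero    a = refl
τ-inv1-u (suc b) (suc n) a = refl

τ-inv1-v : τ inv1-v ≈V V.pow RR.1#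
τ-inv1-v zero    zero    zero    = refl
τ-inv1-v zero    zero    (suc a) = refl
τ-inv1-v zero    (suc n) a       = refl
τ-inv1-v (suc b) n       a       = trans (unfold n a) (trans (τ-inv1-v b n a) (sym (R.mul-identityˡ (V.pow RR.1# b) n a)))
  where
  unfold : ∀ n a → τ inv1-v (suc b) n a ≡ τ inv1-v b n a
  unfold n a = refl

τ-inv1-uv : τ inv1-uv ≈V V.pow uR
τ-inv1-uv zero    zero    zero    = refl
τ-inv1-uv zero    zero    (suc a) = refl
τ-inv1-uv zero    (suc n) a       = refl
τ-inv1-uv (suc b) n       a       = trans (unfold n a) (trans (U.shift-cong (τ-inv1-uv b n) a) (sym (mul-uR (V.pow uR b) n a)))
  where
  unfold : ∀ n a → τ inv1-uv (suc b) n a ≡ U.shift (τ inv1-uv b n) a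
  unfold zero    zero    = refl
  unfold (suc n) zero    = refl
  unfold zero    (suc a) = refl
  unfold (suc n) (suc a) = refl

-- The coefficient of vᵇ in `H` collects the permutations of tail length at least b. `P`, `D` and
-- `Y` are `H`, `C` and `H⁺` without their constant coefficient in v, divided by v.
H H⁺ Y P D C G G⁺ M : ℕ → ℕ → Poly
H  = gf h
H⁺ = gf h⁺
G  = gf g
G⁺ = gf g⁺
C  = gf c
M  = gf κ
P  = H ∘ suc
D  = C ∘ suc
Y  = H⁺ ∘ suc

module TailsLeg = Tails (λ _ π → leg π ∸ 1) (λ b p → trans (cong (_∸ 1) (leg-∷ʳ p)) (leg∸1 p))
module TailsNum = Tails (λ b _ → b) (λ _ _ → refl)

term-eval : ∀ w k a → term w k a ≡ (if k ≡ᵇ a then w else + 0)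
term-eval w zero    zero    = refl
term-eval w zero    (suc a) = refl
term-eval w (suc k) zero    = refl
term-eval w (suc k) (suc a) = term-eval w k a

suc-≤ᵇ : ∀ a b → (suc a ≤ᵇ suc b) ≡ (a ≤ᵇ b)
suc-≤ᵇ zero    b = refl
suc-≤ᵇ (suc a) b = refl

-- Tail length at least b is exactly b or at least b + 1, for a single permutation of weight w.
exact+above : ∀ w x t b a → (if (x ≡ᵇ a) ∧ (t ≡ᵇ b) then w else + 0) ℤ.+ (if suc b ≤ᵇ t then term w x else 0U) a
  ≡ (if b ≤ᵇ t then term w x else 0U) a
exact+above w x zero    zero    a rewrite Bₚ.∧-identityʳ (x ≡ᵇ a) = trans (ℤₚ.+-identityʳ _) (sym (term-eval w x a))
exact+above w x (suc t) zero    a rewrite Bₚ.∧-zeroʳ (x ≡ᵇ a) = ℤₚ.+-identityˡ _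
exact+above w x zero    (suc b) a rewrite Bₚ.∧-zeroʳ (x ≡ᵇ a) = refl
exact+above w x (suc t) (suc b) a rewrite suc-≤ᵇ (suc b) t | suc-≤ᵇ b t = exact+above w x t b a

+sumℕ : ∀ {A : Set} (xs : List A) (f : A → ℕ) → + sumℕ (map f xs) ≡ ∑ℤ xs (λ x → + f x)
+sumℕ []       f = refl
+sumℕ (x ∷ xs) f = cong (λ r → + f x ℤ.+ r) (+sumℕ xs f)

Jsub≡∑ : ∀ φ n a b → Jsub φ n a b ≡ ∑ℤ (W⁺ n) (λ π →
  if (proj₁ (φ (leg π ∸ 1) (tl π)) ≡ᵇ a) ∧ (proj₂ (φ (leg π ∸ 1) (tl π)) ≡ᵇ b) then weight 0 n π else + 0)
Jsub≡∑ φ zero    a b = refl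
Jsub≡∑ φ (suc m) a b = trans
  (+sumℕ (W 2 (suc m)) (λ π → if test π then preimageCount (suc m) π else 0))
  (∑ℤ-cong (W 2 (suc m)) λ {π} π∈ → trans (+-if (test π) _) (cong (λ w → if test π then w else + 0)
    (trans (preimageCount≡count (proj₁ (W-∈⁻ {suc m} π∈))) (cong count (sym (Lₚ.++-identityʳ π))))))
  where
  test : List ℕ → Bool
  test π = (proj₁ (φ (leg π ∸ 1) (tl π)) ≡ᵇ a) ∧ (proj₂ (φ (leg π ∸ 1) (tl π)) ≡ᵇ b)

  +-if : ∀ (x : Bool) k → + (if x then k else 0) ≡ (if x then + k else + 0)
  +-if true  k = refl
  +-if false k = refl

1V : ℕ → ℕ → Poly
1V = VR.1#

-- `exact+above` summed over permutations; the 1 is the empty permutation, present in `H` but not in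
-- `J`.
J+P+1≡H : ∀ b n a → τ J b n a ℤ.+ (P b n a ℤ.+ 1V b n a) ≡ H b n a
J+P+1≡H b n a = trans (cong₂ (λ x y → x ℤ.+ (y ℤ.+ 1V b n a)) (Jsub≡∑ _ n a b) (TailsLeg.gf≈tailed (suc b) n a))
  (trans (go b n a) (sym (TailsLeg.gf≈tailed b n a)))
  where
  go : ∀ b n a → ∑ℤ (W⁺ n) (λ π → if (leg π ∸ 1 ≡ᵇ a) ∧ (tl π ≡ᵇ b) then weight 0 n π else + 0)
    ℤ.+ (TailsLeg.tailed (suc b) 0 n a ℤ.+ 1V b n a) ≡ TailsLeg.tailed b 0 n a
  go zero    zero    zero    = refl
  go zero    zero    (suc a) = refl
  go (suc b) zero    a       = refl
  go b       (suc n) a       = begin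
    ∑ℤ xs e ℤ.+ (TailsLeg.tailed (suc b) 0 (suc n) a ℤ.+ 1V b (suc n) a)
      ≡⟨ cong₂ (λ x y → ∑ℤ xs e ℤ.+ (x ℤ.+ y)) (∑U-eval xs (above (suc b)) a) (1V-suc b) ⟩
    ∑ℤ xs e ℤ.+ (∑ℤ xs (λ π → above (suc b) π a) ℤ.+ + 0)
      ≡⟨ cong (λ y → ∑ℤ xs e ℤ.+ y) (ℤₚ.+-identityʳ _) ⟩
    ∑ℤ xs e ℤ.+ ∑ℤ xs (λ π → above (suc b) π a)
      ≡⟨ sym (∑ℤ-+ xs {e} {λ π → above (suc b) π a}) ⟩
    ∑ℤ xs (λ π → e π ℤ.+ above (suc b) π a)
      ≡⟨ ∑ℤ-cong xs (λ {π} _ → exact+above (weight 0 (suc n) π) (leg π ∸ 1) (tl π) b a) ⟩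
    ∑ℤ xs (λ π → above b π a)
      ≡⟨ sym (∑U-eval xs (above b) a) ⟩
    TailsLeg.tailed b 0 (suc n) a ∎
    where
    open ≡-Reasoning
    xs = W 2 (suc n)
    e : List ℕ → ℤ
    e π = if (leg π ∸ 1 ≡ᵇ a) ∧ (tl π ≡ᵇ b) then weight 0 (suc n) π else + 0
    above : ℕ → List ℕ → Poly
    above b ρ = if b ≤ᵇ tl ρ then term (weight 0 (suc n) ρ) (leg ρ ∸ 1) else 0U
    1V-suc : ∀ b → 1V b (suc n) a ≡ + 0
    1V-suc zero    = refl
    1V-suc (suc b) = refl

-- Serves v = 1 with u kept or set to 1. The condition on x puts the empty permutation, for which
-- leg - 1 is 0, at the constant term.
Jconst+1 : ∀ (x : ℕ → ℕ) → x 0 ≡ 0 → ∀ b n a → τ (Jsub (λ l t → x l , 0)) b n a ℤ.+ 1V b n a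
  ≡ V.const (λ n → ∑U (W 2 n) (λ π → term (weight 0 n π) (x (leg π ∸ 1)))) b n a
Jconst+1 x x0 b n a = trans (cong (λ z → z ℤ.+ 1V b n a) (Jsub≡∑ (λ l t → x l , 0) n a b)) (go b n)
  where
  go : ∀ b n → ∑ℤ (W⁺ n) (λ π → if (x (leg π ∸ 1) ≡ᵇ a) ∧ (0 ≡ᵇ b) then weight 0 n π else + 0) ℤ.+ 1V b n a
    ≡ V.const (λ n → ∑U (W 2 n) (λ π → term (weight 0 n π) (x (leg π ∸ 1)))) b n a
  go zero    zero    = trans (ℤₚ.+-identityˡ (U.const (+ 1) a))
    (trans (cong (λ k → term (+ 1) k a) (sym x0)) (sym (ℤₚ.+-identityʳ (term (+ 1) (x 0) a))))
  go zero    (suc n) = trans (ℤₚ.+-identityʳ _) (trans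
    (∑ℤ-cong (W 2 (suc n)) λ {π} _ → trans
      (cong (λ β → if β then weight 0 (suc n) π else + 0) (Bₚ.∧-identityʳ (x (leg π ∸ 1) ≡ᵇ a)))
      (sym (term-eval (weight 0 (suc n) π) (x (leg π ∸ 1)) a)))
    (sym (∑U-eval (W 2 (suc n)) (λ π → term (weight 0 (suc n) π) (x (leg π ∸ 1))) a)))
  go (suc b) n = trans (cong₂ ℤ._+_ (∑ℤ-zero (W⁺ n) λ {π} _ →
    cong (λ β → if β then weight 0 n π else + 0) (Bₚ.∧-zeroʳ (x (leg π ∸ 1) ≡ᵇ a))) refl) refl

Ju1+1 : ∀ b n a → τ Ju1 b n a ℤ.+ 1V b n a ≡ V.const (h 0) b n a
Ju1+1 = Jconst+1 id refl

J11+1 : ∀ b n a → τ J11 b n a ℤ.+ 1V b n a ≡ V.const (κ 0) b n a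
J11+1 = Jconst+1 (λ _ → 0) refl

-- In `M`, tail length at least b is counted with uᵇ, so coefficient b + 1 carries one more u;
-- multiplying the split of `exact+above` by u makes the exponents agree.
M+uJ1uv : ∀ b n a → M (suc b) n a ℤ.+ U.shift (λ a → τ J1uv b n a ℤ.+ 1V b n a) a ≡ U.shift (M b n) a
M+uJ1uv b n a = trans (cong₂ ℤ._+_ (TailsNum.gf≈tailed (suc b) n a)
    (U.shift-cong (λ a → cong (λ z → z ℤ.+ 1V b n a) (Jsub≡∑ (λ x y → y , y) n a b)) a))
  (trans (go b n a) (sym (U.shift-cong (TailsNum.gf≈tailed b n) a)))
  where
  exact : ℕ → ℕ → ℕ → List ℕ → ℤ
  exact b n a π = if (tl π ≡ᵇ a) ∧ (tl π ≡ᵇ b) then weight 0 n π else + 0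

  above : ℕ → ℕ → ℕ → List ℕ → Poly
  above b k n ρ = if b ≤ᵇ tl ρ then term (weight 0 n ρ) k else 0U

  same : ∀ t a b → ((t ≡ᵇ a) ∧ (t ≡ᵇ b)) ≡ ((b ≡ᵇ a) ∧ (t ≡ᵇ b))
  same t a b with t ≡ᵇ b in eq
  ... | false = trans (Bₚ.∧-zeroʳ (t ≡ᵇ a)) (sym (Bₚ.∧-zeroʳ (b ≡ᵇ a)))
  ... | true  = cong (λ k → (k ≡ᵇ a) ∧ true) (ℕₚ.≡ᵇ⇒≡ t b (subst T (sym eq) tt))

  above-shift : ∀ b n ρ a → above (suc b) (suc b) n ρ a ≡ U.shift (above (suc b) b n ρ) a
  above-shift b n ρ a with suc b ≤ᵇ tl ρ
  ... | true  = refl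
  above-shift b n ρ zero    | false = refl
  above-shift b n ρ (suc a) | false = refl

  go : ∀ b n a → TailsNum.tailed (suc b) 0 n a ℤ.+ U.shift (λ a → ∑ℤ (W⁺ n) (exact b n a) ℤ.+ 1V b n a) a
    ≡ U.shift (TailsNum.tailed b 0 n) a
  go zero    zero    zero          = refl
  go zero    zero    (suc zero)    = refl
  go zero    zero    (suc (suc a)) = refl
  go (suc b) zero    zero          = refl
  go (suc b) zero    (suc a)       = refl
  go b       (suc n) zero          = trans (ℤₚ.+-identityʳ _)
    (trans (∑U-cong (W 2 (suc n)) (λ {ρ} _ → above-shift b (suc n) ρ) zero)
      (∑U-shift (W 2 (suc n)) (above (suc b) b (suc n)) zero))
  go b       (suc n) (suc a)       = begin
    TailsNum.tailed (suc b) 0 (suc n) (suc a) ℤ.+ (∑ℤ xs (exact b (suc n) a) ℤ.+ 1V b (suc n) a)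
      ≡⟨ cong₂ (λ x y → x ℤ.+ (∑ℤ xs (exact b (suc n) a) ℤ.+ y))
           (trans (∑U-cong xs (λ {ρ} _ → above-shift b (suc n) ρ) (suc a))
             (trans (∑U-shift xs (above (suc b) b (suc n)) (suc a)) (∑U-eval xs (above (suc b) b (suc n)) a))) (1V-suc b) ⟩
    ∑ℤ xs (λ ρ → above (suc b) b (suc n) ρ a) ℤ.+ (∑ℤ xs (exact b (suc n) a) ℤ.+ + 0)
      ≡⟨ trans (ℤₚ.+-comm (∑ℤ xs (λ ρ → above (suc b) b (suc n) ρ a)) _)
           (cong (λ z → z ℤ.+ ∑ℤ xs (λ ρ → above (suc b) b (suc n) ρ a)) (ℤₚ.+-identityʳ (∑ℤ xs (exact b (suc n) a)))) ⟩
    ∑ℤ xs (exact b (suc n) a) ℤ.+ ∑ℤ xs (λ ρ → above (suc b) b (suc n) ρ a)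
      ≡⟨ sym (∑ℤ-+ xs {exact b (suc n) a} {λ ρ → above (suc b) b (suc n) ρ a}) ⟩
    ∑ℤ xs (λ ρ → exact b (suc n) a ρ ℤ.+ above (suc b) b (suc n) ρ a)
      ≡⟨ ∑ℤ-cong xs (λ {ρ} _ → trans
           (cong (λ β → (if β then weight 0 (suc n) ρ else + 0) ℤ.+ above (suc b) b (suc n) ρ a) (same (tl ρ) a b))
           (exact+above (weight 0 (suc n) ρ) b (tl ρ) b a)) ⟩
    ∑ℤ xs (λ ρ → above b b (suc n) ρ a)
      ≡⟨ sym (∑U-eval xs (above b b (suc n)) a) ⟩
    TailsNum.tailed b 0 (suc n) a ∎
    where
    open ≡-Reasoning
    xs = W 2 (suc n)
    1V-suc : ∀ b → 1V b (suc n) a ≡ + 0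
    1V-suc zero    = refl
    1V-suc (suc b) = refl

-- For each permutation, (1 - u)(1 + u + ⋯ + uᵏ⁻¹) = 1 - uᵏ with k = leg π, freed of subtraction.
κ+ug : ∀ b n a → κ b n a ℤ.+ U.shift (g b n) a ≡ g b n a ℤ.+ U.shift (h b n) a
κ+ug b n a = begin
  κ b n a ℤ.+ U.shift (g b n) a
    ≡⟨ cong (λ z → κ b n a ℤ.+ z) (sym (∑U-shift xs ladders a)) ⟩
  κ b n a ℤ.+ ∑U xs (U.shift ∘ ladders) a
    ≡⟨ sym (∑U-+ xs {λ π → term (weight b n π) 0} {U.shift ∘ ladders} a) ⟩
  ∑U xs (λ π → term (weight b n π) 0 +U U.shift (ladders π)) a
    ≡⟨ ∑U-cong xs (λ {π} π∈ i → step (weight b n π) (leg π) (leg∸1 (proj₁ (W-∈⁻ {n} π∈))) i) a ⟩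
  ∑U xs (λ π → ladders π +U U.shift (weightTerm b n π)) a
    ≡⟨ ∑U-+ xs {ladders} {U.shift ∘ weightTerm b n} a ⟩
  g b n a ℤ.+ ∑U xs (U.shift ∘ weightTerm b n) a
    ≡⟨ cong (λ z → g b n a ℤ.+ z) (∑U-shift xs (weightTerm b n) a) ⟩
  g b n a ℤ.+ U.shift (h b n) a ∎
  where
  open ≡-Reasoning
  xs = W 2 n
  ladders : List ℕ → Poly
  ladders π = ladder (weight b n π) (leg π)

  step : ∀ w k → k ≡ suc (k ∸ 1) → term w 0 +U U.shift (ladder w k) ≈U ladder w k +U U.shift (term w (k ∸ 1))
  step w (suc k) _ i = trans (shift-ladder w (suc k) i) (ℤₚ.+-comm (term w (suc k) i) (ladder w (suc k) i))

h≈h⁺+c : ∀ b n a → h b n a ≡ h⁺ b n a ℤ.+ c b n a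
h≈h⁺+c b zero    a = ℤₚ.+-comm (U.const (catalanCount b) a) (+ 0)
h≈h⁺+c b (suc n) a = sym (ℤₚ.+-identityʳ _)

g≈g⁺+c : ∀ b n a → g b n a ≡ g⁺ b n a ℤ.+ c b n a
g≈g⁺+c b zero    a = trans (ℤₚ.+-identityʳ _) (ℤₚ.+-comm (U.const (catalanCount b) a) (+ 0))
g≈g⁺+c b (suc n) a = sym (ℤₚ.+-identityʳ _)

gf-+ : ∀ {f f₁ f₂} → (∀ b n a → f b n a ≡ f₁ b n a ℤ.+ f₂ b n a) → gf f ≈V VR._+_ (gf f₁) (gf f₂)
gf-+ {f} {f₁} {f₂} p b n a = trans (R.mul-cong {f = V.pow z b} (λ _ _ → refl) (p b) n a) (RR.distribˡ (V.pow z b) (f₁ b) (f₂ b) n a)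

H≈ : H ≈V VR._+_ H⁺ C
H≈ = gf-+ h≈h⁺+c

G≈ : G ≈V VR._+_ G⁺ C
G≈ = gf-+ g≈g⁺+c

gf-0 : ∀ f → gf f 0 RR.≈ f 0
gf-0 f n a = R.mul-identityˡ (f 0) n a

C≈ : C ≈V VR._+_ (VR._*_ V.X D) 1V
C≈ zero    n a = trans (gf-0 c n a) (sym (trans (cong (λ x → x ℤ.+ 1V 0 n a) (V.mul-X D 0 n a)) (trans (ℤₚ.+-identityˡ _) (one n a))))
  where
  one : ∀ n a → 1V 0 n a ≡ c 0 n a
  one zero    a = refl
  one (suc n) a = refl
C≈ (suc b) n a = sym (trans (cong₂ ℤ._+_ (V.mul-X D (suc b) n a) refl) (ℤₚ.+-identityʳ _))

module RSolver = SemiringSolver RR.commutativeSemiring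

-- The powers (tu)ᵏ⁺¹ and (tu)ˡ with k + l = b combine to (tu)ᵇ⁺¹.
gf-mul-suc : ∀ f g b → V.mul (gf f ∘ suc) (gf g) b RR.≈ R.mul (V.pow z (suc b)) (V.mul (f ∘ suc) g b)
gf-mul-suc f g b = RR.trans {V.mul (gf f ∘ suc) (gf g) b}
  (V.mul-cong {gf f ∘ suc} {λ b → R.mul z (gf (f ∘ suc) b)} {gf g} (λ b → RR.*-assoc z (V.pow z b) (f (suc b))) (λ _ _ _ → refl) b)
  (RR.trans {V.mul (λ b → R.mul z (gf (f ∘ suc) b)) (gf g) b} (V.mul-scaleˡ z (gf (f ∘ suc)) (gf g) b)
    (RR.trans {R.mul z (V.mul (gf (f ∘ suc)) (gf g) b)}
      (R.mul-cong {z} (λ _ _ → refl) (RR.sym {R.mul (V.pow z b) (V.mul (f ∘ suc) g b)} (V.scale-mul z (f ∘ suc) g b)))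
      (RR.sym {R.mul (V.pow z (suc b)) (V.mul (f ∘ suc) g b)} (RR.*-assoc z (V.pow z b) (V.mul (f ∘ suc) g b)))))

private
  E : ℕ → ℕ → Poly
  E = VR._+_ (VR._*_ D H⁺) (VR._*_ Y G⁺)

  tV uV : ℕ → ℕ → Poly
  tV = V.const tR
  uV = V.const uR

-- `conv` at b involves pairs with k + l = b - 1, so after the substitution it is vE; the separate
-- factor tu comes from the maximum.
z-pow-conv : ∀ b → R.mul z (R.mul (V.pow z b) (conv b)) RR.≈ V.mul (V.const z) (V.shift E) b
z-pow-conv zero = RR.trans {R.mul z (R.mul (V.pow z 0) (conv 0))} {R.mul z RR.0#}
  (R.mul-cong {z} (λ _ _ → refl) (RR.zeroʳ (V.pow z 0))) (λ _ _ → refl)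
z-pow-conv (suc b) = RR.trans {R.mul z (R.mul (V.pow z (suc b)) (conv (suc b)))} {R.mul z (E b)}
  (R.mul-cong {z} (λ _ _ → refl) (RR.trans {R.mul p (RR._+_ A B)} (RR.distribˡ p A B)
    (RR.sym {E b} (RR.+-cong {V.mul D H⁺ b} (gf-mul-suc c h⁺ b) (gf-mul-suc h⁺ g⁺ b)))))
  (RR.sym {V.mul (V.const z) (V.shift E) (suc b)} (V.mul-const z (V.shift E) (suc b)))
  where
  p = V.pow z (suc b)
  A = V.mul (c ∘ suc) h⁺ b
  B = V.mul (h⁺ ∘ suc) g⁺ b

h-recurrence′ : ∀ b → h b RR.≈ RR._+_ (c b) (RR._+_ (R.mul z (h (suc b))) (R.mul z (conv b)))
h-recurrence′ b n a = trans (h-recurrence b n a)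
  (cong₂ (λ x y → c b n a ℤ.+ (x ℤ.+ y)) (sym (mul-z (h (suc b)) n a)) (sym (mul-z (conv b) n a)))

tuvE : VR._*_ (VR._*_ (VR._*_ tV uV) V.X) E ≈V V.mul (V.const z) (V.shift E)
tuvE = VR.trans {VR._*_ (VR._*_ (VR._*_ tV uV) V.X) E} (VR.*-assoc (VR._*_ tV uV) V.X E)
  (VR.*-cong {VR._*_ tV uV} (VR.sym {V.const z} (V.const-* tR uR)) (V.mul-X E))

H-recurrence : H ≈V VR._+_ (VR._+_ P C) (VR._*_ (VR._*_ (VR._*_ tV uV) V.X) E)
H-recurrence b = RR.trans {H b} {R.mul p (RR._+_ (c b) (RR._+_ (R.mul z (h (suc b))) (R.mul z (conv b))))}
  (R.mul-cong {p} (λ _ _ → refl) (h-recurrence′ b))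
  (RR.trans {R.mul p (RR._+_ (c b) (RR._+_ (R.mul z (h (suc b))) (R.mul z (conv b))))}
    (solve 5 (λ p c z h k → p :* (c :+ (z :* h :+ z :* k)) := (z :* p :* h :+ p :* c) :+ z :* (p :* k))
      (λ _ _ → refl) p (c b) z (h (suc b)) (conv b))
    (RR.+-cong {RR._+_ (P b) (C b)} (λ _ _ → refl)
      (RR.trans {R.mul z (R.mul p (conv b))} (z-pow-conv b) (RR.sym {VR._*_ (VR._*_ (VR._*_ tV uV) V.X) E b} (tuvE b)))))
  where
  open RSolver
  p = V.pow z b

mul-uV : ∀ f b n a → V.mul uV f b n a ≡ U.shift (f b n) a
mul-uV f b n a = trans (V.mul-const uR f b n a) (mul-uR (f b) n a)

Ju1+vP+1≡H : VR._+_ (τ Ju1) (VR._+_ (VR._*_ V.X P) 1V) ≈V H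
Ju1+vP+1≡H b n a = trans (rearrange (τ Ju1 b n a) (V.mul V.X P b n a) (1V b n a))
  (trans (cong₂ ℤ._+_ (Ju1+1 b n a) (V.mul-X P b n a)) (go b))
  where
  rearrange : ∀ x y o → x ℤ.+ (y ℤ.+ o) ≡ (x ℤ.+ o) ℤ.+ y
  rearrange = ℤSolver.solve-∀
  go : ∀ b → V.const (h 0) b n a ℤ.+ V.shift P b n a ≡ H b n a
  go zero    = trans (ℤₚ.+-identityʳ (h 0 n a)) (sym (gf-0 h n a))
  go (suc b) = ℤₚ.+-identityˡ (P b n a)

-- Neighbouring coefficients of `P` differ by the corresponding coefficient of J(t,u,1) - J, so
-- `V.geometric` with ratio 1 applies.
quotient-1-v : VR._*_ (VR._-_ (τ Ju1) (τ J)) (V.pow RR.1#) ≈V P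
quotient-1-v = VR.trans {VR._*_ (VR._-_ (τ Ju1) (τ J)) (V.pow RR.1#)} (VR.*-comm (VR._-_ (τ Ju1) (τ J)) (V.pow RR.1#))
  (V.geometric RR.1# (VR._-_ (τ Ju1) (τ J)) P
    (λ b n a → trans (step {τ Ju1 (suc b) n a} {τ J (suc b) n a} {P (suc b) n a} (Ju1+1 (suc b) n a) (J+P+1≡H (suc b) n a))
      (cong (λ z → (τ Ju1 (suc b) n a ℤ.- τ J (suc b) n a) ℤ.+ z) (sym (R.mul-identityˡ (P b) n a))))
    (λ n a → start {τ Ju1 0 n a} {τ J 0 n a} {P 0 n a} {1V 0 n a} (Ju1+1 0 n a) (trans (J+P+1≡H 0 n a) (gf-0 h n a))))
  where
  step : ∀ {j₁ j p′ p} → j₁ ℤ.+ + 0 ≡ + 0 → j ℤ.+ (p′ ℤ.+ + 0) ≡ p → p′ ≡ (j₁ ℤ.- j) ℤ.+ p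
  step {j₁} {j} {p′} e₁ refl = trans (sym (ℤₚ.+-identityˡ p′)) (trans (cong (λ x → x ℤ.+ p′) (sym e₁)) (eq j₁ j p′))
    where
    eq : ∀ j₁ j p′ → (j₁ ℤ.+ + 0) ℤ.+ p′ ≡ (j₁ ℤ.- j) ℤ.+ (j ℤ.+ (p′ ℤ.+ + 0))
    eq = ℤSolver.solve-∀
  start : ∀ {j₁ j p o w} → j₁ ℤ.+ o ≡ w → j ℤ.+ (p ℤ.+ o) ≡ w → p ≡ j₁ ℤ.- j
  start {j₁} {j} {p} {o} e₁ e₂ = trans (eq₁ j p o) (trans (cong (λ x → (x ℤ.- o) ℤ.- j) (trans e₂ (sym e₁))) (eq₂ j₁ j o))
    where
    eq₁ : ∀ j p o → p ≡ ((j ℤ.+ (p ℤ.+ o)) ℤ.- o) ℤ.- j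
    eq₁ = ℤSolver.solve-∀
    eq₂ : ∀ j₁ j o → ((j₁ ℤ.+ o) ℤ.- o) ℤ.- j ≡ j₁ ℤ.- j
    eq₂ = ℤSolver.solve-∀

private
  add-sub : ∀ {x o w} → x ℤ.+ o ≡ w → w ℤ.- o ≡ x
  add-sub {x} {o} refl = eq x o
    where
    eq : ∀ x o → (x ℤ.+ o) ℤ.- o ≡ x
    eq = ℤSolver.solve-∀

quotient-1-v′ : VR._*_ (VR._-_ (τ Ju1) (VR._*_ V.X (τ J))) (V.pow RR.1#) ≈V VR._-_ H 1V
quotient-1-v′ = VR.trans {VR._*_ F (V.pow RR.1#)} (VR.*-comm F (V.pow RR.1#))
  (V.geometric RR.1# F (VR._-_ H 1V)
    (λ b n a → trans (step {τ Ju1 (suc b) n a} {τ J b n a} {P b n a} {1V b n a} (Ju1+1 (suc b) n a) (J+P+1≡H b n a)) (sym (cong₂ ℤ._+_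
      (cong (λ x → τ Ju1 (suc b) n a ℤ.- x) (V.mul-X (τ J) (suc b) n a))
      (R.mul-identityˡ (VR._-_ H 1V b) n a))))
    (λ n a → trans (add-sub {τ Ju1 0 n a} {1V 0 n a} (trans (Ju1+1 0 n a) (sym (gf-0 h n a))))
      (sym (trans (cong (λ x → τ Ju1 0 n a ℤ.- x) (V.mul-X (τ J) 0 n a)) (ℤₚ.+-identityʳ (τ Ju1 0 n a))))))
  where
  F = VR._-_ (τ Ju1) (VR._*_ V.X (τ J))
  step : ∀ {j₁ j p o w} → j₁ ℤ.+ + 0 ≡ + 0 → j ℤ.+ (p ℤ.+ o) ≡ w → p ℤ.- + 0 ≡ (j₁ ℤ.- j) ℤ.+ (w ℤ.- o)
  step {j₁} {j} {p} {o} e₁ refl = trans (cong (λ x → x ℤ.- + 0) (sym (ℤₚ.+-identityˡ p)))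
    (trans (cong (λ x → x ℤ.+ p ℤ.- + 0) (sym e₁)) (eq j₁ j p o))
    where
    eq : ∀ j₁ j p o → (j₁ ℤ.+ + 0) ℤ.+ p ℤ.- + 0 ≡ (j₁ ℤ.- j) ℤ.+ (j ℤ.+ (p ℤ.+ o) ℤ.- o)
    eq = ℤSolver.solve-∀

-- The ratio is now u, since 1/(1 - uv) as a series in v has coefficients uᵇ; `M+uJ1uv` supplies the
-- recurrence.
quotient-1-uv : VR._*_ (VR._-_ (τ J11) (VR._*_ (VR._*_ uV V.X) (τ J1uv))) (V.pow uR) ≈V VR._-_ M 1V
quotient-1-uv = VR.trans {VR._*_ F (V.pow uR)} (VR.*-comm F (V.pow uR))
  (V.geometric uR F (VR._-_ M 1V)
    (λ b n a → trans (step b n a) (sym (cong₂ ℤ._+_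
      (cong₂ ℤ._-_ (at-suc b n a) (uvJ (suc b) n a)) (mul-uR (VR._-_ M 1V b) n a))))
    (λ n a → trans (add-sub {τ J11 0 n a} {1V 0 n a} (trans (J11+1 0 n a) (sym (gf-0 κ n a))))
      (sym (trans (cong (λ x → τ J11 0 n a ℤ.- x) (uvJ 0 n a)) (ℤₚ.+-identityʳ (τ J11 0 n a))))))
  where
  F = VR._-_ (τ J11) (VR._*_ (VR._*_ uV V.X) (τ J1uv))

  uvJ : ∀ b n a → VR._*_ (VR._*_ uV V.X) (τ J1uv) b n a ≡ V.shift (λ b n → U.shift (τ J1uv b n)) b n a
  uvJ b n a = trans (VR.*-assoc uV V.X (τ J1uv) b n a) (trans (mul-uV (V.mul V.X (τ J1uv)) b n a)
    (trans (U.shift-cong (V.mul-X (τ J1uv) b n) a) (go b a)))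
    where
    go : ∀ b a → U.shift (V.shift (τ J1uv) b n) a ≡ V.shift (λ b n → U.shift (τ J1uv b n)) b n a
    go zero    zero    = refl
    go zero    (suc a) = refl
    go (suc b) a       = refl

  at-suc : ∀ b n a → τ J11 (suc b) n a ≡ + 0
  at-suc b n a = trans (sym (ℤₚ.+-identityʳ (τ J11 (suc b) n a))) (J11+1 (suc b) n a)

  step : ∀ b n a → M (suc b) n a ℤ.- + 0 ≡ (+ 0 ℤ.- U.shift (τ J1uv b n) a) ℤ.+ U.shift (λ a → M b n a ℤ.- 1V b n a) a
  step b n zero    = trans (ℤₚ.+-identityʳ (M (suc b) n 0)) (trans (sym (ℤₚ.+-identityʳ (M (suc b) n 0))) (M+uJ1uv b n zero))
  step b n (suc a) = eq {M (suc b) n (suc a)} {τ J1uv b n a} {1V b n a} (M+uJ1uv b n (suc a))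
    where
    eq : ∀ {m j o w} → m ℤ.+ (j ℤ.+ o) ≡ w → m ℤ.- + 0 ≡ (+ 0 ℤ.- j) ℤ.+ (w ℤ.- o)
    eq {m} {j} {o} refl = poly m j o
      where
      poly : ∀ m j o → m ℤ.- + 0 ≡ (+ 0 ℤ.- j) ℤ.+ (m ℤ.+ (j ℤ.+ o) ℤ.- o)
      poly = ℤSolver.solve-∀

M+uG≡G+uH : VR._+_ M (VR._*_ uV G) ≈V VR._+_ G (VR._*_ uV H)
M+uG≡G+uH b = RR.trans {VR._+_ M (VR._*_ uV G) b} {RR._+_ (M b) (R.mul uR (G b))}
  (RR.+-cong {M b} (λ _ _ → refl) (V.mul-const uR G b))
  (RR.trans {RR._+_ (M b) (R.mul uR (G b))}
    (solve 4 (λ p k u g → p :* k :+ u :* (p :* g) := p :* (k :+ u :* g)) (λ _ _ → refl) p (κ b) uR (g b))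
    (RR.trans {R.mul p (RR._+_ (κ b) (R.mul uR (g b)))} {R.mul p (RR._+_ (g b) (R.mul uR (h b)))}
      (R.mul-cong {p} (λ _ _ → refl) core)
      (RR.trans {R.mul p (RR._+_ (g b) (R.mul uR (h b)))}
        (solve 4 (λ p k u g → p :* (k :+ u :* g) := p :* k :+ u :* (p :* g)) (λ _ _ → refl) p (g b) uR (h b))
        (RR.+-cong {G b} (λ _ _ → refl) (RR.sym {V.mul uV H b} (V.mul-const uR H b))))))
  where
  open RSolver
  p = V.pow z b
  core : RR._+_ (κ b) (R.mul uR (g b)) RR.≈ RR._+_ (g b) (R.mul uR (h b))
  core n a = trans (cong (λ x → κ b n a ℤ.+ x) (mul-uR (g b) n a))
    (trans (κ+ug b n a) (cong (λ x → g b n a ℤ.+ x) (sym (mul-uR (h b) n a))))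

-- The factor 1/(1 - u) is constant in v and t, so the quotient is taken in each coefficient
-- separately, in the innermost ring.
quotient-1-u : VR._*_ (V.const (R.const (U.pow (+ 1)))) (VR._-_ (VR._-_ M 1V) (VR._*_ uV (VR._-_ H 1V))) ≈V VR._-_ G 1V
quotient-1-u b n a = trans (V.mul-const (R.const (U.pow (+ 1))) F b n a)
  (trans (R.mul-const (U.pow (+ 1)) (F b) n a)
    (U.geometric (+ 1) (F b n) (VR._-_ G 1V b n) (λ a → trans (step a) (cong (λ x → F b n (suc a) ℤ.+ x) (sym (ℤₚ.*-identityˡ _)))) start a))
  where
  F = VR._-_ (VR._-_ M 1V) (VR._*_ uV (VR._-_ H 1V))

  relation : ∀ a → M b n a ℤ.+ U.shift (G b n) a ≡ G b n a ℤ.+ U.shift (H b n) a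
  relation a = trans (cong (λ x → M b n a ℤ.+ x) (sym (mul-uV G b n a)))
    (trans (M+uG≡G+uH b n a) (cong (λ x → G b n a ℤ.+ x) (mul-uV H b n a)))

  start : VR._-_ G 1V b n 0 ≡ F b n 0
  start = trans (cong (λ x → x ℤ.- 1V b n 0) (trans (sym (ℤₚ.+-identityʳ (G b n 0))) (trans (sym (relation 0)) (ℤₚ.+-identityʳ (M b n 0)))))
    (trans (sym (ℤₚ.+-identityʳ (M b n 0 ℤ.- 1V b n 0))) (cong (λ x → (M b n 0 ℤ.- 1V b n 0) ℤ.- x) (sym (mul-uV (VR._-_ H 1V) b n 0))))

  step : ∀ a → VR._-_ G 1V b n (suc a) ≡ F b n (suc a) ℤ.+ VR._-_ G 1V b n a
  step a = trans (eq {M b n (suc a)} {G b n a} {G b n (suc a)} {H b n a} {1V b n a} {1V b n (suc a)} (relation (suc a)))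
    (cong (λ x → ((M b n (suc a) ℤ.- 1V b n (suc a)) ℤ.- x) ℤ.+ VR._-_ G 1V b n a)
    (sym (mul-uV (VR._-_ H 1V) b n (suc a))))
    where
    eq : ∀ {m g g′ h o o′} → m ℤ.+ g ≡ g′ ℤ.+ h → g′ ℤ.- o′ ≡ ((m ℤ.- o′) ℤ.- (h ℤ.- o)) ℤ.+ (g ℤ.- o)
    eq {m} {g} {g′} {h} {o} {o′} e = trans (poly₁ g′ h o′) (trans (cong (λ x → x ℤ.- h ℤ.- o′) (sym e)) (poly₂ m g h o o′))
      where
      poly₁ : ∀ g′ h o′ → g′ ℤ.- o′ ≡ g′ ℤ.+ h ℤ.- h ℤ.- o′
      poly₁ = ℤSolver.solve-∀
      poly₂ : ∀ m g h o o′ → m ℤ.+ g ℤ.- h ℤ.- o′ ≡ ((m ℤ.- o′) ℤ.- (h ℤ.- o)) ℤ.+ (g ℤ.- o)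
      poly₂ = ℤSolver.solve-∀

zshifts-const : ∀ x b n a → zshifts b (R.const (U.const x)) n a ≡ (if (a ≡ᵇ n) ∧ (b ≡ᵇ n) then x else + 0)
zshifts-const x zero    zero    zero    = refl
zshifts-const x zero    zero    (suc a) = refl
zshifts-const x zero    (suc n) zero    = refl
zshifts-const x zero    (suc n) (suc a) = cong (λ β → if β then x else + 0) (sym (Bₚ.∧-zeroʳ (a ≡ᵇ n)))
zshifts-const x (suc b) zero    zero    = refl
zshifts-const x (suc b) zero    (suc a) = refl
zshifts-const x (suc b) (suc n) zero    = refl
zshifts-const x (suc b) (suc n) (suc a) = zshifts-const x b n a

τ-Ctuv : τ Ctuv ≈V C
τ-Ctuv b n a = sym (trans (pow-z b (c b) n a) (trans (zshifts-const (catalanCount b) b n a) go))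
  where
  go : (if (a ≡ᵇ n) ∧ (b ≡ᵇ n) then catalanCount b else + 0) ≡ (if (a ≡ᵇ n) ∧ (b ≡ᵇ n) then + catalan n else + 0)
  go with b ≡ᵇ n in eq
  ... | false rewrite Bₚ.∧-zeroʳ (a ≡ᵇ n) = refl
  ... | true  = cong (λ w → if (a ≡ᵇ n) ∧ true then w else + 0)
    (trans (catalanCount≡catalan b) (cong (λ k → + catalan k) (ℕₚ.≡ᵇ⇒≡ b n (subst T (sym eq) tt))))

module _ {F F′ : Series} {f f′ : ℕ → ℕ → Poly} (p : τ F ≈V f) (p′ : τ F′ ≈V f′) where
  τ-mul : τ (F ⊛ F′) ≈V VR._*_ f f′
  τ-mul b n a = trans (τ-⊛ F F′ b n a) (V.mul-cong p p′ b n a)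

  τ-add : τ (F ⊕ F′) ≈V VR._+_ f f′
  τ-add b n a = cong₂ ℤ._+_ (p b n a) (p′ b n a)

  τ-sub : τ (F ⊖ F′) ≈V VR._-_ f f′
  τ-sub b n a = cong₂ ℤ._-_ (p b n a) (p′ b n a)

≈V-refl : ∀ {f} → f ≈V f
≈V-refl b n a = refl

theorem2p4 : J ≋ (Ctuv ⊖ 𝟙) ⊛ (𝟙 ⊕ tS ⊛ uS ⊛ Ju1)
    ⊕ tS ⊛ uS ⊛ vS ⊛ inv1-u
    ⊛ ((Ju1 ⊖ J) ⊛ inv1-v ⊖ divV (Ctuv ⊖ 𝟙))
    ⊛ ((J11 ⊖ uS ⊛ vS ⊛ J1uv) ⊛ inv1-uv ⊖ uS ⊛ (Ju1 ⊖ vS ⊛ J) ⊛ inv1-v)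
theorem2p4 n a b = trans
  (FinalStep.functional-equation V.psRing {tV} {uV} {V.X} {iu} {τ J} {τ Ju1} {P} {H} {H⁺} {C} {D} {Y} {G⁺} {left} {right}
    J+P+1≡H Ju1+vP+1≡H H≈ C≈ H-recurrence (λ b → H≈ (suc b))
    (VR.+-cong {VR._*_ (VR._-_ (τ Ju1) (τ J)) iv} quotient-1-v ≈V-refl)
    -- The second bracket is (M - 1) - u(H - 1), which over 1 - u gives G - 1 with G = G⁺ + C.
    (VR.trans {VR._*_ iu right} (VR.*-cong {iu} ≈V-refl right≈)
      (VR.trans {VR._*_ iu (VR._-_ (VR._-_ M 1V) (VR._*_ uV (VR._-_ H 1V)))} quotient-1-u
      (VR.+-cong {G} G≈ ≈V-refl))) b n a)
  (sym (transfer b n a))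
  where
  iu iv left right : ℕ → ℕ → Poly
  iu    = V.const (R.const (U.pow (+ 1)))
  iv    = V.pow RR.1#
  left  = VR._-_ (VR._*_ (VR._-_ (τ Ju1) (τ J)) iv) D
  right = VR._-_ (VR._*_ (VR._-_ (τ J11) (VR._*_ (VR._*_ uV V.X) (τ J1uv))) (V.pow uR))
                 (VR._*_ (VR._*_ uV (VR._-_ (τ Ju1) (VR._*_ V.X (τ J)))) iv)

  right≈ : right ≈V VR._-_ (VR._-_ M 1V) (VR._*_ uV (VR._-_ H 1V))
  right≈ b n a = cong₂ ℤ._-_ (quotient-1-uv b n a)
    (trans (VR.*-assoc uV (VR._-_ (τ Ju1) (VR._*_ V.X (τ J))) iv b n a) (VR.*-cong {uV} ≈V-refl quotient-1-v′ b n a))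

  transfer : τ ((Ctuv ⊖ 𝟙) ⊛ (𝟙 ⊕ tS ⊛ uS ⊛ Ju1)
      ⊕ tS ⊛ uS ⊛ vS ⊛ inv1-u
      ⊛ ((Ju1 ⊖ J) ⊛ inv1-v ⊖ divV (Ctuv ⊖ 𝟙))
      ⊛ ((J11 ⊖ uS ⊛ vS ⊛ J1uv) ⊛ inv1-uv ⊖ uS ⊛ (Ju1 ⊖ vS ⊛ J) ⊛ inv1-v))
    ≈V VR._+_ (VR._*_ (VR._-_ C 1V) (VR._+_ 1V (VR._*_ (VR._*_ tV uV) (τ Ju1))))
              (VR._*_ (VR._*_ (VR._*_ (VR._*_ (VR._*_ tV uV) V.X) iu) left) right)
  transfer =
    τ-add (τ-mul (τ-sub τ-Ctuv τ𝟙) (τ-add τ𝟙 (τ-mul (τ-mul τt τu) (≈V-refl {τ Ju1}))))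
      (τ-mul (τ-mul (τ-mul (τ-mul (τ-mul τt τu) τv) τ-inv1-u)
        (τ-sub (τ-mul (τ-sub (≈V-refl {τ Ju1}) (≈V-refl {τ J})) τ-inv1-v) τ-D))
        (τ-sub (τ-mul (τ-sub (≈V-refl {τ J11}) (τ-mul (τ-mul τu τv) (≈V-refl {τ J1uv}))) τ-inv1-uv)
          (τ-mul (τ-mul τu (τ-sub (≈V-refl {τ Ju1}) (τ-mul τv (≈V-refl {τ J})))) τ-inv1-v)))
    where
    -- The subtracted 1 affects only the constant coefficient in v, which `divV` discards.
    τ-D : τ (divV (Ctuv ⊖ 𝟙)) ≈V D
    τ-D b n a = trans (cong₂ ℤ._-_ (τ-Ctuv (suc b) n a) (τ𝟙 (suc b) n a)) (ℤₚ.+-identityʳ (C (suc b) n a))
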